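{- Let $n\ge1$ and let $c$ be a standard Coxeter element of $\mathfrak S_{n+1}$. The map $\varphi:=g\circ\psi_2:\mathsf{NC}(\mathfrak S_{n+1},c)\to\mathsf{FC}(\mathfrak S_{n+1})$ is a bijection. It is characterized as follows. Let $x\in\mathsf{NC}(\mathfrak S_{n+1},c)$ and $k\in[n+1]$. Then $k\in J_{\varphi(x)}$ if and only if one of the following holds: (i) $k\in R_c\cap D_x^c$; (ii) $k\in L_c$ and $k$ is an initial index of a polygon of $x$; (iii) $k\in L_c$, $k\notin\mathsf{supp}(x)$ and $k$ is nested in a polygon of $x$. Moreover $k-1\in I_{\varphi(x)}$ if and only if one of the following holds: (i') $k\in R_c\cap U_x^c$; (ii') $k\in L_c$ and $k$ is a terminal index of a polygon of $x$; (iii') $k\in L_c$, $k\notin\mathsf{supp}(x)$ and $k$ is nested in a polygon of $x$.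
   Context: Write $[n+1]=\{1,\dots,n+1\}$, $s_i=(i,i+1)\in\mathfrak S_{n+1}$, $\mathcal S=\{s_1,\dots,s_n\}$. Permutations are composed right to left. $\ell_{\mathcal T}(w)$ is the minimal number of transpositions needed to write $w$, and $u\leq_{\mathcal T}v$ iff $\ell_{\mathcal T}(u)+\ell_{\mathcal T}(u^{ -1}v)=\ell_{\mathcal T}(v)$. A standard Coxeter element $c$ is a product of $s_1,\dots,s_n$, each once, in some order; it is an $(n+1)$-cycle $c=(i_1,\dots,i_{n+1})$ with $i_1=1$, $i_k=n+1$, $i_1<\dots<i_k$ and $i_k>i_{k+1}>\dots>i_{n+1}$. Put $R_c=\{i_1,\dots,i_k\}$, $L_c=\{i_k,\dots,i_{n+1},i_1\}$. $\mathsf{NC}(\mathfrak S_{n+1},c)=\{u:u\leq_{\mathcal T}c\}$. Label $n+1$ points on a circle clockwise by $i_1,\dots,i_{n+1}$; for $x\in\mathsf{NC}(\mathfrak S_{n+1},c)$, each nontrivial cycle of $x$ is represented by the convex hull of the points in its support, and these "polygons" (edges count as polygons, single points do not) are pairwise disjoint; conversely every such collection of pairwise disjoint polygons represents a unique element of $\mathsf{NC}(\mathfrak S_{n+1},c)$ (each cycle being obtained by going clockwise around its polygon). $\mathsf{Pol}(x)$ is the set of polygons of $x$, $\mathsf{Vert}(P)$ the set of labels of vertices of $P$; $\min P$ (resp. $\max P$), the smallest (resp. largest) element of $\mathsf{Vert}(P)$, is the initial (resp. terminal) index of $P$. An index $\ell$ is nested in $P$ if $\ell\notin\mathsf{Vert}(P)$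 and $\min P<\ell<\max P$. $\mathsf{supp}(x)$ is the set of non-fixed points of $x$, $D_x^c=\mathsf{supp}(x)\setminus\{\text{terminal indices of polygons of }x\}$, $U_x^c=\mathsf{supp}(x)\setminus\{\text{initial indices of polygons of }x\}$. The set $\mathcal I(n)$: pairs $(D,U)$ of subsets of $[n+1]$ with $|D|=|U|=k$ for some $0\le k\le n$, $D=\{d_1<\dots<d_k\}$, $U=\{u_1<\dots<u_k\}$ and $d_i<u_i$ for all $i$. The map $\psi_1:\mathsf{NC}(\mathfrak S_{n+1},c)\to\mathcal I(n)$, $x\mapsto(D_x^c,U_x^c)$ is a bijection. The involution $\mathsf{inv}_c$ of $\mathsf{NC}(\mathfrak S_{n+1},c)$: put $M_x^c=D_x^c\cap U_x^c\cap L_c$ and let $N_x^c$ be the set of $k\in L_c\setminus\mathsf{supp}(x)$ nested in at least one polygon of $x$. For $k\in N_x^c$ there is a unique polygon $P\in\mathsf{Pol}(x)$ in which $k$ is nested such that replacing $P$ by the polygon with vertex set $\mathsf{Vert}(P)\cup\{k\}$ keeps the diagram noncrossing. Adding in this way, one after the other, all $k\in N_x^c$ to polygons of $x$ (the result does not depend on the order) yields $x'\in\mathsf{NC}(\mathfrak S_{n+1},c)$; removing then from the polygons of $x'$ all vertices with label in $M_x^c$ yields $\mathsf{inv}_c(x)\in\mathsf{NC}(\mathfrak S_{n+1},c)$. Define $\psi_2(x)=\psi_1(\mathsf{inv}_c(x))$. Fully commutative elements: $w\in\mathfrak S_{n+1}$ is fully commutative if any two $\mathcal S$-reduced expressions of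 $w$ are related by commutations of adjacent letters; $\mathsf{FC}(\mathfrak S_{n+1})$ is the set of these. Each such $w$ has a unique reduced expression (normal form) $(s_{i_1}s_{i_1-1}\cdots s_{j_1})\cdots(s_{i_k}s_{i_k-1}\cdots s_{j_k})$ with $i_1<\dots<i_k$, $j_1<\dots<j_k$, $j_m\le i_m$ for all $m$, and conversely every such word is a reduced expression of a fully commutative element; put $I_w=\{i_1,\dots,i_k\}$, $J_w=\{j_1,\dots,j_k\}$, $I_w[1]=\{i_1+1,\dots,i_k+1\}$. The map $g:\mathcal I(n)\to\mathsf{FC}(\mathfrak S_{n+1})$ is the bijection sending $(J_w,I_w[1])$ to $w$. -}

module Defs where

open import Data.Nat as ℕ using (ℕ; zero; suc)
open import Data.Nat.GeneralisedArithmetic using (iterate)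
open import Data.Fin using (Fin; zero; suc; inject₁; fromℕ; _<_; _≤_)
open import Data.Fin.Permutation using
  (Permutation′; _⟨$⟩ʳ_; _∘ₚ_; flip; transpose; _≈_)
  renaming (id to idₚ)
open import Data.Fin.Subset using (Subset; _∈_; _∉_; _∪_; ⁅_⁆)
open import Data.List using (List; []; _∷_; _++_; map; foldr; length; concat; tabulate; allFin)
open import Data.List.Membership.Propositional using () renaming (_∈_ to _∈ₗ_)
open import Data.List.Relation.Binary.Permutation.Propositional using (_↭_)
open import Data.List.Relation.Unary.All using (All)
open import Data.List.Relation.Unary.Unique.Propositional using (Unique)
open import Data.Product using (Σ; ∃; ∃₂; _×_; _,_; proj₁)
open import Data.Sum using (_⊎_)
open import Function using (_⇔_)
open import Level using (0ℓ)
open import Relation.Binary using (Setoid)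
open import Relation.Binary.Construct.Closure.Equivalence using (EqClosure)
import Relation.Binary.Construct.On as On
open import Relation.Binary.PropositionalEquality using (_≡_; _≢_; refl; sym; trans)
open import Relation.Nullary using (¬_)
open import Relation.Unary using (Pred; _≐_)

-- Conventions. The label k ∈ [n+1] = {1,…,n+1} is the element of Fin (suc n)
-- with toℕ equal to k − 1, and the index i ∈ {1,…,n} of s_i is the element of
-- Fin n with toℕ equal to i − 1. Thus i ∈ {1,…,n}, viewed in [n+1], is
-- inject₁ i, and i + 1 ∈ [n+1] is suc i.

private
  variable
    m n : ℕ

infixr 7 _·_

-- Composition from right to left (the library's _∘ₚ_ composes left to right).
_·_ : Permutation′ m → Permutation′ m → Permutation′ m
u · v = v ∘ₚ u

product : List (Permutation′ m) → Permutation′ m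
product = foldr _·_ idₚ

Permutations : ℕ → Setoid 0ℓ 0ℓ
Permutations m = record
  { Carrier       = Permutation′ m
  ; _≈_           = _≈_
  ; isEquivalence = record
    { refl  = λ _ → refl
    ; sym   = λ p i → sym (p i)
    ; trans = λ p q i → trans (p i) (q i)
    }
  }

IsTransposition : Pred (Permutation′ m) 0ℓ
IsTransposition t = ∃₂ λ a b → a ≢ b × t ≈ transpose a b

TranspositionWord : Permutation′ m → Pred (List (Permutation′ m)) 0ℓ
TranspositionWord w ts = All IsTransposition ts × product ts ≈ w

-- AbsLength w l  means  ℓ_T(w) = l.
AbsLength : Permutation′ m → Pred ℕ 0ℓ
AbsLength w l =
  (∃ λ ts → TranspositionWord w ts × length ts ≡ l) ×
  (∀ ts → TranspositionWord w ts → l ℕ.≤ length ts)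

_≤T_ : Permutation′ m → Permutation′ m → Set
u ≤T v = ∃₂ λ a b →
  AbsLength u a × AbsLength (flip u · v) b × AbsLength v (a ℕ.+ b)

s : Fin n → Permutation′ (suc n)
s i = transpose (inject₁ i) (suc i)

⟦_⟧ : List (Fin n) → Permutation′ (suc n)
⟦ is ⟧ = product (map s is)

StandardCoxeter : Pred (Permutation′ (suc n)) 0ℓ
StandardCoxeter {n} c = ∃ λ is → is ↭ allFin n × ⟦ is ⟧ ≈ c

NC : Permutation′ (suc n) → Setoid 0ℓ 0ℓ
NC {n} c = On.setoid {B = Σ (Permutation′ (suc n)) (_≤T c)} (Permutations (suc n)) proj₁

-- at c a  is  i_{a+1} = cᵃ(1); in particular  at c (suc n)  is i_1 again.
at : Permutation′ (suc n) → ℕ → Fin (suc n)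
at c = iterate (c ⟨$⟩ʳ_) zero

-- In both sets, the natural number e is the position of the label n+1.
R : Permutation′ (suc n) → Pred (Fin (suc n)) 0ℓ
R {n} c v = ∃ λ e → e ℕ.≤ n × at c e ≡ fromℕ n ×
  ∃ λ a → a ℕ.≤ e × at c a ≡ v

L : Permutation′ (suc n) → Pred (Fin (suc n)) 0ℓ
L {n} c v = ∃ λ e → e ℕ.≤ n × at c e ≡ fromℕ n ×
  ∃ λ a → e ℕ.≤ a × a ℕ.≤ suc n × at c a ≡ v

-- A polygon is given by its set of vertices, a diagram by its set of polygons.
Diagram : ℕ → Set₁
Diagram n = Pred (Subset (suc n)) 0ℓ

supp : Permutation′ m → Pred (Fin m) 0ℓ
supp x k = x ⟨$⟩ʳ k ≢ k

Pol : Permutation′ (suc n) → Diagram n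
Pol x P = ∃ λ p → supp x p × (∀ q → q ∈ P ⇔ (∃ λ a → iterate (x ⟨$⟩ʳ_) p a ≡ q))

IsMin IsMax : Subset m → Pred (Fin m) 0ℓ
IsMin P k = k ∈ P × (∀ {q} → q ∈ P → k ≤ q)
IsMax P k = k ∈ P × (∀ {q} → q ∈ P → q ≤ k)

Initial Terminal : Permutation′ (suc n) → Pred (Fin (suc n)) 0ℓ
Initial  x k = ∃ λ P → Pol x P × IsMin P k
Terminal x k = ∃ λ P → Pol x P × IsMax P k

NestedIn : Fin m → Subset m → Set
NestedIn k P = k ∉ P × (∃ λ a → IsMin P a × a < k) × (∃ λ b → IsMax P b × k < b)

-- The convex hulls of the vertex sets P and Q meet exactly when P and Q have a
-- common vertex or an edge or diagonal of one crosses one of the other; the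
-- latter is stated with the positions of the labels on the circle.
Crosses : Permutation′ (suc n) → Subset (suc n) → Subset (suc n) → Set
Crosses {n} c P Q = ∃₂ λ a b → ∃₂ λ a′ b′ →
  a ℕ.< b × b ℕ.< a′ × a′ ℕ.< b′ × b′ ℕ.≤ n ×
  at c a ∈ P × at c b ∈ Q × at c a′ ∈ P × at c b′ ∈ Q

DisjointPolygons : Permutation′ (suc n) → Subset (suc n) → Subset (suc n) → Set
DisjointPolygons c P Q =
  (∀ {v} → v ∈ P → v ∉ Q) × ¬ Crosses c P Q × ¬ Crosses c Q P

Noncrossing : Permutation′ (suc n) → Diagram n → Set
Noncrossing c 𝒫 = ∀ P Q → 𝒫 P → 𝒫 Q → P ≢ Q → DisjointPolygons c P Q

-- y is the element of NC(𝔖_{n+1}, c) represented by the diagram 𝒫.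
Represents : Permutation′ (suc n) → Diagram n → Permutation′ (suc n) → Set
Represents c 𝒫 y = y ≤T c × Pol y ≐ 𝒫

D U : Permutation′ (suc n) → Pred (Fin (suc n)) 0ℓ
D x k = supp x k × ¬ Terminal x k
U x k = supp x k × ¬ Initial x k

Enumerates : ∀ {k} → Subset m → (Fin k → Fin m) → Set
Enumerates S f = (∀ {a b} → a < b → f a < f b) × (∀ v → v ∈ S ⇔ (∃ λ a → f a ≡ v))

-- |D| = |U| = k is expressed by the increasing enumerations d and u of D = down
-- and U = up.
record 𝓘 (n : ℕ) : Set where
  field
    down up     : Subset (suc n)
    size        : ℕ
    size≤n      : size ℕ.≤ n
    d u         : Fin size → Fin (suc n)
    d-enumerates : Enumerates down d
    u-enumerates : Enumerates up u
    d<u         : ∀ a → d a < u a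

-- Maps between permutations and pairs are given by their graphs; Ψ₁ is that of
-- ψ₁, x ↦ (D_x^c, U_x^c).
Ψ₁ : Permutation′ (suc n) → 𝓘 n → Set
Ψ₁ x p = (∀ k → k ∈ 𝓘.down p ⇔ D x k) × (∀ k → k ∈ 𝓘.up p ⇔ U x k)

M N : Permutation′ (suc n) → Permutation′ (suc n) → Pred (Fin (suc n)) 0ℓ
M c x k = D x k × U x k × L c k
N c x k = L c k × ¬ supp x k × ∃ λ P → Pol x P × NestedIn k P

enlarge : Diagram n → Subset (suc n) → Fin (suc n) → Diagram n
enlarge 𝒫 P k Q = (𝒫 Q × Q ≢ P) ⊎ Q ≡ P ∪ ⁅ k ⁆

-- y′ is obtained from y by adding k to a polygon in which k is nested.
AddVertex : Permutation′ (suc n) → Fin (suc n) → (y y′ : Permutation′ (suc n)) → Set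
AddVertex c k y y′ = ∃ λ P → Pol y P × NestedIn k P ×
  Noncrossing c (enlarge (Pol y) P k) × Represents c (enlarge (Pol y) P k) y′

AddVertices : Permutation′ (suc n) → List (Fin (suc n)) → (y y′ : Permutation′ (suc n)) → Set
AddVertices c []       y y′ = y ≈ y′
AddVertices c (k ∷ ks) y y′ = ∃ λ z → AddVertex c k y z × AddVertices c ks z y′

without : Diagram n → Pred (Fin (suc n)) 0ℓ → Diagram n
without 𝒫 S Q = ∃ λ P → 𝒫 P × (∀ v → v ∈ Q ⇔ (v ∈ P × ¬ S v))

-- Graph of inv_c. The list ks enumerates N_x^c in an arbitrary order.
Inv : Permutation′ (suc n) → (x y : Permutation′ (suc n)) → Set
Inv c x y = ∃₂ λ ks x′ →
  Unique ks × (∀ k → k ∈ₗ ks ⇔ N c x k) ×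
  AddVertices c ks x x′ ×
  Represents c (without (Pol x′) (M c x)) y

-- Graph of ψ₂.
Ψ₂ : Permutation′ (suc n) → Permutation′ (suc n) → 𝓘 n → Set
Ψ₂ c x p = ∃ λ y → Inv c x y × Ψ₁ y p

Reduced : Permutation′ (suc n) → Pred (List (Fin n)) 0ℓ
Reduced w is = ⟦ is ⟧ ≈ w × (∀ js → ⟦ js ⟧ ≈ w → length is ℕ.≤ length js)

data Commutation {n} : List (Fin n) → List (Fin n) → Set where
  commute : ∀ as i j bs → s i · s j ≈ s j · s i →
            Commutation (as ++ i ∷ j ∷ bs) (as ++ j ∷ i ∷ bs)

FullyCommutative : Pred (Permutation′ (suc n)) 0ℓ
FullyCommutative w = ∀ is js → Reduced w is → Reduced w js → EqClosure Commutation is js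

FC : ℕ → Setoid 0ℓ 0ℓ
FC n = On.setoid {B = Σ (Permutation′ (suc n)) FullyCommutative} (Permutations (suc n)) proj₁

-- descending i j  is the word  i, i−1, …, j  (empty if i < j).
descending : Fin n → Fin n → List (Fin n)
descending                 zero    zero    = zero ∷ []
descending                 zero    (suc j) = []
descending {suc (suc n)}   (suc i) zero    = map suc (descending i zero) ++ zero ∷ []
descending                 (suc i) (suc j) = map suc (descending i j)

record NormalForm {n} (w : Permutation′ (suc n)) : Set where
  field
    size    : ℕ
    i j     : Fin size → Fin n
    i-mono  : ∀ {a b} → a < b → i a < i b
    j-mono  : ∀ {a b} → a < b → j a < j b
    j≤i     : ∀ a → j a ≤ i a
    reduced : Reduced w (concat (tabulate λ a → descending (i a) (j a)))

I J : Permutation′ (suc n) → Pred (Fin n) 0ℓ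
I w v = Σ (NormalForm w) λ f → ∃ λ a → NormalForm.i f a ≡ v
J w v = Σ (NormalForm w) λ f → ∃ λ a → NormalForm.j f a ≡ v

-- For k ∈ [n+1]:  k ∈ J_w,  and  k ∈ I_w[1], i.e. k − 1 ∈ I_w.
_∈J_ _∈I[1]_ : Fin (suc n) → Permutation′ (suc n) → Set
k ∈J    w = ∃ λ v → inject₁ v ≡ k × J w v
k ∈I[1] w = ∃ λ v → suc v ≡ k × I w v

-- Graph of g.
G : 𝓘 n → Permutation′ (suc n) → Set
G p w = FullyCommutative w ×
  (∀ k → k ∈ 𝓘.down p ⇔ k ∈J w) × (∀ k → k ∈ 𝓘.up p ⇔ k ∈I[1] w)

-- Graph of φ = g ∘ ψ₂.
Φ : Permutation′ (suc n) → (x w : Permutation′ (suc n)) → Set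
Φ c x w = ∃ λ p → Ψ₂ c x p × G p w

JCondition ICondition : Permutation′ (suc n) → Permutation′ (suc n) → Fin (suc n) → Set
JCondition c x k =
    (R c k × D x k)
  ⊎ (L c k × Initial x k)
  ⊎ (L c k × ¬ supp x k × ∃ λ P → Pol x P × NestedIn k P)
ICondition c x k =
    (R c k × U x k)
  ⊎ (L c k × Terminal x k)
  ⊎ (L c k × ¬ supp x k × ∃ λ P → Pol x P × NestedIn k P)

{-# OPTIONS --safe #-}
module Submission where

-- An element of NC is read as a lattice path: going through the labels in increasing
-- order, a label opens a polygon (up-step, in D but not in U), closes one (down-step),
-- continues one (level step, in D and U) or is fixed (level step of another kind). The
-- height is the number of open polygons. They are stacked between the two sides of the
-- circle, so a label on the right (left) can only touch the one that is next to the right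
-- (left) side. Hence x is determined by its path, and every path occurs in which the height
-- never drops below zero and the level steps of the first kind have positive height. The
-- involution inv_c exchanges the two kinds of level steps at positive height for the
-- labels on the left, which gives the two conditions on φ(x).
--
-- Membership in NC is handled through a local condition (Geo below): c has rank n, where the
-- rank is the number of labels minus the number of orbits, so along a factorisation of c
-- into n transpositions every letter merges two orbits.
--
-- For fully commutative w with normal form given by I and J, the sets J and I[1] are the
-- excedance positions and the excedance values of w. The displacement Σ max(0, w(v) − v) is
-- subadditive, hence at most the length of any word; a normal form attains it, and no word
-- that attains it contains ii or i(i±1)i, even after commutations. Words without such
-- factors are brought to normal form by commutations.

open import Defs
open import Data.Bool using (true)
import Data.Bool.Properties as Boolₚ
open import Data.Empty using (⊥; ⊥-elim)
open import Data.Fin as Fin using (Fin; zero; suc; toℕ; inject₁; fromℕ; fromℕ<)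
open import Data.Fin.Permutation using
  ( Permutation′; _⟨$⟩ʳ_; _⟨$⟩ˡ_; flip; transpose; _≈_; inverseˡ; inverseʳ
  ; lift₀; lift₀-transpose; lift₀-cong; lift₀-remove)
  renaming (id to idₚ; remove to removeₚ)
import Data.Fin.Properties as Finₚ
open import Data.Fin.Subset using (Subset; _∈_; _∉_; _∪_; ⁅_⁆)
import Data.Fin.Subset.Properties as Subsetₚ
open import Data.List using
  (List; []; _∷_; _++_; map; length; concat; tabulate; lookup; filter; allFin)
open import Data.List.Membership.Propositional using (find; lose) renaming (_∈_ to _∈ₗ_)
import Data.List.Membership.Propositional.Properties as ∈ₗₚ
import Data.List.Properties as Listₚ
open import Data.List.Relation.Binary.Permutation.Propositional using (_↭_; ↭-sym; ↭-trans; ↭-reflexive)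
import Data.List.Relation.Binary.Permutation.Propositional.Properties as ↭ₚ
open import Data.List.Relation.Unary.All as All using (All; []; _∷_)
import Data.List.Relation.Unary.All.Properties as Allₚ
open import Data.List.Relation.Unary.AllPairs using (AllPairs; []; _∷_)
import Data.List.Relation.Unary.AllPairs.Properties as AllPairsₚ
open import Data.List.Relation.Unary.Any as Any using (Any; here; there; any?)
open import Data.List.Relation.Unary.Any.Properties using (lookup-index)
open import Data.List.Relation.Unary.Unique.Propositional using (Unique)
import Data.List.Relation.Unary.Unique.Propositional.Properties as Uniqueₚ
open import Data.Nat as ℕ using (ℕ; zero; suc; _+_; _∸_; _≤_; _<_; z≤n; s≤s)
import Data.Nat.DivMod as DM
open import Data.Nat.GeneralisedArithmetic using (iterate)
import Data.Nat.Properties as ℕₚ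
open import Data.Product using (Σ; ∃; ∃₂; _×_; _,_; proj₁; proj₂)
open import Data.Sum using (_⊎_; inj₁; inj₂)
open import Data.Vec using () renaming (tabulate to tabulateᵥ)
import Data.Vec.Properties as Vecₚ
open import Function using (_⇔_; _∘_; id; mk⇔; Equivalence; Bijection; case_of_)
open import Relation.Binary using (Setoid; Tri; tri<; tri≈; tri>)
open import Relation.Binary.Construct.Closure.Equivalence as Eq using (EqClosure)
open import Relation.Binary.Construct.Closure.ReflexiveTransitive using (ε; _◅_)
import Relation.Binary.Construct.Closure.Symmetric as SymC
open import Relation.Binary.PropositionalEquality
open import Relation.Nullary using (¬_; Dec; yes; no; contradiction)
open import Relation.Nullary.Decidable using (dec-true; dec-false; _×-dec_; _⊎-dec_; ¬?; map′)
open import Relation.Unary using (Decidable; Pred; _≐_)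

open import Algebra.Properties.CommutativeMonoid.Sum ℕₚ.+-0-commutativeMonoid
  using (sum; sum-cong-≗; ∑-distrib-+; sum-permute)

-- The clockwise order enters as an abstract ternary relation, so the arguments are invariant under
-- rotation, and the sizes of the labels come in only through the side of the middle one of three.
-- `Geo` constrains single arrows from `a` to `x a` instead of pairs of polygons, which makes it
-- easy to follow through multiplication by a transposition. The height of a path is matched with
-- the number of arrows crossing a level; this turns "nested", for a fixed label, into "positive
-- height". Exchanging level steps keeps all heights and is therefore an involution on paths. So
-- bijectivity of φ requires no separate study of `inv_c`: φ is defined from the exchanged path and
-- only afterwards identified with the relation `Φ`. That identification requires the intermediate
-- diagrams of `inv_c` to exist. Instead of searching for the polygon that is to receive a vertex,
-- one draws the element with the desired path and shows that deleting the vertex gives back the old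
-- element.

private variable
  m n : ℕ

-- Permutations and their orbits

_$_ : Permutation′ m → Fin m → Fin m
_$_ = _⟨$⟩ʳ_
infixr 10 _$_

perm-injective : (x : Permutation′ m) {a b : Fin m} → x $ a ≡ x $ b → a ≡ b
perm-injective x {a} {b} eq = trans (sym (inverseˡ x)) (trans (cong (x ⟨$⟩ˡ_) eq) (inverseˡ x))

transpose-l : (p q : Fin m) → transpose p q $ p ≡ q
transpose-l p q rewrite dec-true (p Fin.≟ p) refl = refl

transpose-r : (p q : Fin m) → transpose p q $ q ≡ p
transpose-r p q with q Fin.≟ p
... | yes refl = refl
... | no _ rewrite dec-true (q Fin.≟ q) refl = refl

transpose-other : {p q a : Fin m} → a ≢ p → a ≢ q → transpose p q $ a ≡ a
transpose-other {p = p} {q} {a} a≢p a≢q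
  rewrite dec-false (a Fin.≟ p) a≢p | dec-false (a Fin.≟ q) a≢q = refl

transpose-involutive : (p q a : Fin m) → transpose p q $ transpose p q $ a ≡ a
transpose-involutive p q a = go (a Fin.≟ p) (a Fin.≟ q)
  where
  go : Dec (a ≡ p) → Dec (a ≡ q) → transpose p q $ transpose p q $ a ≡ a
  go (yes refl) _          = trans (cong (transpose a q $_) (transpose-l a q)) (transpose-r a q)
  go (no _)     (yes refl) = trans (cong (transpose p a $_) (transpose-r p a)) (transpose-l p a)
  go (no a≢p)   (no a≢q)   = trans (cong (transpose p q $_) (transpose-other a≢p a≢q)) (transpose-other a≢p a≢q)

iterate-+ : ∀ {A : Set} (f : A → A) a k l → iterate f a (k + l) ≡ iterate f (iterate f a k) l
iterate-+ f a zero    l = refl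
iterate-+ f a (suc k) l = iterate-+ f (f a) k l

iterate-suc : ∀ {A : Set} (f : A → A) a k → iterate f a (suc k) ≡ f (iterate f a k)
iterate-suc f a zero    = refl
iterate-suc f a (suc k) = iterate-suc f (f a) k

iterate-cong : ∀ {A : Set} {f g : A → A} → (∀ a → f a ≡ g a) → ∀ a k → iterate f a k ≡ iterate g a k
iterate-cong f≗g a zero    = refl
iterate-cong {f = f} {g} f≗g a (suc k) = trans (cong (λ b → iterate f b k) (f≗g a)) (iterate-cong f≗g (g a) k)

iterate-injective : (x : Permutation′ m) → ∀ k {a b} → iterate (x $_) a k ≡ iterate (x $_) b k → a ≡ b
iterate-injective x zero    eq = eq
iterate-injective x (suc k) eq = perm-injective x (iterate-injective x k eq)

Orbit : Permutation′ m → Fin m → Fin m → Set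
Orbit x a b = ∃ λ k → iterate (x $_) a k ≡ b

-- Two of the first `m + 1` iterates coincide, and injectivity cancels the shorter one, so the orbit
-- returns to `a` itself. The bound makes orbits decidable.
period : (x : Permutation′ m) (a : Fin m) →
         ∃ λ k → suc k ≤ m × iterate (x $_) a (suc k) ≡ a
period {m} x a = go (Finₚ.pigeonhole (ℕₚ.n<1+n m) λ i → iterate (x $_) a (toℕ i))
  where
  diff : ∀ {i j : ℕ} → i < j → ∃ λ k → j ≡ suc k + i
  diff {i} {j} i<j = j ∸ suc i , sym (trans (sym (ℕₚ.+-suc _ i)) (ℕₚ.m∸n+n≡m i<j))
  go : (∃₂ λ (i j : Fin (suc m)) → i Fin.< j × iterate (x $_) a (toℕ i) ≡ iterate (x $_) a (toℕ j)) →
       ∃ λ k → suc k ≤ m × iterate (x $_) a (suc k) ≡ a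
  go (i , j , i<j , eq) with diff i<j
  ... | k , j≡ = k ,
    ℕₚ.≤-trans (ℕₚ.m≤m+n (suc k) (toℕ i)) (subst (_≤ m) j≡ (ℕ.s≤s⁻¹ (Finₚ.toℕ<n j))) ,
    sym (iterate-injective x (toℕ i) (trans eq (trans (cong (iterate (x $_) a) j≡)
      (iterate-+ (x $_) a (suc k) (toℕ i)))))

orbit-refl : (x : Permutation′ m) {a : Fin m} → Orbit x a a
orbit-refl x = 0 , refl

orbit-step : (x : Permutation′ m) {a : Fin m} → Orbit x a (x $ a)
orbit-step x = 1 , refl

orbit-trans : (x : Permutation′ m) {a b d : Fin m} → Orbit x a b → Orbit x b d → Orbit x a d
orbit-trans x {a} (k , refl) (l , refl) = k + l , iterate-+ (x $_) a k l

orbit-step-sym : (x : Permutation′ m) {a : Fin m} → Orbit x (x $ a) a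
orbit-step-sym x {a} with period x a
... | k , _ , eq = k , eq

orbit-sym : (x : Permutation′ m) {a b : Fin m} → Orbit x a b → Orbit x b a
orbit-sym x (k , eq) = go k eq
  where
  go : ∀ k {a b} → iterate (x $_) a k ≡ b → Orbit x b a
  go zero    refl = orbit-refl x
  go (suc k) eq   = orbit-trans x (go k eq) (orbit-step-sym x)

-- The orbit relation is the least preorder containing all steps `a`, `x a`; comparisons of orbits
-- thereby reduce to single steps.
orbit-min : (x : Permutation′ m) {E : Fin m → Fin m → Set} → (∀ {a} → E a a) →
            (∀ {a b d} → E a b → E b d → E a d) → (∀ a → E a (x $ a)) →
            ∀ {a b} → Orbit x a b → E a b
orbit-min x {E} r t st (k , eq) = go k eq
  where
  go : ∀ k {a b} → iterate (x $_) a k ≡ b → E a b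
  go zero    refl = r
  go (suc k) {a} eq = t (st a) (go k eq)

orbit-cong : {x y : Permutation′ m} → x ≈ y → ∀ {a b} → Orbit x a b → Orbit y a b
orbit-cong x≈y {a} (k , eq) = k , trans (sym (iterate-cong x≈y a k)) eq

iterate-fixed : ∀ {A : Set} (f : A → A) {a} → f a ≡ a → ∀ k → iterate f a k ≡ a
iterate-fixed f fa zero    = refl
iterate-fixed f {a} fa (suc k) = trans (cong (λ b → iterate f b k) fa) (iterate-fixed f fa k)

orbit-fixed : (x : Permutation′ m) {a b : Fin m} → x $ a ≡ a → Orbit x a b → a ≡ b
orbit-fixed x fa (k , eq) = trans (sym (iterate-fixed (x $_) fa k)) eq

abstract
  -- An exponent can be reduced modulo the period, so finitely many iterates have to be inspected.
  orbit? : (x : Permutation′ m) (a b : Fin m) → Dec (Orbit x a b)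
  orbit? {m} x a b = map′ (λ (k , eq) → toℕ k , eq) shorten
      (Finₚ.any? λ (k : Fin m) → iterate (x $_) a (toℕ k) Fin.≟ b)
    where
    shorten : Orbit x a b → ∃ λ (k : Fin m) → iterate (x $_) a (toℕ k) ≡ b
    shorten (k , eq) with period x a
    ... | d , d<m , eqd = fromℕ< k%<m , trans (cong (iterate (x $_) a) (Finₚ.toℕ-fromℕ< k%<m)) (trans (sym red) eq)
      where
      k%<m : k DM.% suc d < m
      k%<m = ℕₚ.<-≤-trans (DM.m%n<n k (suc d)) d<m
      mult : ∀ l → iterate (x $_) a (l ℕ.* suc d) ≡ a
      mult zero    = refl
      mult (suc l) = trans (iterate-+ (x $_) a (suc d) (l ℕ.* suc d))
        (trans (cong (λ z → iterate (x $_) z (l ℕ.* suc d)) eqd) (mult l))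
      red : iterate (x $_) a k ≡ iterate (x $_) a (k DM.% suc d)
      red = trans (cong (iterate (x $_) a) (trans (DM.m≡m%n+[m/n]*n k (suc d)) (ℕₚ.+-comm (k DM.% suc d) _)))
        (trans (iterate-+ (x $_) a (k DM./ suc d ℕ.* suc d) (k DM.% suc d))
          (cong (λ z → iterate (x $_) z (k DM.% suc d)) (mult (k DM./ suc d))))

-- Multiplication by a transposition merges or splits orbits

module Merge (y : Permutation′ m) (p q : Fin m) (p≁q : ¬ Orbit y p q) where

  z : Permutation′ m
  z = y · transpose p q

  z-p : z $ p ≡ y $ q
  z-p = cong (y $_) (transpose-l p q)

  z-q : z $ q ≡ y $ p
  z-q = cong (y $_) (transpose-r p q)

  z-other : ∀ {a} → a ≢ p → a ≢ q → z $ a ≡ y $ a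
  z-other a≢p a≢q = cong (y $_) (transpose-other a≢p a≢q)

  private
    -- The z-orbit of q follows the y-orbit of p until the latter returns to p.
    follow : ∀ k → Orbit z q p ⊎ iterate (z $_) q (suc k) ≡ iterate (y $_) p (suc k)
    follow zero = inj₂ z-q
    follow (suc k) with follow k
    ... | inj₁ q∼p = inj₁ q∼p
    ... | inj₂ eq with iterate (y $_) p (suc k) Fin.≟ p
    ... | yes ≡p = inj₁ (suc k , trans eq ≡p)
    ... | no ≢p = inj₂ (trans (iterate-suc (z $_) q (suc k)) (trans (cong (z $_) eq)
            (trans (z-other ≢p λ ≡q → p≁q (suc k , ≡q)) (sym (iterate-suc (y $_) p (suc k))))))

  q∼p : Orbit z q p
  q∼p with period y p
  ... | k , _ , eq with follow k
  ... | inj₁ q∼p = q∼p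
  ... | inj₂ eq′ = suc k , trans eq′ eq

  p∼q : Orbit z p q
  p∼q = orbit-sym z q∼p

  widen : ∀ {a b} → Orbit y a b → Orbit z a b
  widen = orbit-min y (orbit-refl z) (orbit-trans z) one
    where
    one : ∀ a → Orbit z a (y $ a)
    one a = go (a Fin.≟ p) (a Fin.≟ q)
      where
      go : Dec (a ≡ p) → Dec (a ≡ q) → Orbit z a (y $ a)
      go (yes refl) _          = orbit-trans z p∼q (1 , z-q)
      go (no _)     (yes refl) = orbit-trans z q∼p (1 , z-p)
      go (no a≢p)   (no a≢q)   = 1 , z-other a≢p a≢q

  Joined : Fin m → Set
  Joined a = Orbit y a p ⊎ Orbit y a q

  joined⇒orbit : ∀ {a} → Joined a → Orbit z a p
  joined⇒orbit (inj₁ a∼p) = widen a∼p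
  joined⇒orbit (inj₂ a∼q) = orbit-trans z (widen a∼q) q∼p

  -- The conclusion is the equivalence relation obtained from the orbits of `y` by uniting the
  -- classes of `p` and `q`, so `orbit-min` leaves only single steps to check.
  narrow : ∀ {a b} → Orbit z a b → Orbit y a b ⊎ (Joined a × Joined b)
  narrow = orbit-min z {λ a b → Orbit y a b ⊎ (Joined a × Joined b)} (inj₁ (orbit-refl y)) tr one
    where
    pull : ∀ {a b} → Orbit y a b → Joined b → Joined a
    pull a∼b (inj₁ b∼p) = inj₁ (orbit-trans y a∼b b∼p)
    pull a∼b (inj₂ b∼q) = inj₂ (orbit-trans y a∼b b∼q)
    tr : ∀ {a b d} → Orbit y a b ⊎ (Joined a × Joined b) → Orbit y b d ⊎ (Joined b × Joined d) →
         Orbit y a d ⊎ (Joined a × Joined d)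
    tr (inj₁ ab)        (inj₁ bd)        = inj₁ (orbit-trans y ab bd)
    tr (inj₁ ab)        (inj₂ (jb , jd)) = inj₂ (pull ab jb , jd)
    tr (inj₂ (ja , jb)) (inj₁ bd)        = inj₂ (ja , pull (orbit-sym y bd) jb)
    tr (inj₂ (ja , jb)) (inj₂ (_ , jd))  = inj₂ (ja , jd)
    one : ∀ a → Orbit y a (z $ a) ⊎ (Joined a × Joined (z $ a))
    one a = go (a Fin.≟ p) (a Fin.≟ q)
      where
      go : Dec (a ≡ p) → Dec (a ≡ q) → Orbit y a (z $ a) ⊎ (Joined a × Joined (z $ a))
      go (yes refl) _          = inj₂ (inj₁ (orbit-refl y) , subst Joined (sym z-p) (inj₂ (orbit-step-sym y)))
      go (no _)     (yes refl) = inj₂ (inj₂ (orbit-refl y) , subst Joined (sym z-q) (inj₁ (orbit-step-sym y)))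
      go (no a≢p)   (no a≢q)   = inj₁ (1 , sym (z-other a≢p a≢q))

-- Each step of the product stays inside an orbit of `y`, so the orbits can only become finer.
split-orbit : (y : Permutation′ m) {p q : Fin m} → Orbit y p q →
              ∀ {a b} → Orbit (y · transpose p q) a b → Orbit y a b
split-orbit y {p} {q} p∼q = orbit-min (y · transpose p q) (orbit-refl y) (orbit-trans y) one
  where
  one : ∀ a → Orbit y a (y $ transpose p q $ a)
  one a = go (a Fin.≟ p) (a Fin.≟ q)
    where
    go : Dec (a ≡ p) → Dec (a ≡ q) → Orbit y a (y $ transpose p q $ a)
    go (yes refl) _          = subst (λ b → Orbit y a (y $ b)) (sym (transpose-l a q))
                                 (orbit-trans y p∼q (orbit-step y))
    go (no _)     (yes refl) = subst (λ b → Orbit y a (y $ b)) (sym (transpose-r p a))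
                                 (orbit-trans y (orbit-sym y p∼q) (orbit-step y))
    go (no a≢p)   (no a≢q)   = subst (λ b → Orbit y a (y $ b)) (sym (transpose-other a≢p a≢q)) (orbit-step y)

-- Counting


ind : {P : Set} → Dec P → ℕ
ind (yes _) = 1
ind (no  _) = 0

ind-yes : {P : Set} (P? : Dec P) → P → ind P? ≡ 1
ind-yes (yes _) _ = refl
ind-yes (no ¬p) p = contradiction p ¬p

ind-no : {P : Set} (P? : Dec P) → ¬ P → ind P? ≡ 0
ind-no (yes p) ¬p = contradiction p ¬p
ind-no (no _)  _  = refl

ind-mono : {P Q : Set} (P? : Dec P) (Q? : Dec Q) → (P → Q) → ind P? ≤ ind Q?
ind-mono (yes p) Q? f = ℕₚ.≤-reflexive (sym (ind-yes Q? (f p)))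
ind-mono (no _)  Q? f = z≤n

ind-cong : {P Q : Set} (P? : Dec P) (Q? : Dec Q) → P ⇔ Q → ind P? ≡ ind Q?
ind-cong P? Q? e = ℕₚ.≤-antisym (ind-mono P? Q? (Equivalence.to e)) (ind-mono Q? P? (Equivalence.from e))

sum-mono : {f g : Fin m → ℕ} → (∀ i → f i ≤ g i) → sum f ≤ sum g
sum-mono {zero}  f≤g = z≤n
sum-mono {suc m} f≤g = ℕₚ.+-mono-≤ (f≤g zero) (sum-mono (f≤g ∘ suc))

sum-zero : {f : Fin m → ℕ} → (∀ i → f i ≡ 0) → sum f ≡ 0
sum-zero {zero}  f≡0 = refl
sum-zero {suc m} f≡0 = cong₂ _+_ (f≡0 zero) (sum-zero (f≡0 ∘ suc))

sum-single : {f : Fin m → ℕ} (a : Fin m) → (∀ i → i ≢ a → f i ≡ 0) → sum f ≡ f a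
sum-single {f = f} zero    z = trans (cong (f zero +_) (sum-zero λ i → z (suc i) λ ())) (ℕₚ.+-identityʳ _)
sum-single (suc a) z = cong₂ _+_ (z zero λ ()) (sum-single a λ i i≢a → z (suc i) (i≢a ∘ Finₚ.suc-injective))

# : {P : Pred (Fin m) _} → Decidable P → ℕ
# P? = sum (λ a → ind (P? a))

module _ {P Q : Fin m → Set} (P? : Decidable P) (Q? : Decidable Q) where

  #-mono : (∀ a → P a → Q a) → # P? ≤ # Q?
  #-mono f = sum-mono λ a → ind-mono (P? a) (Q? a) (f a)

  #-cong : (∀ a → P a ⇔ Q a) → # P? ≡ # Q?
  #-cong f = sum-cong-≗ λ a → ind-cong (P? a) (Q? a) (f a)

  #-insert : ∀ b → (∀ a → P a → Q a) → (∀ a → Q a → P a ⊎ a ≡ b) → Q b → ¬ P b → # Q? ≡ suc (# P?)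
  #-insert b P⊆Q Q⊆ Qb ¬Pb = trans (sum-cong-≗ pointwise) (trans (∑-distrib-+ (λ a → ind (a Fin.≟ b)) (λ a → ind (P? a)))
      (cong (_+ # P?) (trans (sum-single b λ a a≢b → ind-no (a Fin.≟ b) a≢b) (ind-yes (b Fin.≟ b) refl))))
    where
    pointwise : ∀ a → ind (Q? a) ≡ ind (a Fin.≟ b) + ind (P? a)
    pointwise a with a Fin.≟ b
    ... | yes refl = trans (ind-yes (Q? a) Qb) (cong suc (sym (ind-no (P? a) ¬Pb)))
    ... | no a≢b = ind-cong (Q? a) (P? a) (mk⇔ (λ Qa → case Q⊆ a Qa of λ
            { (inj₁ Pa) → Pa ; (inj₂ a≡b) → contradiction a≡b a≢b }) (P⊆Q a))

#-pos : {P : Fin m → Set} (P? : Decidable P) {a : Fin m} → P a → 0 < # P?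
#-pos P? {a} Pa = subst (_≤ # P?) (trans (sum-single a (λ i i≢a → ind-no (i Fin.≟ a) i≢a)) (ind-yes (a Fin.≟ a) refl))
  (#-mono (Fin._≟ a) P? λ { _ refl → Pa })

#-witness : {P : Fin m → Set} (P? : Decidable P) → 0 < # P? → ∃ P
#-witness P? 0<# with Finₚ.any? P?
... | yes w = w
... | no ¬w = contradiction (subst (0 <_) (sum-zero λ a → ind-no (P? a) (λ Pa → ¬w (a , Pa))) 0<#) λ ()

-- Absolute length

-- Fixed points are both least and greatest in their orbit, so these turn out to be the sets U and D
-- of `x` (`U⇔` and `D⇔`). Unlike those they mention no polygons and are decidable by search.
Up Dn : Permutation′ m → Fin m → Set
Up x a = ∃ λ b → b Fin.< a × Orbit x a b
Dn x a = ∃ λ b → a Fin.< b × Orbit x a b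

Up? : (x : Permutation′ m) → Decidable (Up x)
Up? x a = Finₚ.any? λ b → (b Finₚ.<? a) ×-dec orbit? x a b

Dn? : (x : Permutation′ m) → Decidable (Dn x)
Dn? x a = Finₚ.any? λ b → (a Finₚ.<? b) ×-dec orbit? x a b

orbit-least : (x : Permutation′ m) (a : Fin m) → ∃ λ b → Orbit x a b × ¬ Up x b
orbit-least {m} x a = go m a (Finₚ.toℕ<n a)
  where
  go : ∀ k a → toℕ a < k → ∃ λ b → Orbit x a b × ¬ Up x b
  go (suc k) a a<k with Up? x a
  ... | no ¬up = a , orbit-refl x , ¬up
  ... | yes (b , b<a , a∼b) with go k b (ℕₚ.<-≤-trans b<a (ℕ.s≤s⁻¹ a<k))
  ... | d , b∼d , ¬up = d , orbit-trans x a∼b b∼d , ¬up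

-- m minus the number of orbits; this is the absolute length.
abstract
  rank : Permutation′ m → ℕ
  rank x = # (Up? x)

  rank-def : (x : Permutation′ m) → rank x ≡ # (Up? x)
  rank-def x = refl

rank-mono : (x y : Permutation′ m) → (∀ {a b} → Orbit x a b → Orbit y a b) → rank x ≤ rank y
rank-mono x y x⊆y = subst₂ _≤_ (sym (rank-def x)) (sym (rank-def y))
  (#-mono (Up? x) (Up? y) λ { a (b , b<a , a∼b) → b , b<a , x⊆y a∼b })

rank-cong : {x y : Permutation′ m} → x ≈ y → rank x ≡ rank y
rank-cong {x = x} {y} x≈y =
  ℕₚ.≤-antisym (rank-mono x y (orbit-cong {x = x} {y} x≈y)) (rank-mono y x (orbit-cong {x = y} {x} (sym ∘ x≈y)))

rank-merge : (y : Permutation′ m) {p q : Fin m} → ¬ Orbit y p q → rank (y · transpose p q) ≡ suc (rank y)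
rank-merge {m} y {p} {q} p≁q = go (orbit-least y p) (orbit-least y q)
  where
  open Merge y p q p≁q
  grow : ∀ a → Up y a → Up z a
  grow a (b , b<a , a∼b) = b , b<a , widen a∼b
  -- The only new element that is not least is the larger of the two old least elements.
  conclude : ∀ b d → d Fin.< b → ¬ Up y b → ¬ Up y d → Orbit z b d →
             (∀ {a} → Joined a → Orbit y b a ⊎ Orbit y d a) → rank z ≡ suc (rank y)
  conclude b d d<b ¬b ¬d b∼d cover = trans (rank-def z)
      (trans (#-insert (Up? y) (Up? z) b grow shrink (d , d<b , b∼d) ¬b) (cong suc (sym (rank-def y))))
    where
    shrink : ∀ a → Up z a → Up y a ⊎ a ≡ b
    shrink a (e , e<a , a∼e) with narrow a∼e
    ... | inj₁ a∼e′ = inj₁ (e , e<a , a∼e′)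
    ... | inj₂ (ja , je) with cover ja
    ... | inj₁ b∼a with a Fin.≟ b
    ...   | yes a≡b = inj₂ a≡b
    ...   | no a≢b with ℕₚ.<-cmp (toℕ a) (toℕ b)
    ...     | tri< a<b _ _ = contradiction (a , a<b , b∼a) ¬b
    ...     | tri≈ _ a≡b _ = contradiction (Finₚ.toℕ-injective a≡b) a≢b
    ...     | tri> _ _ b<a = inj₁ (b , b<a , orbit-sym y b∼a)
    shrink a (e , e<a , a∼e) | inj₂ (ja , je) | inj₂ d∼a with ℕₚ.<-cmp (toℕ a) (toℕ d)
    ... | tri< a<d _ _ = contradiction (a , a<d , d∼a) ¬d
    ... | tri> _ _ d<a = inj₁ (d , d<a , orbit-sym y d∼a)
    ... | tri≈ _ a≡d _ with Finₚ.toℕ-injective a≡d | cover je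
    ...   | refl | inj₁ b∼e = contradiction (e , ℕₚ.<-trans e<a d<b , b∼e) ¬b
    ...   | refl | inj₂ d∼e = contradiction (e , e<a , d∼e) ¬d
  go : (∃ λ b → Orbit y p b × ¬ Up y b) → (∃ λ d → Orbit y q d × ¬ Up y d) → rank z ≡ suc (rank y)
  go (b , p∼b , ¬b) (d , q∼d , ¬d) with ℕₚ.<-cmp (toℕ b) (toℕ d)
  ... | tri≈ _ b≡d _ = contradiction
          (orbit-trans y p∼b (subst (λ e → Orbit y e q) (sym (Finₚ.toℕ-injective b≡d)) (orbit-sym y q∼d))) p≁q
  ... | tri> _ _ d<b = conclude b d d<b ¬b ¬d
          (orbit-trans z (orbit-sym z (widen p∼b)) (orbit-trans z p∼q (widen q∼d))) λ
            { (inj₁ a∼p) → inj₁ (orbit-sym y (orbit-trans y a∼p p∼b))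
            ; (inj₂ a∼q) → inj₂ (orbit-sym y (orbit-trans y a∼q q∼d)) }
  ... | tri< b<d _ _ = conclude d b b<d ¬d ¬b
          (orbit-trans z (orbit-sym z (widen q∼d)) (orbit-trans z q∼p (widen p∼b))) λ
            { (inj₁ a∼p) → inj₂ (orbit-sym y (orbit-trans y a∼p p∼b))
            ; (inj₂ a∼q) → inj₁ (orbit-sym y (orbit-trans y a∼q q∼d)) }

rank-transpose : (y : Permutation′ m) (p q : Fin m) → rank (y · transpose p q) ≤ suc (rank y)
rank-transpose y p q with orbit? y p q
... | yes p∼q = ℕₚ.m≤n⇒m≤1+n (rank-mono (y · transpose p q) y (split-orbit y p∼q))
... | no  p≁q = ℕₚ.≤-reflexive (rank-merge y p≁q)

product-++ : (ts us : List (Permutation′ m)) → product (ts ++ us) ≈ product ts · product us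
product-++ []       us a = refl
product-++ (t ∷ ts) us a = cong (t $_) (product-++ ts us a)

-- The prefix `v` is arbitrary because the induction moves letters into it one by one.
rank-product : (v : Permutation′ m) (ts : List (Permutation′ m)) → All IsTransposition ts →
               rank (v · product ts) ≤ rank v + length ts
rank-product v [] [] = ℕₚ.≤-reflexive (trans (rank-cong {x = v · idₚ} {v} (λ _ → refl)) (sym (ℕₚ.+-identityʳ _)))
rank-product v (t ∷ ts) ((p , q , p≢q , t≈) ∷ all) = begin
  rank (v · t · product ts)                   ≡⟨ rank-cong {x = v · t · product ts} {(v · transpose p q) · product ts} (λ a → cong (v $_) (t≈ (product ts $ a))) ⟩
  rank ((v · transpose p q) · product ts)     ≤⟨ rank-product (v · transpose p q) ts all ⟩
  rank (v · transpose p q) + length ts        ≤⟨ ℕₚ.+-monoˡ-≤ (length ts) (rank-transpose v p q) ⟩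
  suc (rank v) + length ts                    ≡⟨ sym (ℕₚ.+-suc _ _) ⟩
  rank v + length (t ∷ ts)                    ∎
  where open ℕₚ.≤-Reasoning

rank-id : rank {m} idₚ ≡ 0
rank-id {m} = trans (rank-def {m} idₚ) (sum-zero λ a → ind-no (Up? {m} idₚ a) λ { (b , b<a , a∼b) →
  ℕₚ.<-irrefl (cong toℕ (sym (orbit-fixed {m} idₚ refl a∼b))) b<a })

rank≤length : (w : Permutation′ m) (ts : List (Permutation′ m)) → TranspositionWord w ts → rank w ≤ length ts
rank≤length {m} w ts (all , ts≈w) = subst₂ _≤_ (rank-cong {x = idₚ · product ts} {w} ts≈w) (cong (_+ length ts) (rank-id {m}))
  (rank-product idₚ ts all)

#≤ : {P : Fin m → Set} (P? : Decidable P) → # P? ≤ m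
#≤ {zero}  P? = z≤n
#≤ {suc m} P? = ℕₚ.+-mono-≤ (ind≤1 (P? zero)) (#≤ (P? ∘ suc))
  where
  ind≤1 : {P : Set} (d : Dec P) → ind d ≤ 1
  ind≤1 (yes _) = ℕₚ.≤-refl
  ind≤1 (no _)  = z≤n

#-full : {P : Fin m → Set} (P? : Decidable P) → (∀ a → P a) → # P? ≡ m
#-full {zero}  P? p = refl
#-full {suc m} P? p = cong₂ _+_ (ind-yes (P? zero) (p zero)) (#-full (P? ∘ suc) (p ∘ suc))

module _ (x : Permutation′ (suc n)) where

  private
    Up⁺? : Decidable (λ a → Up x a ⊎ a ≡ zero)
    Up⁺? a = Up? x a ⊎-dec (a Fin.≟ zero)

    suc-rank : # Up⁺? ≡ suc (rank x)
    suc-rank = trans (#-insert (Up? x) Up⁺? zero (λ _ → inj₁) (λ _ → id) (inj₂ refl) λ ())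
      (cong suc (sym (rank-def x)))

  -- The label `zero` is always least in its orbit and hence never counted; adjoining it to the
  -- counted labels improves the bound `suc n` to `n`.
  rank≤ : rank x ≤ n
  rank≤ = ℕ.s≤s⁻¹ (subst (_≤ suc n) suc-rank (#≤ Up⁺?))

  rank-transitive : (∀ a → Orbit x a zero) → rank x ≡ n
  rank-transitive tr = ℕₚ.suc-injective (trans (sym suc-rank) (#-full Up⁺? all))
    where
    all : ∀ a → Up x a ⊎ a ≡ zero
    all zero    = inj₂ refl
    all (suc a) = inj₁ (zero , s≤s z≤n , tr (suc a))

-- The noncrossing condition

-- Br a b d: going clockwise from a, one meets b strictly before d. The cyclic
-- order of three labels is decided by the side (right or left) of the middle one.
record Circle {n} (c : Permutation′ (suc n)) : Set₁ where
  field
    Br         : Fin (suc n) → Fin (suc n) → Fin (suc n) → Set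
    br-rotate  : ∀ {a b d} → Br a b d → Br b d a
    br-asym    : ∀ {a b d} → Br a b d → ¬ Br a d b
    br-trans   : ∀ {a b d e} → Br a b d → Br a d e → Br a b e
    br-total   : ∀ {a b d} → a ≢ b → b ≢ d → a ≢ d → Br a b d ⊎ Br a d b
    br-≢       : ∀ {a b d} → Br a b d → a ≢ b
    br-next    : ∀ {a b} → ¬ Br a b (c $ a)
    transitive : ∀ a b → Orbit c a b
    Right      : Fin (suc n) → Set
    Right?     : Decidable Right
    br-right   : ∀ {a k d} → a Fin.< k → k Fin.< d → Right k → Br a k d
    br-left    : ∀ {a k d} → a Fin.< k → k Fin.< d → ¬ Right k → Br a d k

module Geometry {n} {c : Permutation′ (suc n)} (circle : Circle c) where

  open Circle circle public

  private
    variable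
      a b d e : Fin (suc n)
      x : Permutation′ (suc n)

  br-rotate² : Br a b d → Br d a b
  br-rotate² = br-rotate ∘ br-rotate

  br-≢₂ : Br a b d → b ≢ d
  br-≢₂ = br-≢ ∘ br-rotate

  br-≢₃ : Br a b d → a ≢ d
  br-≢₃ br = br-≢ (br-rotate² br) ∘ sym

  br-trans′ : Br a b d → Br a d e → Br b d e
  br-trans′ abd ade = br-rotate² (br-trans (br-rotate ade) (br-rotate² abd))

  -- The open arc from each a to x a is stable under x. This says that the polygons of x are
  -- disjoint and that x goes clockwise around each of them.
  Geo : Permutation′ (suc n) → Set
  Geo x = ∀ {a b} → Br a b (x $ a) → Br a (x $ b) (x $ a)

  geo-cong : {y : Permutation′ (suc n)} → x ≈ y → Geo x → Geo y
  geo-cong x≈y geo {a} {b} br = subst₂ (Br a) (x≈y b) (x≈y a) (geo (subst (Br a b) (sym (x≈y a)) br))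

  geo-orbit : ∀ x → Geo x → Orbit x b d → Br a b (x $ a) → Br a d (x $ a)
  geo-orbit x geo (k , eq) = go k eq
    where
    go : ∀ k {b} → iterate (x $_) b k ≡ d → Br a b (x $ a) → Br a d (x $ a)
    go zero    refl br = br
    go (suc k) eq   br = go k eq (geo br)

  -- A vertex of the polygon of `a` on the open arc would carry its whole orbit into that arc,
  -- including the endpoint `a`.
  avoid : ∀ x → Geo x → Orbit x a b → ¬ Br a b (x $ a)
  avoid x geo a∼b br = br-≢ (geo-orbit x geo (orbit-sym x a∼b) br) refl

  geo-id : Geo idₚ
  geo-id br = ⊥-elim (br-≢₃ br refl)

  module _ (v : Permutation′ (suc n)) (geo : Geo v) where

    private
      -- The arc that starts at one end of the splitting chord. The hypotheses are symmetric in `p`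
      -- and `q`, so that it serves both ends.
      half : ∀ z {p q} → Orbit v p q → p ≢ q → z $ p ≡ v $ q → z $ q ≡ v $ p →
             (∀ {a} → a ≢ p → a ≢ q → z $ a ≡ v $ a) →
             Br p b (v $ q) → Br p (z $ b) (v $ q)
      half {b} z {p} {q} p∼q p≢q zp zq zo br with b Fin.≟ q
      ... | yes b≡q = subst (λ e → Br p e (v $ q)) (sym (trans (cong (z $_) b≡q) zq)) goal
        where
        goal : Br p (v $ p) (v $ q)
        goal with br-total (λ p≡vp → p≢q (orbit-fixed v (sym p≡vp) p∼q)) (p≢q ∘ perm-injective v) (br-≢₃ br)
        ... | inj₁ good = good
        ... | inj₂ bad  = ⊥-elim (avoid v geo (orbit-trans v p∼q (orbit-step v)) bad)
      ... | no b≢q = subst (λ e → Br p e (v $ q)) (sym (zo (br-≢ br ∘ sym) b≢q)) goal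
        where
        goal : Br p (v $ b) (v $ q)
        goal with v $ b Fin.≟ p
        ... | yes vb≡p = ⊥-elim (avoid v geo
                (orbit-trans v (1 , vb≡p) (orbit-trans v p∼q (orbit-step v)))
                (subst (Br b (v $ q)) (sym vb≡p) (br-rotate br)))
        ... | no vb≢p with br-total (vb≢p ∘ sym) (b≢q ∘ perm-injective v) (br-≢₃ br)
        ... | inj₁ good = good
        ... | inj₂ bad  = ⊥-elim (br-asym (br-rotate (br-trans br bad))
                (geo-orbit v geo (orbit-trans v (orbit-step-sym v) (orbit-sym v p∼q)) (br-trans′ br bad)))

    -- The chord from `p` to `q` cuts their polygon in two. Arcs from other labels are unchanged,
    -- and images change only within one old orbit, which such an arc contains entirely or not at
    -- all.
    geo-split : ∀ {p q} → Orbit v p q → p ≢ q → Geo (v · transpose p q)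
    geo-split {p} {q} p∼q p≢q {a} {b} = go (a Fin.≟ p) (a Fin.≟ q) (b Fin.≟ p) (b Fin.≟ q)
      where
      z = v · transpose p q
      zp : z $ p ≡ v $ q
      zp = cong (v $_) (transpose-l p q)
      zq : z $ q ≡ v $ p
      zq = cong (v $_) (transpose-r p q)
      zo : ∀ {a} → a ≢ p → a ≢ q → z $ a ≡ v $ a
      zo a≢p a≢q = cong (v $_) (transpose-other a≢p a≢q)
      go : Dec (a ≡ p) → Dec (a ≡ q) → Dec (b ≡ p) → Dec (b ≡ q) →
           Br a b (z $ a) → Br a (z $ b) (z $ a)
      go (yes refl) _ _ _ br = subst (Br a (z $ b)) (sym zp) (half z p∼q p≢q zp zq zo (subst (Br a b) zp br))
      go (no _) (yes refl) _ _ br = subst (Br a (z $ b)) (sym zq)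
        (half z (orbit-sym v p∼q) (p≢q ∘ sym) zq zp (λ a≢q a≢p → zo a≢p a≢q) (subst (Br a b) zq br))
      go (no a≢p) (no a≢q) (yes refl) _ br = subst₂ (Br a) (sym zp) (sym (zo a≢p a≢q))
        (geo-orbit v geo (orbit-trans v p∼q (orbit-step v)) (subst (Br a b) (zo a≢p a≢q) br))
      go (no a≢p) (no a≢q) (no _) (yes refl) br = subst₂ (Br a) (sym zq) (sym (zo a≢p a≢q))
        (geo-orbit v geo (orbit-trans v (orbit-sym v p∼q) (orbit-step v)) (subst (Br a b) (zo a≢p a≢q) br))
      go (no a≢p) (no a≢q) (no b≢p) (no b≢q) br = subst₂ (Br a) (sym (zo b≢p b≢q)) (sym (zo a≢p a≢q))
        (geo (subst (Br a b) (zo a≢p a≢q) br))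

  -- The product inserts `κ` between `p` and `y p`. The hypothesis on all `a` says that no other
  -- arrow separates `κ` from `p`; the last one excludes that `κ` lies strictly between `y p` and
  -- `p`.
  geo-join : ∀ y → Geo y → ∀ {p κ} → y $ κ ≡ κ → p ≢ κ →
             (∀ a → a ≢ p → a ≢ κ → Br a κ (y $ a) ⇔ Br a p (y $ a)) →
             ¬ Br κ p (y $ p) → Geo (y · transpose p κ)
  geo-join y geo {p} {κ} yκ p≢κ visible ¬κp {a} {b} = go (a Fin.≟ p) (a Fin.≟ κ) (b Fin.≟ p) (b Fin.≟ κ)
    where
    z = y · transpose p κ
    zp : z $ p ≡ κ
    zp = trans (cong (y $_) (transpose-l p κ)) yκ
    zκ : z $ κ ≡ y $ p
    zκ = cong (y $_) (transpose-r p κ)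
    zo : ∀ {a} → a ≢ p → a ≢ κ → z $ a ≡ y $ a
    zo a≢p a≢κ = cong (y $_) (transpose-other a≢p a≢κ)
    to : ∀ {a} → a ≢ p → a ≢ κ → Br a κ (y $ a) → Br a p (y $ a)
    to a≢p a≢κ = Equivalence.to (visible _ a≢p a≢κ)
    from : ∀ {a} → a ≢ p → a ≢ κ → Br a p (y $ a) → Br a κ (y $ a)
    from a≢p a≢κ = Equivalence.from (visible _ a≢p a≢κ)
    y≢κ : ∀ {a} → a ≢ κ → y $ a ≢ κ
    y≢κ a≢κ ya≡κ = a≢κ (perm-injective y (trans ya≡κ (sym yκ)))
    fromp : b ≢ p → b ≢ κ → Br p b κ → Br p (y $ b) κ
    fromp b≢p b≢κ br with y $ b Fin.≟ p
    ... | yes yb≡p = ⊥-elim (br-≢₂ (to b≢p b≢κ (subst (Br b κ) (sym yb≡p) (br-rotate br))) (sym yb≡p))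
    ... | no yb≢p with br-total (yb≢p ∘ sym) (y≢κ b≢κ) p≢κ
    ... | inj₁ good = good
    ... | inj₂ bad  = ⊥-elim (br-asym (br-rotate (br-trans br bad)) (to b≢p b≢κ (br-trans′ br bad)))
    fromκ : b ≢ p → b ≢ κ → Br κ b (y $ p) → Br κ (y $ b) (y $ p)
    fromκ b≢p b≢κ br with br-total (y≢κ b≢κ ∘ sym) (b≢p ∘ perm-injective y) (br-≢₃ br)
    ... | inj₁ good = good
    ... | inj₂ bad  = ⊥-elim (br-asym (br-rotate (br-trans br bad))
            (from b≢p b≢κ (geo-orbit y geo (orbit-step-sym y) (br-trans′ br bad))))
    go : Dec (a ≡ p) → Dec (a ≡ κ) → Dec (b ≡ p) → Dec (b ≡ κ) →
         Br a b (z $ a) → Br a (z $ b) (z $ a)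
    go (yes refl) _ (yes refl) _ br = ⊥-elim (br-≢ br refl)
    go (yes refl) _ (no _) (yes refl) br = ⊥-elim (br-≢₂ br (sym zp))
    go (yes refl) _ (no b≢p) (no b≢κ) br = subst₂ (Br a) (sym (zo b≢p b≢κ)) (sym zp)
      (fromp b≢p b≢κ (subst (Br a b) zp br))
    go (no _) (yes refl) (yes refl) _ br = ⊥-elim (¬κp (subst (Br κ p) zκ br))
    go (no _) (yes refl) (no _) (yes refl) br = ⊥-elim (br-≢ br refl)
    go (no _) (yes refl) (no b≢p) (no b≢κ) br = subst₂ (Br a) (sym (zo b≢p b≢κ)) (sym zκ)
      (fromκ b≢p b≢κ (subst (Br a b) zκ br))
    go (no a≢p) (no a≢κ) (yes refl) _ br = subst₂ (Br a) (sym zp) (sym (zo a≢p a≢κ))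
      (from a≢p a≢κ (subst (Br a b) (zo a≢p a≢κ) br))
    go (no a≢p) (no a≢κ) (no _) (yes refl) br = subst₂ (Br a) (sym zκ) (sym (zo a≢p a≢κ))
      (geo (to a≢p a≢κ (subst (Br a b) (zo a≢p a≢κ) br)))
    go (no a≢p) (no a≢κ) (no b≢p) (no b≢κ) br = subst₂ (Br a) (sym (zo b≢p b≢κ)) (sym (zo a≢p a≢κ))
      (geo (subst (Br a b) (zo a≢p a≢κ) br))

  -- Merging the polygons of a and of q = x⁻¹ (c a), where c a is the point next to a.
  module UpStep (x : Permutation′ (suc n)) (geo : Geo x) {a : Fin (suc n)} (xa≢ca : x $ a ≢ c $ a) where

    private
      ca q : Fin (suc n)
      ca = c $ a
      q = x ⟨$⟩ˡ ca
      xq : x $ q ≡ ca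
      xq = inverseʳ x
      a≢ca : a ≢ ca
      a≢ca a≡ca = xa≢ca (trans (sym (orbit-fixed c (sym a≡ca) (transitive a (x $ a)))) a≡ca)
    q≢a : q ≢ a
    q≢a q≡a = xa≢ca (trans (cong (x $_) (sym q≡a)) xq)
    private
      qab : q ≢ ca → Br q a ca
      qab q≢ca with br-total (q≢a ∘ sym) q≢ca a≢ca
      ... | inj₁ bad = ⊥-elim (br-next bad)
      ... | inj₂ abq = br-rotate² abq
      q∼ca : Orbit x q ca
      q∼ca = 1 , xq
      z = x · transpose a q
      za : z $ a ≡ ca
      za = trans (cong (x $_) (transpose-l a q)) xq
      zq : z $ q ≡ x $ a
      zq = cong (x $_) (transpose-r a q)
      zo : ∀ {d} → d ≢ a → d ≢ q → z $ d ≡ x $ d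
      zo d≢a d≢q = cong (x $_) (transpose-other d≢a d≢q)

    -- The image `x q` is the point right after `a`, so `a` would lie on the open arc from `q` to
    -- `x q`, against `avoid`; if `q` is that point, it is fixed.
    separate : ¬ Orbit x a q
    separate a∼q with q Fin.≟ ca
    ... | yes q≡ca = q≢a (orbit-fixed x (trans xq (sym q≡ca)) (orbit-sym x a∼q))
    ... | no q≢ca = avoid x geo (orbit-sym x a∼q) (subst (Br q a) (sym xq) (qab q≢ca))

    private
      -- No point lies strictly between `a` and `c a`, so an arc that contains `a` contains `c a`
      -- too unless it starts or ends there.
      catch : ca ≢ e → ca ≢ x $ e → Br e a (x $ e) → Br e ca (x $ e)
      catch ca≢e ca≢xe br with br-total (ca≢e ∘ sym) ca≢xe (br-≢₃ br)
      ... | inj₁ good = good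
      ... | inj₂ bad  = ⊥-elim (br-next (br-trans′ br bad))
      x≢ca : d ≢ q → ca ≢ x $ d
      x≢ca d≢q ca≡xd = d≢q (perm-injective x (trans (sym ca≡xd) (sym xq)))

      inside : q ≢ ca → Br q (x $ a) ca
      inside q≢ca = subst (Br q (x $ a)) xq (geo (subst (Br q a) (sym xq) (qab q≢ca)))

      ¬qa : ¬ Br q a (x $ a)
      ¬qa br with q Fin.≟ ca
      ... | yes q≡ca = br-next (subst (Br a (x $ a)) q≡ca (br-rotate br))
      ... | no q≢ca = br-next (br-trans′ br (inside q≢ca))

      fromq : d ≢ a → d ≢ q → Br q d (x $ a) → Br q (x $ d) (x $ a)
      fromq {d} d≢a d≢q br with br-total xd≢q (d≢a ∘ perm-injective x) (br-≢₃ br)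
        where
        xd≢q : q ≢ x $ d
        xd≢q with q Fin.≟ ca
        ... | yes q≡ca = subst (_≢ x $ d) (sym q≡ca) (x≢ca d≢q)
        ... | no q≢ca = br-≢ (subst (Br q (x $ d)) xq (geo (subst (Br q d) (sym xq) (br-trans br (inside q≢ca)))))
      ... | inj₁ good = good
      ... | inj₂ bad = ⊥-elim (br-asym (br-rotate (br-trans br bad))
              (geo-orbit x geo (orbit-sym x q∼ca)
                (catch ca≢d (x≢ca d≢q) (geo-orbit x geo (orbit-step-sym x) (br-trans′ br bad)))))
        where
        ca≢d : ca ≢ d
        ca≢d with q Fin.≟ ca
        ... | yes q≡ca = subst (_≢ d) q≡ca (d≢q ∘ sym)
        ... | no q≢ca = br-≢₂ (br-trans br (inside q≢ca)) ∘ sym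

      atA : e ≢ q → Br e a (x $ e) → Br e ca (x $ e)
      atA {e} e≢q br with ca Fin.≟ e
      ... | no ca≢e = catch ca≢e (x≢ca e≢q) br
      ... | yes refl = ⊥-elim (avoid x geo (orbit-sym x q∼ca) (br-trans (br-rotate² (qab (e≢q ∘ sym))) br))

      atQ : e ≢ a → Br e q (x $ e) → Br e (x $ a) (x $ e)
      atQ {e} e≢a br with x $ e Fin.≟ a
      ... | yes xe≡a = ⊥-elim (br-next (br-rotate² (subst (Br e ca) xe≡a (geo-orbit x geo q∼ca br))))
      ... | no xe≢a with br-total e≢a (xe≢a ∘ sym) (br-≢₃ br)
      ... | inj₁ ea = geo ea
      ... | inj₂ bad = ⊥-elim (br-next (br-rotate² (br-trans (geo-orbit x geo q∼ca br) bad)))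

    geo-up : Geo z
    geo-up {e} {d} = go (e Fin.≟ a) (e Fin.≟ q) (d Fin.≟ a) (d Fin.≟ q)
      where
      go : Dec (e ≡ a) → Dec (e ≡ q) → Dec (d ≡ a) → Dec (d ≡ q) → Br e d (z $ e) → Br e (z $ d) (z $ e)
      go (yes refl) _ _ _ br = ⊥-elim (br-next (subst (Br e d) za br))
      go (no _) (yes refl) (yes refl) _ br = ⊥-elim (¬qa (subst (Br e d) zq br))
      go (no _) (yes refl) (no _) (yes refl) br = ⊥-elim (br-≢ br refl)
      go (no _) (yes refl) (no d≢a) (no d≢q) br = subst₂ (Br e) (sym (zo d≢a d≢q)) (sym zq)
        (fromq d≢a d≢q (subst (Br e d) zq br))
      go (no e≢a) (no e≢q) (yes refl) _ br = subst₂ (Br e) (sym za) (sym (zo e≢a e≢q))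
        (atA e≢q (subst (Br e d) (zo e≢a e≢q) br))
      go (no e≢a) (no e≢q) (no _) (yes refl) br = subst₂ (Br e) (sym zq) (sym (zo e≢a e≢q))
        (atQ e≢a (subst (Br e d) (zo e≢a e≢q) br))
      go (no e≢a) (no e≢q) (no d≢a) (no d≢q) br = subst₂ (Br e) (sym (zo d≢a d≢q)) (sym (zo e≢a e≢q))
        (geo (subst (Br e d) (zo e≢a e≢q) br))

  rank-c : rank c ≡ n
  rank-c = rank-transitive c λ a → transitive a zero

  transposition : ∀ {p q : Fin (suc n)} → p ≢ q → IsTransposition (transpose p q)
  transposition {p} {q} p≢q = p , q , p≢q , λ _ → refl

  Word : List (Permutation′ (suc n)) → Set
  Word = All IsTransposition

  -- While `x` differs from `c`, some `a` allows an `UpStep`, and each such step raises the rank by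
  -- one. Since ranks are at most `n`, the number `k` with `n ≤ rank x + k` bounds the remaining
  -- steps.
  up-chain : ∀ x → Geo x → ∃ λ us → Word us × x · product us ≈ c × rank x + length us ≡ n
  up-chain x geo = go n x geo (ℕₚ.m≤n+m n (rank x))
    where
    go : ∀ k x → Geo x → n ≤ rank x + k → ∃ λ us → Word us × x · product us ≈ c × rank x + length us ≡ n
    go k x geo bound with Finₚ.any? (λ a → ¬? (x $ a Fin.≟ c $ a))
    ... | no none = [] , [] , x≈c , trans (ℕₚ.+-identityʳ _) (trans (rank-cong {x = x} {c} x≈c) rank-c)
      where
      x≈c : x ≈ c
      x≈c a with x $ a Fin.≟ c $ a
      ... | yes eq = eq
      ... | no neq = contradiction (a , neq) none
    ... | yes (a , neq) = step k bound
      where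
      open UpStep x geo neq
      q = x ⟨$⟩ˡ (c $ a)
      z = x · transpose a q
      rank-z : rank z ≡ suc (rank x)
      rank-z = rank-merge x separate
      step : ∀ k → n ≤ rank x + k → ∃ λ us → Word us × x · product us ≈ c × rank x + length us ≡ n
      step zero bound = contradiction (subst (_≤ n) rank-z (rank≤ z))
        (ℕₚ.≤⇒≯ (subst (n ≤_) (ℕₚ.+-identityʳ _) bound))
      step (suc k) bound with go k z geo-up (subst (λ r → n ≤ r + k) (sym rank-z) (subst (n ≤_) (ℕₚ.+-suc _ k) bound))
      ... | us , word , z·us≈c , len = transpose a q ∷ us , transposition (q≢a ∘ sym) ∷ word , z·us≈c ,
            trans (ℕₚ.+-suc _ _) (trans (cong (_+ length us) (sym rank-z)) len)

  -- Cuts the vertex `k` off its polygon: the predecessor of `k` is sent to the old `x k`, and `k`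
  -- becomes fixed.
  remove : Fin (suc n) → Permutation′ (suc n) → Permutation′ (suc n)
  remove k x = x · transpose (x ⟨$⟩ˡ k) k

  remove-fixes : ∀ k x → remove k x $ k ≡ k
  remove-fixes k x = trans (cong (x $_) (transpose-r (x ⟨$⟩ˡ k) k)) (inverseʳ x)

  preimage-≢ : ∀ {k} (x : Permutation′ (suc n)) → x $ k ≢ k → x ⟨$⟩ˡ k ≢ k
  preimage-≢ {k} x xk≢k eq = xk≢k (trans (cong (x $_) (sym eq)) (inverseʳ x))

  geo-remove : ∀ {k} x → Geo x → x $ k ≢ k → Geo (remove k x)
  geo-remove {k} x geo xk≢k = geo-split x geo (1 , inverseʳ x) (preimage-≢ x xk≢k)

  remove-apart : ∀ {k} x → x $ k ≢ k → ¬ Orbit (remove k x) (x ⟨$⟩ˡ k) k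
  remove-apart {k} x xk≢k o =
    preimage-≢ x xk≢k (sym (orbit-fixed (remove k x) (remove-fixes k x) (orbit-sym (remove k x) o)))

  restore : ∀ k x → remove k x · transpose (x ⟨$⟩ˡ k) k ≈ x
  restore k x a = cong (x $_) (transpose-involutive (x ⟨$⟩ˡ k) k a)

  down-chain : ∀ x → Geo x → ∃ λ ts → Word ts × product ts ≈ x × length ts ≡ rank x
  down-chain x geo = go (rank x) x geo refl
    where
    go : ∀ r x → Geo x → rank x ≡ r → ∃ λ ts → Word ts × product ts ≈ x × length ts ≡ rank x
    go r x geo rank≡ with Finₚ.any? (λ a → ¬? (x $ a Fin.≟ a))
    ... | no none = [] , [] , id≈x , sym (trans (rank-cong {x = x} {idₚ} (sym ∘ id≈x)) (rank-id {suc n}))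
      where
      id≈x : idₚ ≈ x
      id≈x a with x $ a Fin.≟ a
      ... | yes eq = sym eq
      ... | no neq = contradiction (a , neq) none
    ... | yes (k , neq) = step r rank≡
      where
      z = remove k x
      t = transpose (x ⟨$⟩ˡ k) k
      rank-x : rank x ≡ suc (rank z)
      rank-x = trans (sym (rank-cong {x = z · t} {x} (restore k x))) (rank-merge z (remove-apart x neq))
      step : ∀ r → rank x ≡ r → ∃ λ ts → Word ts × product ts ≈ x × length ts ≡ rank x
      step zero rank≡ with () ← trans (sym rank≡) rank-x
      step (suc r) rank≡ with go r z (geo-remove x geo neq) (ℕₚ.suc-injective (trans (sym rank-x) rank≡))
      ... | ts , word , ts≈z , len = ts ++ t ∷ [] , Allₚ.++⁺ word (transposition (preimage-≢ x neq) ∷ []) ,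
            (λ a → trans (product-++ ts (t ∷ []) a) (trans (ts≈z (t $ a)) (restore k x a))) ,
            trans (Listₚ.length-++ ts) (trans (ℕₚ.+-comm (length ts) 1) (trans (cong suc len) (sym rank-x)))

  -- Chains down to the identity and up to `c` give words whose lengths add up to `rank c`. The
  -- words for `x` and `c` are minimal by rank; a shorter word for the quotient would, together with
  -- that for `x`, give a word for `c` shorter than `rank c`.
  geo⇒≤T : ∀ x → Geo x → x ≤T c
  geo⇒≤T x geo with down-chain x geo | up-chain x geo
  ... | ts , wts , ts≈x , lents | us , wus , xus≈c , lenus =
    rank x , length us ,
    ((ts , (wts , ts≈x) , lents) , λ ts′ → rank≤length x ts′) ,
    ((us , (wus , us≈) , refl) , minimal) ,
    ((ts ++ us , (Allₚ.++⁺ wts wus , tsus≈c) , trans (Listₚ.length-++ ts) (cong (_+ length us) lents)) ,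
     λ ws word → subst (_≤ length ws) (trans rank-c (sym lenus)) (rank≤length c ws word))
    where
    us≈ : product us ≈ flip x · c
    us≈ a = perm-injective x (trans (xus≈c a) (sym (inverseʳ x)))
    tsus≈c : product (ts ++ us) ≈ c
    tsus≈c a = trans (product-++ ts us a) (trans (ts≈x (product us $ a)) (xus≈c a))
    minimal : ∀ vs → TranspositionWord (flip x · c) vs → length us ≤ length vs
    minimal vs (wvs , vs≈) = ℕₚ.+-cancelˡ-≤ (rank x) _ _ (begin
      rank x + length us       ≡⟨ trans lenus (sym rank-c) ⟩
      rank c                   ≤⟨ rank≤length c (ts ++ vs) (Allₚ.++⁺ wts wvs , λ a →
                                    trans (product-++ ts vs a) (trans (ts≈x (product vs $ a))
                                      (trans (cong (x $_) (vs≈ a)) (inverseʳ x)))) ⟩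
      length (ts ++ vs)        ≡⟨ Listₚ.length-++ ts ⟩
      length ts + length vs    ≡⟨ cong (_+ length vs) lents ⟩
      rank x + length vs       ∎)
      where open ℕₚ.≤-Reasoning

  geo-c : Geo c
  geo-c br = ⊥-elim (br-next br)

  -- Along a factorisation of c with n letters every letter merges two orbits, so
  -- the prefixes are obtained from c by splitting.
  geo-prefix : ∀ us v → Word us → v · product us ≈ c → rank v + length us ≤ n → Geo v
  geo-prefix [] v [] v≈c _ = geo-cong {x = c} {y = v} (sym ∘ v≈c) geo-c
  geo-prefix (t ∷ us) v ((p , q , p≢q , t≈) ∷ word) v·tus≈c bound with orbit? v p q
  ... | yes p∼q = ⊥-elim (ℕₚ.<-irrefl refl (begin-strict
      n                                    ≡⟨ sym rank-c ⟩
      rank c                               ≡⟨ rank-cong {x = c} {vt · product us} (sym ∘ vt·us≈c) ⟩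
      rank (vt · product us)               ≤⟨ rank-product vt us word ⟩
      rank vt + length us                  ≤⟨ ℕₚ.+-monoˡ-≤ (length us) (rank-mono vt v (split-orbit v p∼q)) ⟩
      rank v + length us                   <⟨ ℕₚ.≤-reflexive (sym (ℕₚ.+-suc _ _)) ⟩
      rank v + length (t ∷ us)             ≤⟨ bound ⟩
      n                                    ∎))
    where
    open ℕₚ.≤-Reasoning
    vt = v · transpose p q
    vt·us≈c : vt · product us ≈ c
    vt·us≈c a = trans (cong (v $_) (sym (t≈ (product us $ a)))) (v·tus≈c a)
  ... | no p≁q = geo-cong {x = vt · transpose p q} {y = v} (λ a → cong (v $_) (transpose-involutive p q a))
      (geo-split vt (geo-prefix us vt word vt·us≈c
          (subst (λ r → r + length us ≤ n) (sym (rank-merge v p≁q)) (subst (_≤ n) (ℕₚ.+-suc _ _) bound)))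
        (Merge.p∼q v p q p≁q) p≢q)
    where
    vt = v · transpose p q
    vt·us≈c : vt · product us ≈ c
    vt·us≈c a = trans (cong (v $_) (sym (t≈ (product us $ a)))) (v·tus≈c a)

  -- The chain from the identity writes `c` with `n` transpositions, so minimality bounds the two
  -- given words by `n` letters together, as `geo-prefix` requires.
  ≤T⇒geo : ∀ x → x ≤T c → Geo x
  ≤T⇒geo x (_ , _ , ((ts , (wts , ts≈x) , refl) , _) , ((us , (wus , us≈) , refl) , _) , (_ , minimal)) =
    let (vs , wvs , vs≈c , lenvs) = up-chain idₚ geo-id in
    geo-prefix us x wus (λ a → trans (cong (x $_) (us≈ a)) (inverseʳ x)) (begin
      rank x + length us      ≤⟨ ℕₚ.+-monoˡ-≤ (length us) (rank≤length x ts (wts , ts≈x)) ⟩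
      length ts + length us   ≤⟨ minimal vs (wvs , vs≈c) ⟩
      length vs               ≡⟨ cong (_+ length vs) (sym (rank-id {suc n})) ⟩
      rank {suc n} idₚ + length vs ≡⟨ lenvs ⟩
      n                       ∎)
    where open ℕₚ.≤-Reasoning

-- The cycle of a standard Coxeter element

at-suc : (c : Permutation′ (suc n)) (k : ℕ) → at c (suc k) ≡ c $ at c k
at-suc c k = iterate-suc (c $_) zero k

record Unimodal {n} (c : Permutation′ (suc n)) : Set where
  field
    peak         : ℕ
    peak≤n       : peak ≤ n
    at-peak      : at c peak ≡ fromℕ n
    rise         : ∀ {a b} → a < b → b ≤ peak → at c a Fin.< at c b
    fall         : ∀ {a b} → peak ≤ a → a < b → b ≤ n → at c b Fin.< at c a
    closed       : at c (suc n) ≡ zero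
    at-surjective : ∀ v → ∃ λ a → a ≤ n × at c a ≡ v
    at-injective : ∀ {a b} → a ≤ n → b ≤ n → at c a ≡ at c b → a ≡ b

unimodal-cong : {c d : Permutation′ (suc n)} → c ≈ d → Unimodal c → Unimodal d
unimodal-cong {n} {c} {d} c≈d u = record
  { peak = peak ; peak≤n = peak≤n ; at-peak = trans (sym (at≡ peak)) at-peak
  ; rise = λ {a} {b} a<b b≤ → subst₂ Fin._<_ (at≡ a) (at≡ b) (rise a<b b≤)
  ; fall = λ {a} {b} ≤a a<b b≤ → subst₂ Fin._<_ (at≡ b) (at≡ a) (fall ≤a a<b b≤)
  ; closed = trans (sym (at≡ (suc n))) closed
  ; at-surjective = λ v → let (a , a≤ , eq) = at-surjective v in a , a≤ , trans (sym (at≡ a)) eq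
  ; at-injective = λ {a} {b} a≤ b≤ eq → at-injective a≤ b≤ (trans (at≡ a) (trans eq (sym (at≡ b)))) }
  where
  open Unimodal u
  at≡ : ∀ k → at c k ≡ at d k
  at≡ = iterate-cong c≈d zero

s₀ : Permutation′ (suc (suc n))
s₀ = transpose zero (suc zero)

s₀-fixes : (v : Fin (suc n)) → v ≢ zero → s₀ $ suc v ≡ suc v
s₀-fixes zero    v≢0 = contradiction refl v≢0
s₀-fixes (suc v) _   = refl

module _ {c : Permutation′ (suc n)} (u : Unimodal c) where

  open Unimodal u

  private
    at≢0 : ∀ {k} → suc k ≤ n → at c (suc k) ≢ zero
    at≢0 k<n eq with () ← at-injective k<n z≤n eq

  -- The new cycle is `zero` followed by the shifted cycle of `c`. All positions move by one, and
  -- `suc zero` comes second, on the rising side.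
  unimodal-above : Unimodal (s₀ · lift₀ c)
  unimodal-above = record
    { peak = suc peak ; peak≤n = s≤s peak≤n ; at-peak = trans (at′ peak≤n) (cong suc at-peak)
    ; rise = rise′ ; fall = fall′
    ; closed = trans (at-suc c′ (suc n)) (trans (cong (c′ $_) (at′ ℕₚ.≤-refl))
        (cong (λ z → s₀ $ suc z) (trans (sym (at-suc c n)) closed)))
    ; at-surjective = surj ; at-injective = inj }
    where
    c′ = s₀ · lift₀ c
    at′ : ∀ {k} → k ≤ n → at c′ (suc k) ≡ suc (at c k)
    at′ {zero}  _   = refl
    at′ {suc k} k<n = trans (at-suc c′ (suc k)) (trans (cong (c′ $_) (at′ (ℕₚ.<⇒≤ k<n)))
      (trans (cong (λ z → s₀ $ suc z) (sym (at-suc c k))) (s₀-fixes _ (at≢0 k<n))))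
    rise′ : ∀ {a b} → a < b → b ≤ suc peak → at c′ a Fin.< at c′ b
    rise′ {zero}  {suc b} _ (s≤s b≤) = subst (Fin.zero {suc n} Fin.<_) (sym (at′ (ℕₚ.≤-trans b≤ peak≤n))) (s≤s z≤n)
    rise′ {suc a} {suc b} (s≤s a<b) (s≤s b≤) =
      subst₂ Fin._<_ (sym (at′ (ℕₚ.≤-trans (ℕₚ.<⇒≤ a<b) (ℕₚ.≤-trans b≤ peak≤n)))) (sym (at′ (ℕₚ.≤-trans b≤ peak≤n)))
        (s≤s (rise a<b b≤))
    fall′ : ∀ {a b} → suc peak ≤ a → a < b → b ≤ suc n → at c′ b Fin.< at c′ a
    fall′ {suc a} {suc b} (s≤s ≤a) (s≤s a<b) (s≤s b≤) =
      subst₂ Fin._<_ (sym (at′ b≤)) (sym (at′ (ℕₚ.≤-trans (ℕₚ.<⇒≤ a<b) b≤))) (s≤s (fall ≤a a<b b≤))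
    surj : ∀ v → ∃ λ a → a ≤ suc n × at c′ a ≡ v
    surj zero    = 0 , z≤n , refl
    surj (suc v) = let (a , a≤ , eq) = at-surjective v in suc a , s≤s a≤ , trans (at′ a≤) (cong suc eq)
    inj : ∀ {a b} → a ≤ suc n → b ≤ suc n → at c′ a ≡ at c′ b → a ≡ b
    inj {zero}  {zero}  _ _ _ = refl
    inj {zero}  {suc b} _ (s≤s b≤) eq with () ← trans eq (at′ b≤)
    inj {suc a} {zero}  (s≤s a≤) _ eq with () ← trans (sym eq) (at′ a≤)
    inj {suc a} {suc b} (s≤s a≤) (s≤s b≤) eq =
      cong suc (at-injective a≤ b≤ (Finₚ.suc-injective (trans (sym (at′ a≤)) (trans eq (at′ b≤)))))

  -- Here `suc zero` comes last, at the end of the falling side, and the other shifted labels keep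
  -- their positions. The condition `0 < n` excludes a peak at position 0, which `zero` now
  -- occupies.
  unimodal-below : 0 < n → Unimodal (lift₀ c · s₀)
  unimodal-below 0<n = go peak refl
    where
    c′ = lift₀ c · s₀
    at′ : ∀ {k} → k ≤ n → at c′ (suc k) ≡ suc (at c (suc k))
    at′ {zero}  _   = refl
    at′ {suc k} k<n = trans (at-suc c′ (suc k)) (trans (cong (c′ $_) (at′ (ℕₚ.<⇒≤ k<n)))
      (trans (cong (lift₀ c $_) (s₀-fixes _ (at≢0 k<n))) (cong suc (sym (at-suc c (suc k))))))
    0≢n : zero ≢ fromℕ n
    0≢n eq = ℕₚ.<⇒≢ 0<n (trans (cong toℕ eq) (Finₚ.toℕ-fromℕ n))
    rise′ : ∀ {a b} → a < b → b ≤ peak → at c′ a Fin.< at c′ b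
    rise′ {zero}  {suc b} _ b≤ = subst (Fin.zero {suc n} Fin.<_) (sym (at′ (ℕₚ.<⇒≤ (ℕₚ.≤-trans b≤ peak≤n)))) (s≤s z≤n)
    rise′ {suc a} {suc b} (s≤s a<b) b≤ =
      subst₂ Fin._<_ (sym (at′ (ℕₚ.≤-trans (ℕₚ.<⇒≤ a<b) b≤n))) (sym (at′ b≤n)) (s≤s (rise (s≤s a<b) b≤))
      where b≤n = ℕₚ.<⇒≤ (ℕₚ.≤-trans b≤ peak≤n)
    fall″ : ∀ {a b} → peak ≤ suc a → a < b → b ≤ n → at c (suc b) Fin.< at c (suc a)
    fall″ {a} {b} ≤a a<b b≤n with ℕₚ.m≤n⇒m<n∨m≡n b≤n
    ... | inj₁ b<n = fall ≤a (s≤s a<b) b<n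
    ... | inj₂ refl = subst (Fin._< at c (suc a)) (sym closed) (nonzero (at c (suc a)) (at≢0 a<b))
      where
      nonzero : ∀ {m} (v : Fin (suc m)) → v ≢ zero → zero {m} Fin.< v
      nonzero zero    v≢0 = contradiction refl v≢0
      nonzero (suc v) _   = s≤s z≤n
    surj : ∀ v → ∃ λ a → a ≤ suc n × at c′ a ≡ v
    surj zero    = 0 , z≤n , refl
    surj (suc v) with at-surjective v
    ... | zero  , _ , eq = suc n , ℕₚ.≤-refl , trans (at′ ℕₚ.≤-refl) (cong suc (trans closed eq))
    ... | suc a , a<n , eq = suc a , s≤s (ℕₚ.<⇒≤ a<n) , trans (at′ (ℕₚ.<⇒≤ a<n)) (cong suc eq)
    inj′ : ∀ {a b} → a ≤ n → b ≤ n → at c (suc a) ≡ at c (suc b) → a ≡ b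
    inj′ a≤ b≤ eq with ℕₚ.m≤n⇒m<n∨m≡n a≤ | ℕₚ.m≤n⇒m<n∨m≡n b≤
    ... | inj₁ a<n  | inj₁ b<n  = ℕₚ.suc-injective (at-injective a<n b<n eq)
    ... | inj₁ a<n  | inj₂ refl = contradiction (trans eq closed) (at≢0 a<n)
    ... | inj₂ refl | inj₁ b<n  = contradiction (trans (sym eq) closed) (at≢0 b<n)
    ... | inj₂ refl | inj₂ refl = refl
    inj : ∀ {a b} → a ≤ suc n → b ≤ suc n → at c′ a ≡ at c′ b → a ≡ b
    inj {zero}  {zero}  _ _ _ = refl
    inj {zero}  {suc b} _ (s≤s b≤) eq with () ← trans eq (at′ b≤)
    inj {suc a} {zero}  (s≤s a≤) _ eq with () ← trans (sym eq) (at′ a≤)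
    inj {suc a} {suc b} (s≤s a≤) (s≤s b≤) eq =
      cong suc (inj′ a≤ b≤ (Finₚ.suc-injective (trans (sym (at′ a≤)) (trans eq (at′ b≤)))))
    go : ∀ e → peak ≡ e → Unimodal c′
    go zero e≡ = contradiction (trans (cong (at c) (sym e≡)) at-peak) 0≢n
    go (suc e) e≡ = record
      { peak = peak ; peak≤n = ℕₚ.m≤n⇒m≤1+n peak≤n
      ; at-peak = trans (cong (at c′) e≡) (trans (at′ (ℕₚ.<⇒≤ (subst (_≤ n) e≡ peak≤n)))
          (cong suc (trans (cong (at c) (sym e≡)) at-peak)))
      ; rise = rise′
      ; fall = λ { {zero} ≤0 _ _ → contradiction (subst (_≤ 0) e≡ ≤0) λ ()
                 ; {suc a} {suc b} ≤a (s≤s a<b) (s≤s b≤) →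
                     subst₂ Fin._<_ (sym (at′ b≤)) (sym (at′ (ℕₚ.≤-trans (ℕₚ.<⇒≤ a<b) b≤))) (s≤s (fall″ ≤a a<b b≤)) }
      ; closed = trans (at-suc c′ (suc n)) (trans (cong (c′ $_) (at′ ℕₚ.≤-refl))
          (cong (λ z → c′ $ suc z) closed))
      ; at-surjective = surj ; at-injective = inj }

⟦⟧-++ : (is js : List (Fin n)) → ⟦ is ++ js ⟧ ≈ ⟦ is ⟧ · ⟦ js ⟧
⟦⟧-++ []       js a = refl
⟦⟧-++ (i ∷ is) js a = cong (s i $_) (⟦⟧-++ is js a)

⟦map-suc⟧ : (is : List (Fin n)) → ⟦ map suc is ⟧ ≈ lift₀ ⟦ is ⟧
⟦map-suc⟧ []       zero    = refl
⟦map-suc⟧ []       (suc a) = refl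
⟦map-suc⟧ (i ∷ is) a       = trans (cong (s (suc i) $_) (⟦map-suc⟧ is a))
  (trans (lift₀-transpose (inject₁ i) (suc i) (lift₀ ⟦ is ⟧ $ a)) (lift a))
  where
  lift : ∀ a → lift₀ (s i) $ lift₀ ⟦ is ⟧ $ a ≡ lift₀ ⟦ i ∷ is ⟧ $ a
  lift zero    = refl
  lift (suc a) = refl

⟦⟧-fixes-zero : (is : List (Fin n)) → All (λ i → toℕ i ≢ 0) is → ⟦ is ⟧ $ zero ≡ zero
⟦⟧-fixes-zero [] [] = refl
⟦⟧-fixes-zero (zero ∷ is)  (≢0 ∷ _)  = contradiction refl ≢0
⟦⟧-fixes-zero (suc i ∷ is) (_ ∷ all) = cong (s (suc i) $_) (⟦⟧-fixes-zero is all)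

-- If `x` fixes `zero`, its lift fixes both labels moved by `s₀`.
s₀-commutes : (x : Permutation′ (suc n)) → x $ zero ≡ zero → s₀ · lift₀ x ≈ lift₀ x · s₀
s₀-commutes x x0 zero          = cong suc (sym x0)
s₀-commutes x x0 (suc zero)    = cong (λ v → s₀ $ suc v) x0
s₀-commutes x x0 (suc (suc v)) = s₀-fixes (x $ suc v) λ eq → case perm-injective x (trans eq (sym x0)) of λ ()

map-suc-++ : (as bs : List (Fin (suc n))) {cs : List (Fin n)} → as ++ bs ≡ map suc cs →
             ∃₂ λ as′ bs′ → as ≡ map suc as′ × bs ≡ map suc bs′ × cs ≡ as′ ++ bs′
map-suc-++ []       bs {cs} eq = [] , cs , refl , eq , refl
map-suc-++ (a ∷ as) bs {c ∷ cs} eq with Listₚ.∷-injective eq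
... | a≡ , eq′ with map-suc-++ as bs eq′
... | as′ , bs′ , refl , refl , refl = c ∷ as′ , bs′ , cong (_∷ map suc as′) a≡ , refl , refl

peel : (is : List (Fin (suc n))) → is ↭ allFin (suc n) →
       ∃₂ λ as bs → is ≡ map suc as ++ zero ∷ map suc bs × as ++ bs ↭ allFin n
peel {n} is is↭ with ∈ₗₚ.∈-∃++ (↭ₚ.∈-resp-↭ (↭-sym is↭) (∈ₗₚ.∈-allFin (zero {n})))
... | as , bs , refl with ↭ₚ.drop-mid as [] is↭
... | rest with ↭ₚ.↭-map-inv suc (subst (_↭ (as ++ bs)) (sym (Listₚ.map-tabulate id suc)) (↭-sym rest))
... | cs , eq , cs↭ with map-suc-++ as bs eq
... | as′ , bs′ , refl , refl , refl = as′ , bs′ , refl , ↭-sym cs↭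

-- s₁ commutes with all letters but s₂, so it can be moved to one end of the word.
coxeter-unimodal : (is : List (Fin n)) → is ↭ allFin n → Unimodal ⟦ is ⟧
coxeter-unimodal {zero} [] _ = record
  { peak = 0 ; peak≤n = z≤n ; at-peak = refl
  ; rise = λ { () z≤n } ; fall = λ { _ () z≤n }
  ; closed = refl
  ; at-surjective = λ { zero → 0 , z≤n , refl } ; at-injective = λ { z≤n z≤n _ → refl } }
coxeter-unimodal {suc n} is is↭ with peel is is↭
-- The letter of value 0 in `as ++ bs` stands, once shifted, for s₂ and occurs only once. If it is
-- not in `as`, then s₁ moves to the front; otherwise it is not in `bs`, and s₁ moves to the end.
... | as , bs , refl , rest = go (any? (λ i → toℕ i ℕ.≟ 0) as)
  where
  u : Unimodal ⟦ as ++ bs ⟧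
  u = coxeter-unimodal (as ++ bs) rest
  whole : ∀ a → ⟦ map suc as ++ zero ∷ map suc bs ⟧ $ a ≡ lift₀ ⟦ as ⟧ $ s₀ $ lift₀ ⟦ bs ⟧ $ a
  whole a = trans (⟦⟧-++ (map suc as) (zero ∷ map suc bs) a)
    (trans (⟦map-suc⟧ as _) (cong (λ z → lift₀ ⟦ as ⟧ $ s₀ $ z) (⟦map-suc⟧ bs a)))
  lift-++ : ∀ a → lift₀ ⟦ as ++ bs ⟧ $ a ≡ lift₀ ⟦ as ⟧ $ lift₀ ⟦ bs ⟧ $ a
  lift-++ zero    = refl
  lift-++ (suc a) = cong suc (⟦⟧-++ as bs a)
  go : Dec _ → Unimodal ⟦ map suc as ++ zero ∷ map suc bs ⟧
  go (no none) = unimodal-cong {c = s₀ · lift₀ ⟦ as ++ bs ⟧}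
    (λ a → sym (trans (whole a) (trans
      (sym (s₀-commutes ⟦ as ⟧ (⟦⟧-fixes-zero as (Allₚ.¬Any⇒All¬ as none)) (lift₀ ⟦ bs ⟧ $ a)))
      (cong (s₀ $_) (sym (lift-++ a)))))) (unimodal-above u)
  go (yes some) = unimodal-cong {c = lift₀ ⟦ as ++ bs ⟧ · s₀}
    (λ a → sym (trans (whole a) (trans
      (cong (lift₀ ⟦ as ⟧ $_) (s₀-commutes ⟦ bs ⟧ (⟦⟧-fixes-zero bs (bs≢0 as some rest)) a))
      (sym (lift-++ (s₀ $ a)))))) (unimodal-below u (0<n some))
    where
    0<n : ∀ {n} {as : List (Fin n)} → Any (λ i → toℕ i ≡ 0) as → 0 < n
    0<n (here {x = zero} _) = s≤s z≤n
    0<n (there a)           = 0<n a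
    bs≢0 : ∀ {n} (as : List (Fin n)) {bs} → Any (λ i → toℕ i ≡ 0) as → as ++ bs ↭ allFin n →
           All (λ i → toℕ i ≢ 0) bs
    bs≢0 {zero} (() ∷ _) _ _
    bs≢0 {suc n} as {bs} some ↭all with ∈ₗₚ.∈-∃++ (zero∈ some)
      where
      zero∈ : ∀ {as : List (Fin (suc n))} → Any (λ i → toℕ i ≡ 0) as → zero ∈ₗ as
      zero∈ (here {x = zero} _) = here refl
      zero∈ (there a)           = there (zero∈ a)
    ... | xs , ys , refl = Allₚ.++⁻ʳ ys (Allₚ.++⁻ʳ xs (↭ₚ.All-resp-↭ (↭-sym
            (↭ₚ.drop-mid xs [] (↭-trans (↭-reflexive (sym (Listₚ.++-assoc xs (zero ∷ ys) bs))) ↭all)))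
            (Allₚ.tabulate⁺ λ _ ())))

-- The circular order of a standard Coxeter element

module CoxeterCircle {n} {c : Permutation′ (suc n)} (u : Unimodal c) where

  open Unimodal u

  pos : Fin (suc n) → ℕ
  pos v = proj₁ (at-surjective v)

  pos≤n : ∀ v → pos v ≤ n
  pos≤n v = proj₁ (proj₂ (at-surjective v))

  at-pos : ∀ v → at c (pos v) ≡ v
  at-pos v = proj₂ (proj₂ (at-surjective v))

  pos-at : ∀ {a} → a ≤ n → pos (at c a) ≡ a
  pos-at a≤n = at-injective (pos≤n _) a≤n (at-pos _)

  pos-injective : ∀ {a b} → pos a ≡ pos b → a ≡ b
  pos-injective {a} {b} eq = trans (sym (at-pos a)) (trans (cong (at c) eq) (at-pos b))

  R⇒≤ : ∀ {v} → R c v → pos v ≤ peak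
  R⇒≤ (e , e≤n , at-e , a , a≤e , refl) with at-injective e≤n peak≤n (trans at-e (sym at-peak))
  ... | refl = subst (_≤ peak) (sym (pos-at (ℕₚ.≤-trans a≤e e≤n))) a≤e

  ≤⇒R : ∀ {v} → pos v ≤ peak → R c v
  ≤⇒R {v} pos≤ = peak , peak≤n , at-peak , pos v , pos≤ , at-pos v

  R? : ∀ v → Dec (R c v)
  R? v = map′ ≤⇒R R⇒≤ (pos v ℕ.≤? peak)

  ¬R⇒L : ∀ {v} → ¬ R c v → L c v
  ¬R⇒L {v} ¬r = peak , peak≤n , at-peak , pos v , ℕₚ.≰⇒≥ (¬r ∘ ≤⇒R) , ℕₚ.m≤n⇒m≤1+n (pos≤n v) , at-pos v

  L-zero : L c zero
  L-zero = peak , peak≤n , at-peak , suc n , ℕₚ.m≤n⇒m≤1+n peak≤n , ℕₚ.≤-refl , closed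

  L-max : L c (fromℕ n)
  L-max = peak , peak≤n , at-peak , peak , ℕₚ.≤-refl , ℕₚ.m≤n⇒m≤1+n peak≤n , at-peak

  -- The two ranges of positions share only the peak; the closing position `suc n` in `L`
  -- contributes the label 1 again.
  R∩L : ∀ {v} → R c v → L c v → v ≡ zero ⊎ v ≡ fromℕ n
  R∩L {v} r (e , e≤n , at-e , a , e≤a , a≤ , refl) with ℕₚ.m≤n⇒m<n∨m≡n a≤
  ... | inj₂ refl = inj₁ closed
  ... | inj₁ (s≤s a≤n) with at-injective e≤n peak≤n (trans at-e (sym at-peak))
  ... | refl with ℕₚ.≤-antisym (subst (_≤ peak) (pos-at a≤n) (R⇒≤ r)) e≤a
  ... | refl = inj₂ at-peak

  rising : ∀ {a b} → pos a ≤ peak → pos b ≤ peak → a Fin.< b → pos a < pos b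
  rising {a} {b} a≤ b≤ a<b with ℕₚ.<-cmp (pos a) (pos b)
  ... | tri< lt _ _ = lt
  ... | tri≈ _ eq _ = contradiction (cong toℕ (pos-injective eq)) (ℕₚ.<⇒≢ a<b)
  ... | tri> _ _ gt = contradiction (subst₂ Fin._<_ (at-pos b) (at-pos a) (rise gt a≤)) (ℕₚ.<⇒≯ a<b)

  falling : ∀ {a b} → peak < pos a → peak < pos b → a Fin.< b → pos b < pos a
  falling {a} {b} a≥ b≥ a<b with ℕₚ.<-cmp (pos b) (pos a)
  ... | tri< lt _ _ = lt
  ... | tri≈ _ eq _ = contradiction (cong toℕ (sym (pos-injective eq))) (ℕₚ.<⇒≢ a<b)
  ... | tri> _ _ gt = contradiction (subst₂ Fin._<_ (at-pos b) (at-pos a) (fall (ℕₚ.<⇒≤ a≥) gt (pos≤n b))) (ℕₚ.<⇒≯ a<b)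

  Between : ℕ → ℕ → ℕ → Set
  Between a b d = a < b × b < d ⊎ b < d × d < a ⊎ d < a × a < b

  coxeter-circle : Circle c
  coxeter-circle = record
    { Br         = λ a b d → Between (pos a) (pos b) (pos d)
    ; br-rotate  = λ { (inj₁ (p , q)) → inj₂ (inj₂ (p , q))
                     ; (inj₂ (inj₁ (p , q))) → inj₁ (p , q)
                     ; (inj₂ (inj₂ (p , q))) → inj₂ (inj₁ (p , q)) }
    ; br-asym    = asym
    ; br-trans   = tr
    ; br-total   = λ a≢b b≢d a≢d → total (a≢b ∘ pos-injective) (b≢d ∘ pos-injective) (a≢d ∘ pos-injective)
    ; br-≢       = λ { (inj₁ (p , q)) eq → ℕₚ.<⇒≢ p (cong pos eq)
                     ; (inj₂ (inj₁ (p , q))) eq → ℕₚ.<⇒≢ (ℕₚ.<-trans p q) (cong pos (sym eq))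
                     ; (inj₂ (inj₂ (p , q))) eq → ℕₚ.<⇒≢ q (cong pos eq) }
    ; br-next    = λ {a} {b} → next a b
    ; transitive = λ a b → orbit-trans c (orbit-sym c (pos a , at-pos a)) (pos b , at-pos b)
    ; Right      = R c
    ; Right?     = R?
    ; br-right   = λ {a} {k} {d} → right {a} {k} {d}
    ; br-left    = λ {a} {k} {d} → left {a} {k} {d}
    }
    where
    asym : ∀ {a b d} → Between a b d → ¬ Between a d b
    asym (inj₁ (p , q)) (inj₁ (r , t)) = ℕₚ.<-asym q t
    asym (inj₁ (p , q)) (inj₂ (inj₁ (r , t))) = ℕₚ.<-asym q r
    asym (inj₁ (p , q)) (inj₂ (inj₂ (r , t))) = ℕₚ.<-asym p r
    asym (inj₂ (inj₁ (p , q))) (inj₁ (r , t)) = ℕₚ.<-asym p t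
    asym (inj₂ (inj₁ (p , q))) (inj₂ (inj₁ (r , t))) = ℕₚ.<-asym p r
    asym (inj₂ (inj₁ (p , q))) (inj₂ (inj₂ (r , t))) = ℕₚ.<-asym q t
    asym (inj₂ (inj₂ (p , q))) (inj₁ (r , t)) = ℕₚ.<-asym p r
    asym (inj₂ (inj₂ (p , q))) (inj₂ (inj₁ (r , t))) = ℕₚ.<-asym q t
    asym (inj₂ (inj₂ (p , q))) (inj₂ (inj₂ (r , t))) = ℕₚ.<-asym p t
    tr : ∀ {a b d e} → Between a b d → Between a d e → Between a b e
    tr (inj₁ (p , q)) (inj₁ (r , t)) = inj₁ (p , ℕₚ.<-trans q t)
    tr (inj₁ (p , q)) (inj₂ (inj₁ (r , t))) = contradiction (ℕₚ.<-trans p q) (ℕₚ.<-asym (ℕₚ.<-trans r t))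
    tr (inj₁ (p , q)) (inj₂ (inj₂ (r , t))) = inj₂ (inj₂ (r , p))
    tr (inj₂ (inj₁ (p , q))) (inj₁ (r , t)) = contradiction q (ℕₚ.<-asym r)
    tr (inj₂ (inj₁ (p , q))) (inj₂ (inj₁ (r , t))) = inj₂ (inj₁ (ℕₚ.<-trans p r , t))
    tr (inj₂ (inj₁ (p , q))) (inj₂ (inj₂ (r , t))) = contradiction q (ℕₚ.<-asym t)
    tr (inj₂ (inj₂ (p , q))) (inj₁ (r , t)) = contradiction p (ℕₚ.<-asym r)
    tr (inj₂ (inj₂ (p , q))) (inj₂ (inj₁ (r , t))) = inj₂ (inj₂ (t , q))
    tr (inj₂ (inj₂ (p , q))) (inj₂ (inj₂ (r , t))) = contradiction p (ℕₚ.<-asym t)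
    total : ∀ {a b d} → a ≢ b → b ≢ d → a ≢ d → Between a b d ⊎ Between a d b
    total {a} {b} {d} a≢b b≢d a≢d with ℕₚ.<-cmp a b | ℕₚ.<-cmp b d | ℕₚ.<-cmp a d
    ... | tri≈ _ eq _ | _ | _ = contradiction eq a≢b
    ... | _ | tri≈ _ eq _ | _ = contradiction eq b≢d
    ... | _ | _ | tri≈ _ eq _ = contradiction eq a≢d
    ... | tri< p _ _ | tri< q _ _ | _ = inj₁ (inj₁ (p , q))
    ... | tri< p _ _ | tri> _ _ q | tri< r _ _ = inj₂ (inj₁ (r , q))
    ... | tri< p _ _ | tri> _ _ q | tri> _ _ r = inj₁ (inj₂ (inj₂ (r , p)))
    ... | tri> _ _ p | tri< q _ _ | tri< r _ _ = inj₂ (inj₂ (inj₂ (p , r)))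
    ... | tri> _ _ p | tri< q _ _ | tri> _ _ r = inj₁ (inj₂ (inj₁ (q , r)))
    ... | tri> _ _ p | tri> _ _ q | _ = inj₂ (inj₂ (inj₁ (q , p)))
    next : ∀ a b → ¬ Between (pos a) (pos b) (pos (c $ a))
    next a b btw with ℕₚ.m≤n⇒m<n∨m≡n (pos≤n a)
    ... | inj₁ a<n = go (subst (Between (pos a) (pos b)) pos-ca btw)
      where
      pos-ca : pos (c $ a) ≡ suc (pos a)
      pos-ca = trans (cong pos (trans (cong (c $_) (sym (at-pos a))) (sym (at-suc c (pos a))))) (pos-at a<n)
      go : ¬ Between (pos a) (pos b) (suc (pos a))
      go (inj₁ (p , q)) = ℕₚ.<⇒≱ p (ℕ.s≤s⁻¹ q)
      go (inj₂ (inj₁ (p , q))) = ℕₚ.<-asym q (ℕₚ.n<1+n _)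
      go (inj₂ (inj₂ (p , q))) = ℕₚ.<-asym p (ℕₚ.n<1+n _)
    ... | inj₂ a≡n = go (subst (Between (pos a) (pos b)) pos-ca btw)
      where
      pos-ca : pos (c $ a) ≡ 0
      pos-ca = trans (cong pos (trans (cong (c $_) (trans (sym (at-pos a)) (cong (at c) a≡n)))
        (trans (sym (at-suc c n)) closed))) (pos-at z≤n)
      go : ¬ Between (pos a) (pos b) 0
      go (inj₁ (p , ()))
      go (inj₂ (inj₁ (() , q)))
      go (inj₂ (inj₂ (p , q))) = ℕₚ.<⇒≱ q (subst (pos b ≤_) (sym a≡n) (pos≤n b))
    -- Labels increase with the position up to the peak and decrease after it. So from a rising `k`
    -- onwards the circle runs through larger labels before it descends, on the falling side, to
    -- those below `k`.
    right : ∀ {a k d} → a Fin.< k → k Fin.< d → R c k → Between (pos a) (pos k) (pos d)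
    right {a} {k} {d} a<k k<d r with pos a ℕ.≤? peak | pos d ℕ.≤? peak
    ... | yes a≤ | yes d≤ = inj₁ (rising a≤ (R⇒≤ r) a<k , rising (R⇒≤ r) d≤ k<d)
    ... | yes a≤ | no  d> = inj₁ (rising a≤ (R⇒≤ r) a<k , ℕₚ.≤-<-trans (R⇒≤ r) (ℕₚ.≰⇒> d>))
    ... | no  a> | yes d≤ = inj₂ (inj₁ (rising (R⇒≤ r) d≤ k<d , ℕₚ.≤-<-trans d≤ (ℕₚ.≰⇒> a>)))
    ... | no  a> | no  d> = inj₂ (inj₁ (ℕₚ.≤-<-trans (R⇒≤ r) (ℕₚ.≰⇒> d>) ,
                              falling (ℕₚ.≰⇒> a>) (ℕₚ.≰⇒> d>) (ℕₚ.<-trans a<k k<d)))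
    left : ∀ {a k d} → a Fin.< k → k Fin.< d → ¬ R c k → Between (pos a) (pos d) (pos k)
    left {a} {k} {d} a<k k<d ¬r = go (pos a ℕ.≤? peak) (pos d ℕ.≤? peak)
      where
      k> : peak < pos k
      k> = ℕₚ.≰⇒> (¬r ∘ ≤⇒R)
      go : Dec (pos a ≤ peak) → Dec (pos d ≤ peak) → Between (pos a) (pos d) (pos k)
      go (yes a≤) (yes d≤) = inj₁ (rising a≤ d≤ (ℕₚ.<-trans a<k k<d) , ℕₚ.≤-<-trans d≤ k>)
      go (yes a≤) (no  d>) = inj₁ (ℕₚ.≤-<-trans a≤ (ℕₚ.≰⇒> d>) , falling k> (ℕₚ.≰⇒> d>) k<d)
      go (no  a>) (yes d≤) = inj₂ (inj₁ (ℕₚ.≤-<-trans d≤ k> , falling (ℕₚ.≰⇒> a>) k> a<k))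
      go (no  a>) (no  d>) = inj₂ (inj₁ (falling k> (ℕₚ.≰⇒> d>) k<d , falling (ℕₚ.≰⇒> a>) k> a<k))

-- Lattice paths

cnt? : {P : Fin m → Set} → Decidable P → (k : ℕ) → Decidable (λ a → toℕ a < k × P a)
cnt? P? k a = (toℕ a ℕ.<? k) ×-dec P? a

abstract
  cnt : {P : Fin m → Set} → Decidable P → ℕ → ℕ
  cnt P? k = # (cnt? P? k)

  cnt-def : {P : Fin m → Set} (P? : Decidable P) (k : ℕ) → cnt P? k ≡ # (cnt? P? k)
  cnt-def P? k = refl

module _ {P : Fin m → Set} (P? : Decidable P) where

  cnt-zero : cnt P? 0 ≡ 0
  cnt-zero = trans (cnt-def P? 0) (sum-zero λ a → ind-no (cnt? P? 0 a) λ { (() , _) })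

  cnt-yes : ∀ κ → P κ → cnt P? (suc (toℕ κ)) ≡ suc (cnt P? (toℕ κ))
  cnt-yes κ p = trans (cnt-def P? _) (trans
    (#-insert (cnt? P? (toℕ κ)) (cnt? P? (suc (toℕ κ))) κ (λ { a (a<κ , pa) → ℕₚ.m<n⇒m<1+n a<κ , pa })
      (λ { a (a≤κ , pa) → split a pa (ℕₚ.m≤n⇒m<n∨m≡n (ℕ.s≤s⁻¹ a≤κ)) }) (ℕₚ.n<1+n _ , p) (ℕₚ.<-irrefl refl ∘ proj₁))
    (cong suc (sym (cnt-def P? _))))
    where
    split : ∀ a → P a → toℕ a < toℕ κ ⊎ toℕ a ≡ toℕ κ → (toℕ a < toℕ κ × P a) ⊎ a ≡ κ
    split a pa (inj₁ a<κ) = inj₁ (a<κ , pa)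
    split a pa (inj₂ a≡κ) = inj₂ (Finₚ.toℕ-injective a≡κ)

  cnt-no : ∀ κ → ¬ P κ → cnt P? (suc (toℕ κ)) ≡ cnt P? (toℕ κ)
  cnt-no κ ¬p = trans (cnt-def P? _) (trans
    (#-cong (cnt? P? (suc (toℕ κ))) (cnt? P? (toℕ κ)) (λ a → mk⇔
      (λ (a≤κ , pa) → ℕₚ.≤∧≢⇒< (ℕ.s≤s⁻¹ a≤κ) (λ eq → ¬p (subst P (Finₚ.toℕ-injective eq) pa)) , pa)
      (λ (a<κ , pa) → ℕₚ.m<n⇒m<1+n a<κ , pa)))
    (sym (cnt-def P? _)))

  cnt-mono : ∀ {k l} → k ≤ l → cnt P? k ≤ cnt P? l
  cnt-mono {k} {l} k≤l = subst₂ _≤_ (sym (cnt-def P? k)) (sym (cnt-def P? l))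
    (#-mono (cnt? P? k) (cnt? P? l) λ { a (a<k , pa) → ℕₚ.<-≤-trans a<k k≤l , pa })

cnt-cong : {P Q : Fin m → Set} (P? : Decidable P) (Q? : Decidable Q) → (∀ a → P a ⇔ Q a) → ∀ k → cnt P? k ≡ cnt Q? k
cnt-cong P? Q? e k = trans (cnt-def P? k) (trans
  (#-cong (cnt? P? k) (cnt? Q? k) λ a → mk⇔ (λ (a<k , p) → a<k , Equivalence.to (e a) p) (λ (a<k , q) → a<k , Equivalence.from (e a) q))
  (sym (cnt-def Q? k)))

-- A lattice path: D and U are the sets of up- and down-steps.
record Valid {n} {D U : Fin (suc n) → Set} (D? : Decidable D) (U? : Decidable U) : Set where
  field
    ballot   : ∀ κ → U κ → cnt U? (toℕ κ) < cnt D? (toℕ κ)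
    balanced : cnt U? (suc n) ≡ cnt D? (suc n)

-- The number of these elements is the height of the lattice path of x at k.
Above : Permutation′ m → ℕ → Fin m → Set
Above x k a = toℕ a < k × k ≤ toℕ (x $ a)

Above? : (x : Permutation′ m) (k : ℕ) → Decidable (Above x k)
Above? x k a = (toℕ a ℕ.<? k) ×-dec (k ℕ.≤? toℕ (x $ a))

above-cross : (x : Permutation′ m) {k : ℕ} {a b : Fin m} → toℕ a < k → k ≤ toℕ b → Orbit x a b → ∃ (Above x k)
above-cross x {k} {a} {b} a<k k≤b (i , eq) = go i a<k eq
  where
  go : ∀ i {a} → toℕ a < k → iterate (x $_) a i ≡ b → ∃ (Above x k)
  go zero    a<k refl = contradiction k≤b (ℕₚ.<⇒≱ a<k)
  go (suc i) {a} a<k eq with k ℕ.≤? toℕ (x $ a)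
  ... | yes k≤ = a , a<k , k≤
  ... | no ≰ = go i (ℕₚ.≰⇒> ≰) eq

module _ {D U : Fin m → Set} (D? : Decidable D) (U? : Decidable U) (x : Permutation′ m)
         (local : ∀ k → ind (D? k) + ind ((x ⟨$⟩ˡ k) Fin.<? k) ≡ ind (U? k) + ind (k Fin.<? (x $ k))) where

  -- By `local`, D minus U at a label is the indicator of an upward arrow leaving it minus that of
  -- an upward arrow arriving. Summed over labels below `k`, arrows with both ends there cancel and
  -- those crossing `k` remain. Adding `# dn` to both sides avoids subtraction.
  height : ∀ k → cnt D? k ≡ cnt U? k + # (Above? x k)
  height k = ℕₚ.+-cancelʳ-≡ (# dn) _ _ (begin
    cnt D? k + # dn                  ≡⟨ cong (_+ # dn) (cnt-def D? k) ⟩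
    # (cnt? D? k) + # dn             ≡⟨ sym (∑-distrib-+ (λ a → ind (cnt? D? k a)) (λ a → ind (dn a))) ⟩
    sum (λ a → ind (cnt? D? k a) + ind (dn a)) ≡⟨ sum-cong-≗ pointwise ⟩
    sum (λ a → ind (cnt? U? k a) + ind (up a)) ≡⟨ ∑-distrib-+ (λ a → ind (cnt? U? k a)) (λ a → ind (up a)) ⟩
    # (cnt? U? k) + # up             ≡⟨ cong₂ _+_ (sym (cnt-def U? k)) up≡ ⟩
    cnt U? k + (# (Above? x k) + # dn) ≡⟨ sym (ℕₚ.+-assoc (cnt U? k) _ _) ⟩
    cnt U? k + # (Above? x k) + # dn ∎)
    where
    open ≡-Reasoning
    dn : Decidable (λ a → toℕ a < k × (x ⟨$⟩ˡ a) Fin.< a)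
    dn = cnt? (λ a → (x ⟨$⟩ˡ a) Fin.<? a) k
    up : Decidable (λ a → toℕ a < k × a Fin.< (x $ a))
    up = cnt? (λ a → a Fin.<? (x $ a)) k
    pointwise : ∀ a → ind (cnt? D? k a) + ind (dn a) ≡ ind (cnt? U? k a) + ind (up a)
    pointwise a = go (toℕ a ℕ.<? k)
      where
      both : {P : Fin _ → Set} (P? : Decidable P) → toℕ a < k → ind (cnt? P? k a) ≡ ind (P? a)
      both P? a<k = ind-cong (cnt? P? k a) (P? a) (mk⇔ proj₂ (a<k ,_))
      none : {P : Fin _ → Set} (P? : Decidable P) → ¬ toℕ a < k → ind (cnt? P? k a) ≡ 0
      none P? a≮k = ind-no (cnt? P? k a) (a≮k ∘ proj₁)
      go : Dec (toℕ a < k) → ind (cnt? D? k a) + ind (dn a) ≡ ind (cnt? U? k a) + ind (up a)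
      go (yes a<k) = trans (cong₂ _+_ (both D? a<k) (both (λ a → (x ⟨$⟩ˡ a) Fin.<? a) a<k))
        (trans (local a) (sym (cong₂ _+_ (both U? a<k) (both (λ a → a Fin.<? (x $ a)) a<k))))
      go (no a≮k) = trans (cong₂ _+_ (none D? a≮k) (none (λ a → (x ⟨$⟩ˡ a) Fin.<? a) a≮k))
        (sym (cong₂ _+_ (none U? a≮k) (none (λ a → a Fin.<? (x $ a)) a≮k)))
    up≡ : # up ≡ # (Above? x k) + # dn
    -- Reindexing along `x` counts the arrows arriving below `k` by their sources; an upward arrow
    -- that starts below `k` either arrives below `k` or crosses.
    up≡ = sym (trans (cong (# (Above? x k) +_) (sum-permute (λ a → ind (dn a)) x))
      (trans (sym (∑-distrib-+ (λ a → ind (Above? x k a)) (λ a → ind (dn (x $ a))))) (sum-cong-≗ each)))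
      where
      each : ∀ a → ind (Above? x k a) + ind (dn (x $ a)) ≡ ind (up a)
      each a = go (k ℕ.≤? toℕ (x $ a))
        where
        go : Dec (k ≤ toℕ (x $ a)) → ind (Above? x k a) + ind (dn (x $ a)) ≡ ind (up a)
        go (yes k≤) = trans (cong (ind (Above? x k a) +_) (ind-no (dn (x $ a)) (ℕₚ.≤⇒≯ k≤ ∘ proj₁)))
          (trans (ℕₚ.+-identityʳ _) (ind-cong (Above? x k a) (up a)
            (mk⇔ (λ (a<k , _) → a<k , ℕₚ.<-≤-trans a<k k≤) (λ (a<k , _) → a<k , k≤))))
        go (no k≰) = trans (cong (_+ ind (dn (x $ a))) (ind-no (Above? x k a) (k≰ ∘ proj₂)))
          (ind-cong (dn (x $ a)) (up a) (mk⇔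
            (λ (xa<k , lt) → ℕₚ.<-trans (a<xa lt) xa<k , a<xa lt)
            (λ (a<k , lt) → ℕₚ.≰⇒> k≰ , subst (Fin._< (x $ a)) (sym (inverseˡ x)) lt)))
          where
          a<xa : (x ⟨$⟩ˡ (x $ a)) Fin.< (x $ a) → a Fin.< (x $ a)
          a<xa = subst (Fin._< (x $ a)) (inverseˡ x)

  height-positive : ∀ {k a} → Above x k a → cnt U? k < cnt D? k
  height-positive {k} ab = subst (cnt U? k <_) (sym (height k)) (ℕₚ.m<m+n (cnt U? k) (#-pos (Above? x k) ab))

  height-witness : ∀ {k} → cnt U? k < cnt D? k → ∃ (Above x k)
  height-witness {k} lt = #-witness (Above? x k) (ℕₚ.+-cancelˡ-< (cnt U? k) 0 _
    (subst₂ _<_ (sym (ℕₚ.+-identityʳ _)) (height k) lt))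

  height-end : cnt U? m ≡ cnt D? m
  height-end = sym (trans (height m) (trans (cong (cnt U? m +_)
    (sum-zero λ a → ind-no (Above? x m a) λ (_ , m≤) → ℕₚ.<⇒≱ (Finₚ.toℕ<n (x $ a)) m≤)) (ℕₚ.+-identityʳ _)))

ind-≶ : {a b : Fin m} → a ≢ b → ind (a Fin.<? b) + ind (b Fin.<? a) ≡ 1
ind-≶ {a = a} {b} a≢b with ℕₚ.<-cmp (toℕ a) (toℕ b)
... | tri< a<b _ b≮a = cong₂ _+_ (ind-yes (a Fin.<? b) a<b) (ind-no (b Fin.<? a) b≮a)
... | tri≈ _ a≡b _ = contradiction (Finₚ.toℕ-injective a≡b) a≢b
... | tri> a≮b _ b<a = cong₂ _+_ (ind-no (a Fin.<? b) a≮b) (ind-yes (b Fin.<? a) b<a)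

≮∧≢⇒> : {a b : Fin m} → ¬ a Fin.< b → a ≢ b → b Fin.< a
≮∧≢⇒> a≮b a≢b = ℕₚ.≤∧≢⇒< (ℕₚ.≮⇒≥ a≮b) (a≢b ∘ sym ∘ Finₚ.toℕ-injective)

fixed-inverse : (x : Permutation′ m) {k : Fin m} → x $ k ≡ k → x ⟨$⟩ˡ k ≡ k
fixed-inverse x eq = trans (cong (x ⟨$⟩ˡ_) (sym eq)) (inverseˡ x)

inverse-fixed : (x : Permutation′ m) {k : Fin m} → x ⟨$⟩ˡ k ≡ k → x $ k ≡ k
inverse-fixed x eq = trans (cong (x $_) (sym eq)) (inverseʳ x)

orbit-preimage : (x : Permutation′ m) {k : Fin m} → Orbit x k (x ⟨$⟩ˡ k)
orbit-preimage x {k} = orbit-sym x (1 , inverseʳ x)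

fixed⇒¬Up : (x : Permutation′ m) {k : Fin m} → x $ k ≡ k → ¬ Up x k
fixed⇒¬Up x eq (b , b<k , k∼b) = ℕₚ.<-irrefl (cong toℕ (sym (orbit-fixed x eq k∼b))) b<k

fixed⇒¬Dn : (x : Permutation′ m) {k : Fin m} → x $ k ≡ k → ¬ Dn x k
fixed⇒¬Dn x eq (b , k<b , k∼b) = ℕₚ.<-irrefl (cong toℕ (orbit-fixed x eq k∼b)) k<b

¬Up∧¬Dn⇒fixed : (x : Permutation′ m) {k : Fin m} → ¬ Up x k → ¬ Dn x k → x $ k ≡ k
¬Up∧¬Dn⇒fixed x {k} ¬u ¬d with ℕₚ.<-cmp (toℕ (x $ k)) (toℕ k)
... | tri< lt _ _ = contradiction (x $ k , lt , orbit-step x) ¬u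
... | tri≈ _ eq _ = Finₚ.toℕ-injective eq
... | tri> _ _ gt = contradiction (x $ k , gt , orbit-step x) ¬d

-- The path of a noncrossing element determines it

module Bits {n} {c : Permutation′ (suc n)} (circle : Circle c) where

  open Geometry circle public

  module _ (x : Permutation′ (suc n)) (geo : Geo x) where

    -- If the preimage of `k` were larger, the arc from it to `k` would pass the smaller vertex `b`,
    -- against `avoid`. So smaller vertices force the polygon to arrive from below at a right label;
    -- the next three lemmas are the mirror images.
    right-up : ∀ {k} → Right k → Up x k → (x ⟨$⟩ˡ k) Fin.< k
    right-up {k} r u@(b , b<k , k∼b) with (x ⟨$⟩ˡ k) Fin.<? k
    ... | yes lt = lt
    ... | no ≮ = ⊥-elim (avoid x geo (orbit-trans x (1 , inverseʳ x) k∼b)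
            (subst (Br (x ⟨$⟩ˡ k) b) (sym (inverseʳ x)) (br-rotate² (br-right b<k k<x⁻¹k r))))
      where
      k<x⁻¹k : k Fin.< (x ⟨$⟩ˡ k)
      k<x⁻¹k = ≮∧≢⇒> ≮ λ eq → fixed⇒¬Up x (inverse-fixed x eq) u

    left-up : ∀ {k} → ¬ Right k → Up x k → (x $ k) Fin.< k
    left-up {k} ¬r u@(b , b<k , k∼b) with (x $ k) Fin.<? k
    ... | yes lt = lt
    ... | no ≮ = ⊥-elim (avoid x geo k∼b (br-rotate² (br-left b<k (≮∧≢⇒> ≮ λ eq → fixed⇒¬Up x eq u) ¬r)))

    right-dn : ∀ {k} → Right k → Dn x k → k Fin.< (x $ k)
    right-dn {k} r d@(b , k<b , k∼b) with k Fin.<? (x $ k)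
    ... | yes lt = lt
    ... | no ≮ = ⊥-elim (avoid x geo k∼b (br-rotate (br-right (≮∧≢⇒> ≮ λ eq → fixed⇒¬Dn x (sym eq) d) k<b r)))

    left-dn : ∀ {k} → ¬ Right k → Dn x k → k Fin.< (x ⟨$⟩ˡ k)
    left-dn {k} ¬r d@(b , k<b , k∼b) with k Fin.<? (x ⟨$⟩ˡ k)
    ... | yes lt = lt
    ... | no ≮ = ⊥-elim (avoid x geo (orbit-trans x (1 , inverseʳ x) k∼b)
            (subst (Br (x ⟨$⟩ˡ k) b) (sym (inverseʳ x)) (br-left x⁻¹k<k k<b ¬r)))
      where
      x⁻¹k<k : (x ⟨$⟩ˡ k) Fin.< k
      x⁻¹k<k = ≮∧≢⇒> ≮ λ eq → fixed⇒¬Dn x (inverse-fixed x (sym eq)) d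

    private
      image-up : ∀ {k} → (x $ k) Fin.< k → Up x k
      image-up lt = _ , lt , orbit-step x
      image-dn : ∀ {k} → k Fin.< (x $ k) → Dn x k
      image-dn lt = _ , lt , orbit-step x
      preimage-up : ∀ {k} → (x ⟨$⟩ˡ k) Fin.< k → Up x k
      preimage-up lt = _ , lt , orbit-preimage x
      preimage-dn : ∀ {k} → k Fin.< (x ⟨$⟩ˡ k) → Dn x k
      preimage-dn lt = _ , lt , orbit-preimage x

      balance : ∀ k → ind (k Fin.<? (x $ k)) + ind ((x $ k) Fin.<? k) ≡ ind (k Fin.<? (x ⟨$⟩ˡ k)) + ind ((x ⟨$⟩ˡ k) Fin.<? k)
      balance k with x $ k Fin.≟ k
      ... | no neq = trans (ind-≶ (neq ∘ sym)) (sym (ind-≶ (neq ∘ inverse-fixed x ∘ sym)))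
      ... | yes eq = trans (cong₂ _+_ (no< eq) (no> eq))
              (sym (cong₂ _+_ (no< (fixed-inverse x eq)) (no> (fixed-inverse x eq))))
        where
        no< : ∀ {b} → b ≡ k → ind (k Fin.<? b) ≡ 0
        no< {b} eq = ind-no (k Fin.<? b) (ℕₚ.<-irrefl (cong toℕ (sym eq)))
        no> : ∀ {b} → b ≡ k → ind (b Fin.<? k) ≡ 0
        no> {b} eq = ind-no (b Fin.<? k) (ℕₚ.<-irrefl (cong toℕ eq))

      dnR : ∀ {k} → Right k → ind (Dn? x k) ≡ ind (k Fin.<? (x $ k))
      dnR {k} r = ind-cong (Dn? x k) (k Fin.<? (x $ k)) (mk⇔ (right-dn r) image-dn)
      upR : ∀ {k} → Right k → ind (Up? x k) ≡ ind ((x ⟨$⟩ˡ k) Fin.<? k)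
      upR {k} r = ind-cong (Up? x k) ((x ⟨$⟩ˡ k) Fin.<? k) (mk⇔ (right-up r) preimage-up)
      dnL : ∀ {k} → ¬ Right k → ind (Dn? x k) ≡ ind (k Fin.<? (x ⟨$⟩ˡ k))
      dnL {k} ¬r = ind-cong (Dn? x k) (k Fin.<? (x ⟨$⟩ˡ k)) (mk⇔ (left-dn ¬r) preimage-dn)
      upL : ∀ {k} → ¬ Right k → ind (Up? x k) ≡ ind ((x $ k) Fin.<? k)
      upL {k} ¬r = ind-cong (Up? x k) ((x $ k) Fin.<? k) (mk⇔ (left-up ¬r) image-up)

    local : ∀ k → ind (Dn? x k) + ind ((x ⟨$⟩ˡ k) Fin.<? k) ≡ ind (Up? x k) + ind (k Fin.<? (x $ k))
    local k with Right? k
    ... | yes r = trans (cong₂ _+_ (dnR r) (sym (upR r))) (ℕₚ.+-comm (ind (k Fin.<? (x $ k))) _)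
    ... | no ¬r = trans (cong (_+ ind ((x ⟨$⟩ˡ k) Fin.<? k)) (dnL ¬r)) (trans (sym (balance k))
            (trans (ℕₚ.+-comm (ind (k Fin.<? (x $ k))) _) (cong (_+ ind (k Fin.<? (x $ k))) (sym (upL ¬r)))))

    -- Needed for left labels in `Up`: there it is the inverse whose arrow arrives from below, and
    -- this arrow witnesses the positive height in `bits-valid`.
    local-inverse : ∀ k → ind (Dn? x k) + ind ((x $ k) Fin.<? k) ≡ ind (Up? x k) + ind (k Fin.<? (x ⟨$⟩ˡ k))
    local-inverse k with Right? k
    ... | no ¬r = trans (cong₂ _+_ (dnL ¬r) (sym (upL ¬r))) (ℕₚ.+-comm (ind (k Fin.<? (x ⟨$⟩ˡ k))) _)
    ... | yes r = trans (cong (_+ ind ((x $ k) Fin.<? k)) (dnR r)) (trans (balance k)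
            (trans (ℕₚ.+-comm (ind (k Fin.<? (x ⟨$⟩ˡ k))) _) (cong (_+ ind (k Fin.<? (x ⟨$⟩ˡ k))) (sym (upR r)))))

    bits-valid : Valid (Dn? x) (Up? x)
    bits-valid = record { ballot = ballot ; balanced = height-end (Dn? x) (Up? x) x local }
      where
      ballot : ∀ κ → Up x κ → cnt (Up? x) (toℕ κ) < cnt (Dn? x) (toℕ κ)
      ballot κ u with Right? κ
      ... | yes r = height-positive (Dn? x) (Up? x) x local {a = x ⟨$⟩ˡ κ}
                      (right-up r u , ℕₚ.≤-reflexive (cong toℕ (sym (inverseʳ x))))
      ... | no ¬r = height-positive (Dn? x) (Up? x) (flip x) local-inverse {a = x $ κ}
                      (left-up ¬r u , ℕₚ.≤-reflexive (cong toℕ (sym (inverseˡ x))))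

  SameBits : (x y : Permutation′ (suc n)) → Set
  SameBits x y = (∀ k → Dn x k ⇔ Dn y k) × (∀ k → Up x k ⇔ Up y k)

  sameBits-sym : ∀ {x y} → SameBits x y → SameBits y x
  sameBits-sym (d , u) = (λ k → mk⇔ (Equivalence.from (d k)) (Equivalence.to (d k))) ,
                         (λ k → mk⇔ (Equivalence.from (u k)) (Equivalence.to (u k)))

  -- Scanning the labels upwards, the arrows of x between labels ≤ κ are determined by the bits.
  private
    Agree : (x y : Permutation′ (suc n)) → Fin (suc n) → Set
    Agree x y κ = ∀ a → a Fin.< κ → (x $ a) Fin.< κ → x $ a ≡ y $ a

    module Determined (x y : Permutation′ (suc n)) (geox : Geo x) (geoy : Geo y) (same : SameBits x y)
                      (κ : Fin (suc n)) (xy : Agree x y κ) (yx : Agree y x κ) where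

      up : Up x κ → Up y κ
      up = Equivalence.to (proj₂ same κ)

      beyond : ∀ {x y} → Agree x y κ → ∀ {q} → q Fin.< κ → y $ q ≡ κ → x $ q ≢ κ → κ Fin.< (x $ q)
      beyond {x} agree {q} q<κ yq xq≢κ with (x $ q) Fin.<? κ
      ... | yes lt = contradiction (trans (agree q q<κ lt) yq) xq≢κ
      ... | no ≮ = ≮∧≢⇒> ≮ xq≢κ

      -- The preimage of κ is the last point before κ whose arrow crosses κ.
      private
        crossing : ∀ {x} → Geo x → Right κ → ∀ {p q} → p Fin.< κ → x $ p ≡ κ → κ Fin.< (x $ q) → ¬ Br p q κ
        crossing {x} geo r {p} {q} p<κ xp κ<xq br = br-asym (br-right p<κ κ<xq r)
          (subst (Br p (x $ q)) xp (geo (subst (Br p q) (sym xp) br)))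

      preimages : Right κ → Up x κ → x ⟨$⟩ˡ κ ≡ y ⟨$⟩ˡ κ
      preimages r u with (x ⟨$⟩ˡ κ) Fin.≟ (y ⟨$⟩ˡ κ)
      ... | yes eq = eq
      ... | no neq with br-total neq (ℕₚ.<⇒≢ q<κ ∘ cong toℕ) (ℕₚ.<⇒≢ p<κ ∘ cong toℕ)
        where
        p<κ = right-up x geox r u
        q<κ = right-up y geoy r (up u)
      ... | inj₁ pqκ = ⊥-elim (crossing {x} geox r (right-up x geox r u) (inverseʳ x)
              (beyond {x} {y} xy (right-up y geoy r (up u)) (inverseʳ y)
                λ eq → neq (perm-injective x (trans (inverseʳ x) (sym eq)))) pqκ)
      ... | inj₂ pκq = ⊥-elim (crossing {y} geoy r (right-up y geoy r (up u)) (inverseʳ y)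
              (beyond {y} {x} yx (right-up x geox r u) (inverseʳ x)
                λ eq → neq (perm-injective y (trans eq (sym (inverseʳ y))))) (br-rotate² pκq))

      private
        beyond′ : ∀ {x y} → Agree x y κ → (y $ κ) Fin.< κ → x $ κ ≢ y $ κ → κ Fin.< (x ⟨$⟩ˡ (y $ κ))
        beyond′ {x} {y} agree b<κ neq with (x ⟨$⟩ˡ (y $ κ)) Fin.<? κ
        ... | yes lt = contradiction (cong toℕ (perm-injective y (trans (sym (agree _ lt
                (subst (Fin._< κ) (sym (inverseʳ x)) b<κ))) (inverseʳ x)))) (ℕₚ.<⇒≢ lt)
        ... | no ≮ = ≮∧≢⇒> ≮ λ eq → neq (trans (cong (x $_) (sym eq)) (inverseʳ x))
        crossing′ : ∀ {x} → Geo x → ¬ Right κ → ∀ {b} → (x $ κ) Fin.< κ → κ Fin.< (x ⟨$⟩ˡ b) → ¬ Br κ b (x $ κ)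
        crossing′ {x} geo ¬r {b} xκ<κ κ<m br = br-asym (br-rotate² (br-left xκ<κ κ<m ¬r))
          (geo-orbit x geo (orbit-preimage x) br)

      images : ¬ Right κ → Up x κ → x $ κ ≡ y $ κ
      images ¬r u with (x $ κ) Fin.≟ (y $ κ)
      ... | yes eq = eq
      ... | no neq with br-total (ℕₚ.<⇒≢ b<κ ∘ cong toℕ ∘ sym) neq (ℕₚ.<⇒≢ b′<κ ∘ cong toℕ ∘ sym)
        where
        b<κ = left-up x geox ¬r u
        b′<κ = left-up y geoy ¬r (up u)
      ... | inj₁ κbb′ = ⊥-elim (crossing′ {y} geoy ¬r (left-up y geoy ¬r (up u))
              (beyond′ {y} {x} yx (left-up x geox ¬r u) (neq ∘ sym)) κbb′)
      ... | inj₂ κb′b = ⊥-elim (crossing′ {x} geox ¬r (left-up x geox ¬r u)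
              (beyond′ {x} {y} xy (left-up y geoy ¬r (up u)) neq) κb′b)

      private
        below : ¬ Dn x κ → ∀ {z} → Orbit x κ z → z ≢ κ → z Fin.< κ
        below ¬d {z} κ∼z z≢κ with z Fin.<? κ
        ... | yes lt = lt
        ... | no ≮ = contradiction (z , ≮∧≢⇒> ≮ z≢κ , κ∼z) ¬d

      -- All other vertices of the polygon lie below `κ`, where the arrows of `x` and `y` agree, so
      -- `x κ` is in the `y`-orbit of `κ` as well. Its `y`-preimage `w` cannot be smaller than `κ`
      -- by agreement, nor larger since `κ` closes its polygon in `y` too.
      closed-image : ¬ Dn x κ → x ⟨$⟩ˡ κ ≡ y ⟨$⟩ˡ κ → (x $ κ) Fin.< κ → x $ κ ≡ y $ κ
      closed-image ¬d pre b<κ = go (ℕₚ.<-cmp (toℕ w) (toℕ κ))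
        where
        b w : Fin (suc n)
        b = x $ κ
        w = y ⟨$⟩ˡ b
        ym : y $ w ≡ b
        ym = inverseʳ y
        path : ∀ j z → Orbit x κ z → iterate (x $_) z j ≡ κ → Orbit y κ z
        path zero    z _   refl = orbit-refl y
        path (suc j) z κ∼z eq = step (z Fin.≟ κ) ((x $ z) Fin.≟ κ)
          where
          step : Dec (z ≡ κ) → Dec (x $ z ≡ κ) → Orbit y κ z
          step (yes z≡κ) _ = subst (Orbit y κ) (sym z≡κ) (orbit-refl y)
          step (no z≢κ) (yes xz≡κ) = subst (Orbit y κ)
            (trans (sym pre) (trans (cong (x ⟨$⟩ˡ_) (sym xz≡κ)) (inverseˡ x))) (orbit-preimage y)
          step (no z≢κ) (no xz≢κ) = orbit-trans y (path j (x $ z) (orbit-trans x κ∼z (orbit-step x)) eq)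
            (orbit-sym y (1 , sym (xy z (below ¬d κ∼z z≢κ) (below ¬d (orbit-trans x κ∼z (orbit-step x)) xz≢κ))))
        κ∼b : Orbit y κ b
        κ∼b with orbit-step-sym x {κ}
        ... | j , eq = path j b (orbit-step x) eq
        go : _ → x $ κ ≡ y $ κ
        go (tri< w<κ _ _) = contradiction (cong toℕ (perm-injective x
          (trans (sym (yx w w<κ (subst (Fin._< κ) (sym ym) b<κ))) ym))) (ℕₚ.<⇒≢ w<κ)
        go (tri≈ _ w≡κ _) = trans (sym ym) (cong (y $_) (Finₚ.toℕ-injective w≡κ))
        go (tri> _ _ κ<w) = contradiction (Equivalence.from (proj₁ same κ)
          (w , κ<w , orbit-trans y κ∼b (orbit-preimage y))) ¬d

      closed-preimage : ¬ Dn x κ → x $ κ ≡ y $ κ → ∀ {a} → a Fin.< κ → x $ a ≡ κ → y $ a ≡ κ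
      closed-preimage ¬d img {a} a<κ xa = go (ℕₚ.<-cmp (toℕ (y $ a)) (toℕ κ))
        where
        path : ∀ j → Orbit y κ (iterate (x $_) κ j)
        path zero    = orbit-refl y
        path (suc j) = subst (Orbit y κ) (sym (iterate-suc (x $_) κ j)) (step (z Fin.≟ κ) ((x $ z) Fin.≟ κ))
          where
          z = iterate (x $_) κ j
          step : Dec (z ≡ κ) → Dec (x $ z ≡ κ) → Orbit y κ (x $ z)
          step (yes z≡κ) _ = subst (Orbit y κ) (trans (sym img) (cong (x $_) (sym z≡κ))) (orbit-step y)
          step (no _) (yes xz≡κ) = subst (Orbit y κ) (sym xz≡κ) (orbit-refl y)
          step (no z≢κ) (no xz≢κ) = orbit-trans y (path j)
            (1 , sym (xy z (below ¬d (j , refl) z≢κ) (below ¬d (orbit-trans x (j , refl) (orbit-step x)) xz≢κ)))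
        κ∼a : Orbit y κ a
        κ∼a with orbit-sym x (1 , xa)
        ... | j , eq = subst (Orbit y κ) eq (path j)
        go : _ → y $ a ≡ κ
        go (tri< lt _ _) = trans (yx a a<κ lt) xa
        go (tri≈ _ eq _) = Finₚ.toℕ-injective eq
        go (tri> _ _ gt) = contradiction (Equivalence.from (proj₁ same κ)
          (y $ a , gt , orbit-trans y κ∼a (orbit-step y))) ¬d

      -- On the right, `preimages` settles the arrow into `κ`; an arrow from `κ` to a smaller label
      -- means that `κ` closes its polygon, and then `closed-image` applies. On the left, images and
      -- preimages exchange roles.
      step : ∀ a → a Fin.≤ κ → (x $ a) Fin.≤ κ → x $ a ≡ y $ a
      step a a≤κ xa≤κ with ℕₚ.m≤n⇒m<n∨m≡n a≤κ | ℕₚ.m≤n⇒m<n∨m≡n xa≤κ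
      ... | inj₁ a<κ | inj₁ xa<κ = xy a a<κ xa<κ
      ... | inj₁ a<κ | inj₂ xa≡ = trans xa≡κ (sym goal)
        where
        xa≡κ = Finₚ.toℕ-injective xa≡
        κ∼a : Orbit x κ a
        κ∼a = orbit-sym x (1 , xa≡κ)
        goal : y $ a ≡ κ
        goal with Right? κ
        ... | yes r = trans (cong (y $_) (trans (sym (trans (cong (x ⟨$⟩ˡ_) (sym xa≡κ)) (inverseˡ x)))
                (preimages r (a , a<κ , κ∼a)))) (inverseʳ y)
        ... | no ¬r = closed-preimage (λ d → ℕₚ.<-asym (left-dn x geox ¬r d)
                (subst (Fin._< κ) (sym (trans (cong (x ⟨$⟩ˡ_) (sym xa≡κ)) (inverseˡ x))) a<κ))
                (images ¬r (a , a<κ , κ∼a)) a<κ xa≡κ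
      ... | inj₂ a≡ | inj₁ xa<κ with Finₚ.toℕ-injective a≡
      ...   | refl with Right? κ
      ...     | no ¬r = images ¬r (_ , xa<κ , orbit-step x)
      ...     | yes r = closed-image (λ d → ℕₚ.<-asym (right-dn x geox r d) xa<κ)
                          (preimages r (_ , xa<κ , orbit-step x)) xa<κ
      step a a≤κ xa≤κ | inj₂ a≡ | inj₂ xa≡ with Finₚ.toℕ-injective a≡
      ... | refl = trans fixed (sym (¬Up∧¬Dn⇒fixed y
              (fixed⇒¬Up x fixed ∘ Equivalence.from (proj₂ same κ)) (fixed⇒¬Dn x fixed ∘ Equivalence.from (proj₁ same κ))))
        where fixed = Finₚ.toℕ-injective xa≡

  -- Each arrow is compared when the scan reaches the larger of its ends. Agreement of `x` with `y`
  -- and of `y` with `x` are proved together because each step uses both.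
  bits-injective : ∀ {x y} → Geo x → Geo y → SameBits x y → x ≈ y
  bits-injective {x} {y} geox geoy same a = conclude x y (λ κ → proj₁ (go (suc n) κ (Finₚ.toℕ<n κ))) a
    where
    UpTo : (x y : Permutation′ (suc n)) → Fin (suc n) → Set
    UpTo x y κ = ∀ a → a Fin.≤ κ → (x $ a) Fin.≤ κ → x $ a ≡ y $ a
    conclude : ∀ x y → (∀ κ → UpTo x y κ) → ∀ a → x $ a ≡ y $ a
    conclude x y f a with ℕₚ.≤-total (toℕ a) (toℕ (x $ a))
    ... | inj₁ a≤ = f (x $ a) a a≤ ℕₚ.≤-refl
    ... | inj₂ ≤a = f a a ℕₚ.≤-refl ≤a
    agree : ∀ x y κ → (∀ λ′ → λ′ Fin.< κ → UpTo x y λ′) → Agree x y κ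
    agree x y κ f a a<κ xa<κ with ℕₚ.≤-total (toℕ a) (toℕ (x $ a))
    ... | inj₁ a≤ = f (x $ a) xa<κ a a≤ ℕₚ.≤-refl
    ... | inj₂ ≤a = f a a<κ a ℕₚ.≤-refl ≤a
    go : ∀ k κ → toℕ κ < k → UpTo x y κ × UpTo y x κ
    go (suc k) κ κ<k = Determined.step x y geox geoy same κ xy yx ,
                       Determined.step y x geoy geox (sameBits-sym {x} {y} same) κ yx xy
      where
      xy = agree x y κ λ l l<κ → proj₁ (go k l (ℕₚ.<-≤-trans l<κ (ℕ.s≤s⁻¹ κ<k)))
      yx = agree y x κ λ l l<κ → proj₂ (go k l (ℕₚ.<-≤-trans l<κ (ℕ.s≤s⁻¹ κ<k)))

-- Drawing an element with a given path

maximum : {P : Fin m → Set} (P? : Decidable P) {_⊏_ : Fin m → Fin m → Set} →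
          (∀ {a b} → P a → P b → a ≢ b → a ⊏ b ⊎ b ⊏ a) → (∀ {a b d} → a ⊏ b → b ⊏ d → a ⊏ d) →
          ∃ P → ∃ λ p → P p × ∀ a → P a → a ≢ p → a ⊏ p
maximum {m} {P} P? {_⊏_} total tr (a , Pa) = let (p , Pp , top) = go m in
  p , Pp , λ b Pb b≢p → top b (Finₚ.toℕ<n b) Pb b≢p
  where
  Top : ℕ → Fin m → Set
  Top k p = ∀ b → toℕ b < k → P b → b ≢ p → b ⊏ p
  extend : ∀ {k} {p κ : Fin m} → toℕ κ ≡ k → P p → Dec (P κ) → Top k p → ∃ λ p → P p × Top (suc k) p
  extend {k} {p} {κ} κ≡k Pp Pκ? top = go Pκ? (κ Fin.≟ p)
    where
    keep : (P κ → κ ≢ p → κ ⊏ p) → Top (suc k) p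
    keep κ⊏p b b≤k Pb b≢p with ℕₚ.m≤n⇒m<n∨m≡n (ℕ.s≤s⁻¹ b≤k)
    ... | inj₁ b<k = top b b<k Pb b≢p
    ... | inj₂ b≡k with Finₚ.toℕ-injective (trans b≡k (sym κ≡k))
    ...   | refl = κ⊏p Pb b≢p
    go : Dec (P κ) → Dec (κ ≡ p) → ∃ λ p → P p × Top (suc k) p
    go (no ¬Pκ) _ = p , Pp , keep λ Pκ → contradiction Pκ ¬Pκ
    go (yes Pκ) (yes κ≡p) = p , Pp , keep λ _ κ≢p → contradiction κ≡p κ≢p
    go (yes Pκ) (no κ≢p) with total Pκ Pp κ≢p
    ... | inj₁ κ⊏p = p , Pp , keep λ _ _ → κ⊏p
    ... | inj₂ p⊏κ = κ , Pκ , above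
      where
      above : Top (suc k) κ
      above b b≤k Pb b≢κ with ℕₚ.m≤n⇒m<n∨m≡n (ℕ.s≤s⁻¹ b≤k) | b Fin.≟ p
      ... | inj₂ b≡k | _ = contradiction (Finₚ.toℕ-injective (trans b≡k (sym κ≡k))) b≢κ
      ... | inj₁ b<k | yes refl = p⊏κ
      ... | inj₁ b<k | no b≢p = tr (top b b<k Pb b≢p) p⊏κ
  go : ∀ k → ∃ λ p → P p × Top k p
  go zero = a , Pa , λ _ ()
  go (suc k) with go k | k ℕ.<? m
  ... | p , Pp , top | yes k<m = extend {κ = fromℕ< k<m} (Finₚ.toℕ-fromℕ< k<m) Pp (P? (fromℕ< k<m)) top
  ... | p , Pp , top | no k≮m = p , Pp , λ b b≤k → top b (ℕₚ.<-≤-trans (Finₚ.toℕ<n b) (ℕₚ.≮⇒≥ k≮m))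

module Scan {n} {c : Permutation′ (suc n)} (circle : Circle c)
            {D U : Fin (suc n) → Set} (D? : Decidable D) (U? : Decidable U) (valid : Valid D? U?) where

  open Bits circle
  open Valid valid

  -- The diagram drawn after reading the labels below k. Each polygon that is still to be
  -- extended is represented in Op by its last vertex before the gap in which the labels
  -- from k onwards lie; these representatives are visible from the gap.
  record Stage (k : ℕ) : Set₁ where
    field
      y       : Permutation′ (suc n)
      fixes   : ∀ a → k ≤ toℕ a → y $ a ≡ a
      geo     : Geo y
      Op      : Fin (suc n) → Set
      Op?     : Decidable Op
      op<     : ∀ {p} → Op p → toℕ p < k
      visible : ∀ {p} → Op p → ∀ m → k ≤ toℕ m → ∀ a → a ≢ p → Br a m (y $ a) ⇔ Br a p (y $ a)
      exit    : ∀ {p} → Op p → ∀ m → k ≤ toℕ m → y $ p ≡ p ⊎ Br p m (y $ p)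
      count   : cnt D? k ≡ cnt U? k + # Op?
      up      : ∀ a → toℕ a < k → Up y a ⇔ U a
      dn      : ∀ a → toℕ a < k → D a ⇔ (Dn y a ⊎ ∃ λ p → Op p × Orbit y p a)

  start : Stage 0
  start = record
    { y = idₚ ; fixes = λ _ _ → refl ; geo = geo-id ; Op = λ _ → ⊥ ; Op? = λ _ → no λ ()
    ; op< = λ () ; visible = λ () ; exit = λ ()
    ; count = trans (cnt-zero D?) (trans (sym (cnt-zero U?)) (sym (trans (cong (cnt U? 0 +_) (sum-zero {suc n} λ _ → refl))
        (ℕₚ.+-identityʳ _))))
    ; up = λ _ () ; dn = λ _ () }

  module Step (κ : Fin (suc n)) (stage : Stage (toℕ κ)) where

    open Stage stage

    κ-fixed : y $ κ ≡ κ
    κ-fixed = fixes κ ℕₚ.≤-refl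

    y< : ∀ {a} → a Fin.< κ → (y $ a) Fin.< κ
    y< {a} a<κ = ℕₚ.≰⇒> λ κ≤ya → ℕₚ.<⇒≱ a<κ
      (subst (κ Fin.≤_) (perm-injective y (fixes (y $ a) κ≤ya)) κ≤ya)

    κ-alone : ∀ {a} → Orbit y a κ → a ≡ κ
    κ-alone a∼κ = sym (orbit-fixed y κ-fixed (orbit-sym y a∼κ))

    op≢κ : ∀ {p} → Op p → p ≢ κ
    op≢κ op = ℕₚ.<⇒≢ (op< op) ∘ cong toℕ

    -- For a moved `a`, both `m` and `κ` exceed `a` and `y a`, so their position relative to this
    -- arrow is decided by the side of the larger of `a` and `y a`.
    shift-gap : ∀ m → κ Fin.< m → ∀ a → a ≢ κ → Br a m (y $ a) ⇔ Br a κ (y $ a)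
    shift-gap m κ<m a a≢κ with ℕₚ.<-cmp (toℕ a) (toℕ κ)
    ... | tri≈ _ a≡κ _ = contradiction (Finₚ.toℕ-injective a≡κ) a≢κ
    ... | tri> _ _ κ<a = mk⇔ (λ br → contradiction (sym fixed) (br-≢₃ br)) (λ br → contradiction (sym fixed) (br-≢₃ br))
      where fixed = fixes a (ℕₚ.<⇒≤ κ<a)
    ... | tri< a<κ _ _ with ℕₚ.<-cmp (toℕ a) (toℕ (y $ a)) | Right? a | Right? (y $ a)
    ...   | tri≈ _ eq _ | _ | _ = mk⇔ (λ br → contradiction (Finₚ.toℕ-injective eq) (br-≢₃ br))
                                      (λ br → contradiction (Finₚ.toℕ-injective eq) (br-≢₃ br))
    ...   | tri< lt _ _ | _ | yes r = mk⇔ (λ br → ⊥-elim (br-asym br (br-right lt (ℕₚ.<-trans (y< a<κ) κ<m) r)))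
                                          (λ br → ⊥-elim (br-asym br (br-right lt (y< a<κ) r)))
    ...   | tri< lt _ _ | _ | no ¬r = mk⇔ (λ _ → br-left lt (y< a<κ) ¬r)
                                          (λ _ → br-left lt (ℕₚ.<-trans (y< a<κ) κ<m) ¬r)
    ...   | tri> _ _ gt | yes r | _ = mk⇔ (λ _ → br-rotate (br-right gt a<κ r))
                                          (λ _ → br-rotate (br-right gt (ℕₚ.<-trans a<κ κ<m) r))
    ...   | tri> _ _ gt | no ¬r | _ = mk⇔
              (λ br → ⊥-elim (br-asym br (br-rotate² (br-left gt (ℕₚ.<-trans a<κ κ<m) ¬r))))
              (λ br → ⊥-elim (br-asym br (br-rotate² (br-left gt a<κ ¬r))))

    data UpTo (a : Fin (suc n)) : Set where
      before : a Fin.< κ → UpTo a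
      here   : a ≡ κ → UpTo a

    up-to : ∀ {a} → toℕ a < suc (toℕ κ) → UpTo a
    up-to {a} a≤κ with ℕₚ.m≤n⇒m<n∨m≡n (ℕ.s≤s⁻¹ a≤κ)
    ... | inj₁ a<κ = before a<κ
    ... | inj₂ a≡κ = here (Finₚ.toℕ-injective a≡κ)

    module Skip (¬Uκ : ¬ U κ) where

      Op′ : Fin (suc n) → Set
      Op′ a = Op a ⊎ (a ≡ κ × D κ)

      Op′? : Decidable Op′
      Op′? a = Op? a ⊎-dec ((a Fin.≟ κ) ×-dec D? κ)

      count′ : Dec (D κ) → cnt D? (suc (toℕ κ)) ≡ cnt U? (suc (toℕ κ)) + # Op′?
      count′ (yes d) = trans (cnt-yes D? κ d) (trans (cong suc count) (trans (sym (ℕₚ.+-suc _ _))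
        (cong₂ _+_ (sym (cnt-no U? κ ¬Uκ)) (sym (#-insert Op? Op′? κ (λ _ → inj₁)
          (λ { _ (inj₁ o) → inj₁ o ; _ (inj₂ (eq , _)) → inj₂ eq }) (inj₂ (refl , d)) (λ o → op≢κ o refl))))))
      count′ (no ¬d) = trans (cnt-no D? κ ¬d) (trans count (cong₂ _+_ (sym (cnt-no U? κ ¬Uκ))
        (#-cong Op? Op′? λ a → mk⇔ inj₁ λ { (inj₁ o) → o ; (inj₂ (_ , d)) → contradiction d ¬d })))

      up′ : ∀ a → UpTo a → Up y a ⇔ U a
      up′ a (before a<κ) = up a a<κ
      up′ a (here refl)  = mk⇔ (λ u → contradiction u (fixed⇒¬Up y κ-fixed)) (λ u → contradiction u ¬Uκ)

      dn′ : ∀ a → UpTo a → D a ⇔ (Dn y a ⊎ ∃ λ p → Op′ p × Orbit y p a)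
      dn′ a (before a<κ) = mk⇔ (λ d → case Equivalence.to (dn a a<κ) d of λ
          { (inj₁ dn) → inj₁ dn ; (inj₂ (p , o , p∼a)) → inj₂ (p , inj₁ o , p∼a) })
        λ { (inj₁ dn₁) → Equivalence.from (dn a a<κ) (inj₁ dn₁)
          ; (inj₂ (p , inj₁ o , p∼a)) → Equivalence.from (dn a a<κ) (inj₂ (p , o , p∼a))
          ; (inj₂ (p , inj₂ (refl , _) , κ∼a)) →
              contradiction (cong toℕ (κ-alone (orbit-sym y κ∼a))) (ℕₚ.<⇒≢ a<κ) }
      dn′ a (here refl) = mk⇔ (λ d → inj₂ (a , inj₂ (refl , d) , orbit-refl y))
        λ { (inj₁ dn₁) → contradiction dn₁ (fixed⇒¬Dn y κ-fixed)
          ; (inj₂ (p , inj₁ o , p∼κ)) → contradiction (κ-alone p∼κ) (op≢κ o)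
          ; (inj₂ (p , inj₂ (_ , d) , _)) → d }

      next : Stage (suc (toℕ κ))
      next = record
        { y = y ; fixes = λ a κ<a → fixes a (ℕₚ.<⇒≤ κ<a) ; geo = geo ; Op = Op′ ; Op? = Op′?
        ; op< = λ { (inj₁ o) → ℕₚ.m<n⇒m<1+n (op< o) ; (inj₂ (refl , _)) → ℕₚ.n<1+n _ }
        ; visible = λ { (inj₁ o) m κ<m → visible o m (ℕₚ.<⇒≤ κ<m)
                      ; (inj₂ (refl , _)) m κ<m a a≢κ → shift-gap m κ<m a a≢κ }
        ; exit = λ { (inj₁ o) m κ<m → exit o m (ℕₚ.<⇒≤ κ<m) ; (inj₂ (refl , _)) m κ<m → inj₁ κ-fixed }
        ; count = count′ (D? κ)
        ; up = λ a a≤κ → up′ a (up-to a≤κ)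
        ; dn = λ a a≤κ → dn′ a (up-to a≤κ) }

    -- p is the representative next to κ on the side of κ.
    Extremal : Fin (suc n) → Set
    Extremal p = (Right κ × ∀ q → Op q → q ≢ p → Br q p κ) ⊎ (¬ Right κ × ∀ q → Op q → q ≢ p → Br p q κ)

    module Join (Uκ : U κ) {p : Fin (suc n)} (op : Op p) (extremal : Extremal p) where

      p≢κ : p ≢ κ
      p≢κ = op≢κ op

      p≁κ : ¬ Orbit y p κ
      p≁κ p∼κ = p≢κ (κ-alone p∼κ)

      open Merge y p κ p≁κ using (z; p∼q; widen; narrow; Joined; joined⇒orbit)

      zp : z $ p ≡ κ
      zp = trans (cong (y $_) (transpose-l p κ)) κ-fixed

      zκ : z $ κ ≡ y $ p
      zκ = cong (y $_) (transpose-r p κ)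

      zo : ∀ {a} → a ≢ p → a ≢ κ → z $ a ≡ y $ a
      zo a≢p a≢κ = cong (y $_) (transpose-other a≢p a≢κ)

      exitκ : y $ p ≡ p ⊎ Br p κ (y $ p)
      exitκ = exit op κ ℕₚ.≤-refl

      ¬κp : ¬ Br κ p (y $ p)
      ¬κp br with exitκ
      ... | inj₁ yp = br-≢₂ br (sym yp)
      ... | inj₂ pκ = br-asym br (br-rotate pκ)

      geo-z : Geo z
      geo-z = geo-join y geo κ-fixed p≢κ (λ a a≢p _ → visible op κ ℕₚ.≤-refl a a≢p) ¬κp

      -- If the polygon stays open, the last vertex before the new gap is `κ` when `κ` is on the
      -- right. On the left the gap lies between `p` and `κ`, so that `p` keeps its role.
      Op′ : Fin (suc n) → Set
      Op′ a = (Op a × a ≢ p) ⊎ (D κ × (Right κ × a ≡ κ ⊎ ¬ Right κ × a ≡ p))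

      Op′? : Decidable Op′
      Op′? a = (Op? a ×-dec ¬? (a Fin.≟ p)) ⊎-dec
        (D? κ ×-dec ((Right? κ ×-dec (a Fin.≟ κ)) ⊎-dec (¬? (Right? κ) ×-dec (a Fin.≟ p))))

      private
        false⇔ : {A B : Set} → ¬ A → ¬ B → A ⇔ B
        false⇔ ¬a ¬b = mk⇔ (λ a → contradiction a ¬a) (λ b → contradiction b ¬b)
        true⇔ : {A B : Set} → A → B → A ⇔ B
        true⇔ a b = mk⇔ (λ _ → b) (λ _ → a)

      visible-z : ∀ {q} m → (p ≢ q → Br p m κ ⇔ Br p q κ) → (κ ≢ q → Br κ m (y $ p) ⇔ Br κ q (y $ p)) →
                  (∀ a → a ≢ p → a ≢ κ → a ≢ q → Br a m (y $ a) ⇔ Br a q (y $ a)) →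
                  ∀ a → a ≢ q → Br a m (z $ a) ⇔ Br a q (z $ a)
      visible-z {q} m atp atκ other a a≢q = go (a Fin.≟ p) (a Fin.≟ κ)
        where
        go : Dec (a ≡ p) → Dec (a ≡ κ) → Br a m (z $ a) ⇔ Br a q (z $ a)
        go (yes refl) _ = subst (λ e → Br a m e ⇔ Br a q e) (sym zp) (atp a≢q)
        go (no _) (yes refl) = subst (λ e → Br a m e ⇔ Br a q e) (sym zκ) (atκ a≢q)
        go (no a≢p) (no a≢κ) = subst (λ e → Br a m e ⇔ Br a q e) (sym (zo a≢p a≢κ)) (other a a≢p a≢κ a≢q)

      module _ (m : Fin (suc n)) (κ<m : κ Fin.< m) where

        κ≤m = ℕₚ.<⇒≤ κ<m

        module OnRight (r : Right κ) (top : ∀ q → Op q → q ≢ p → Br q p κ) where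

          pκm : Br p κ m
          pκm = br-right (op< op) κ<m r

          κm : Br κ m (y $ p)
          κm with exit op m κ≤m
          ... | inj₁ yp = subst (Br κ m) (sym yp) (br-rotate pκm)
          ... | inj₂ pm = br-trans′ pκm pm

          κq : ∀ {q} → Op q → q ≢ p → Br κ q (y $ p)
          κq {q} o q≢p with exitκ
          ... | inj₁ yp = subst (Br κ q) (sym yp) (br-rotate² (top q o q≢p))
          ... | inj₂ pκ = br-trans′ (br-rotate (top q o q≢p))
                  (Equivalence.to (visible o κ ℕₚ.≤-refl p (q≢p ∘ sym)) pκ)

          visible-old : ∀ {q} → Op q → q ≢ p → ∀ a → a ≢ q → Br a m (z $ a) ⇔ Br a q (z $ a)
          visible-old {q} o q≢p = visible-z m
            (λ _ → false⇔ (br-asym pκm) (λ br → br-asym br (br-rotate (top q o q≢p))))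
            (λ _ → true⇔ κm (κq o q≢p))
            (λ a _ _ a≢q → visible o m κ≤m a a≢q)

          visible-new : ∀ a → a ≢ κ → Br a m (z $ a) ⇔ Br a κ (z $ a)
          visible-new = visible-z m
            (λ _ → false⇔ (br-asym pκm) (λ br → br-≢₂ br refl))
            (λ κ≢κ → contradiction refl κ≢κ)
            (λ a _ a≢κ _ → shift-gap m κ<m a a≢κ)

          exit-new : Br κ m (z $ κ)
          exit-new = subst (Br κ m) (sym zκ) κm

        module OnLeft (¬r : ¬ Right κ) (bottom : ∀ q → Op q → q ≢ p → Br p q κ) where

          pmκ : Br p m κ
          pmκ = br-left (op< op) κ<m ¬r

          ¬κm : ¬ Br κ m (y $ p)
          ¬κm br = br-asym br (br-rotate² (br-left (y< (op< op)) κ<m ¬r))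

          ¬κq : ∀ {q} → Op q → q ≢ p → ¬ Br κ q (y $ p)
          ¬κq {q} o q≢p br with exitκ
          ... | inj₁ yp = br-asym (bottom q o q≢p) (br-rotate² (subst (Br κ q) yp br))
          ... | inj₂ pκ = br-asym br (br-rotate (br-trans′ (bottom q o q≢p) pκ))

          visible-old : ∀ {q} → Op q → q ≢ p → ∀ a → a ≢ q → Br a m (z $ a) ⇔ Br a q (z $ a)
          visible-old {q} o q≢p = visible-z m
            (λ _ → true⇔ pmκ (bottom q o q≢p))
            (λ _ → false⇔ ¬κm (¬κq o q≢p))
            (λ a _ _ a≢q → visible o m κ≤m a a≢q)

          visible-p : ∀ a → a ≢ p → Br a m (z $ a) ⇔ Br a p (z $ a)
          visible-p = visible-z m
            (λ p≢p → contradiction refl p≢p)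
            (λ _ → false⇔ ¬κm ¬κp)
            (λ a a≢p _ _ → visible op m κ≤m a a≢p)

          exit-p : Br p m (z $ p)
          exit-p = subst (Br p m) (sym zp) pmκ

        visible′ : Extremal p → ∀ {q} → Op′ q → ∀ a → a ≢ q → Br a m (z $ a) ⇔ Br a q (z $ a)
        visible′ (inj₁ (r , top)) (inj₁ (o , q≢p)) = OnRight.visible-old r top o q≢p
        visible′ (inj₂ (¬r , bottom)) (inj₁ (o , q≢p)) = OnLeft.visible-old ¬r bottom o q≢p
        visible′ (inj₁ (r , top)) (inj₂ (_ , inj₁ (_ , refl))) = OnRight.visible-new r top
        visible′ (inj₂ (¬r , _)) (inj₂ (_ , inj₁ (r , _))) = contradiction r ¬r
        visible′ (inj₁ (r , _)) (inj₂ (_ , inj₂ (¬r , _))) = contradiction r ¬r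
        visible′ (inj₂ (¬r , bottom)) (inj₂ (_ , inj₂ (_ , refl))) = OnLeft.visible-p ¬r bottom

        exit′ : Extremal p → ∀ {q} → Op′ q → z $ q ≡ q ⊎ Br q m (z $ q)
        exit′ _ {q} (inj₁ (o , q≢p)) = subst (λ e → e ≡ q ⊎ Br q m e) (sym (zo q≢p (op≢κ o))) (exit o m κ≤m)
        exit′ (inj₁ (r , top)) (inj₂ (_ , inj₁ (_ , refl))) = inj₂ (OnRight.exit-new r top)
        exit′ (inj₂ (¬r , _)) (inj₂ (_ , inj₁ (r , _))) = contradiction r ¬r
        exit′ (inj₁ (r , _)) (inj₂ (_ , inj₂ (¬r , _))) = contradiction r ¬r
        exit′ (inj₂ (¬r , bottom)) (inj₂ (_ , inj₂ (_ , refl))) = inj₂ (OnLeft.exit-p ¬r bottom)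

      op<′ : ∀ {q} → Op′ q → toℕ q < suc (toℕ κ)
      op<′ (inj₁ (o , _)) = ℕₚ.m<n⇒m<1+n (op< o)
      op<′ (inj₂ (_ , inj₁ (_ , refl))) = ℕₚ.n<1+n _
      op<′ (inj₂ (_ , inj₂ (_ , refl))) = ℕₚ.m<n⇒m<1+n (op< op)

      count′ : cnt D? (suc (toℕ κ)) ≡ cnt U? (suc (toℕ κ)) + # Op′?
      count′ = go (D? κ)
        where
        Rest? : Decidable (λ a → Op a × a ≢ p)
        Rest? a = Op? a ×-dec ¬? (a Fin.≟ p)
        rest : # Op? ≡ suc (# Rest?)
        rest = #-insert Rest? Op? p (λ _ → proj₁) (λ a o → split a o (a Fin.≟ p)) op (λ (_ , p≢p) → p≢p refl)
          where
          split : ∀ a → Op a → Dec (a ≡ p) → (Op a × a ≢ p) ⊎ a ≡ p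
          split a o (yes eq) = inj₂ eq
          split a o (no neq) = inj₁ (o , neq)
        fewer : cnt D? (toℕ κ) ≡ cnt U? (suc (toℕ κ)) + # Rest?
        fewer = trans count (trans (cong (cnt U? (toℕ κ) +_) rest) (trans (ℕₚ.+-suc _ _)
          (cong (_+ # Rest?) (sym (cnt-yes U? κ Uκ)))))
        new : D κ → Dec (Right κ) → # Op′? ≡ suc (# Rest?)
        new d (yes r) = #-insert Rest? Op′? κ (λ _ → inj₁)
          (λ { _ (inj₁ o) → inj₁ o ; _ (inj₂ (_ , inj₁ (_ , eq))) → inj₂ eq
             ; _ (inj₂ (_ , inj₂ (¬r , _))) → contradiction r ¬r })
          (inj₂ (d , inj₁ (r , refl))) (λ (o , _) → op≢κ o refl)
        new d (no ¬r) = #-insert Rest? Op′? p (λ _ → inj₁)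
          (λ { _ (inj₁ o) → inj₁ o ; _ (inj₂ (_ , inj₁ (r , _))) → contradiction r ¬r
             ; _ (inj₂ (_ , inj₂ (_ , eq))) → inj₂ eq })
          (inj₂ (d , inj₂ (¬r , refl))) (λ (_ , p≢p) → p≢p refl)
        go : Dec (D κ) → cnt D? (suc (toℕ κ)) ≡ cnt U? (suc (toℕ κ)) + # Op′?
        go (yes d) = trans (cnt-yes D? κ d) (trans (cong suc fewer) (trans (sym (ℕₚ.+-suc _ _))
          (cong (cnt U? (suc (toℕ κ)) +_) (sym (new d (Right? κ))))))
        go (no ¬d) = trans (cnt-no D? κ ¬d) (trans fewer (cong (cnt U? (suc (toℕ κ)) +_)
          (#-cong Rest? Op′? λ a → mk⇔ inj₁ λ { (inj₁ o) → o ; (inj₂ (d , _)) → contradiction d ¬d })))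

      joined-old : ∀ {a} → a Fin.< κ → Joined a → Orbit y p a
      joined-old a<κ (inj₁ a∼p) = orbit-sym y a∼p
      joined-old a<κ (inj₂ a∼κ) = contradiction (cong toℕ (κ-alone a∼κ)) (ℕₚ.<⇒≢ a<κ)

      up′ : ∀ a → UpTo a → Up z a ⇔ U a
      up′ a (here refl) = true⇔ (p , op< op , orbit-sym z p∼q) Uκ
      up′ a (before a<κ) = mk⇔ (λ u → Equivalence.to (up a a<κ) (back u))
                               (λ u → let (b , b<a , a∼b) = Equivalence.from (up a a<κ) u in b , b<a , widen a∼b)
        where
        back : Up z a → Up y a
        back (b , b<a , a∼b) with narrow a∼b
        ... | inj₁ a∼b′ = b , b<a , a∼b′
        ... | inj₂ (ja , jb) = b , b<a , orbit-trans y (orbit-sym y (joined-old a<κ ja))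
                (joined-old (ℕₚ.<-trans b<a a<κ) jb)

      -- The arrow from a moved representative `q` jumps over the gap by `exit`, hence over `p` by
      -- visibility; so `avoid` puts `p` in another polygon.
      apart : ∀ {q} → Op q → q ≢ p → ¬ Orbit y q p
      apart {q} o q≢p q∼p with exit o κ ℕₚ.≤-refl
      ... | inj₁ yq = q≢p (orbit-fixed y yq q∼p)
      ... | inj₂ qκ = avoid y geo q∼p (Equivalence.to (visible op κ ℕₚ.≤-refl q q≢p) qκ)

      z-fixes : ∀ a → suc (toℕ κ) ≤ toℕ a → z $ a ≡ a
      z-fixes a κ<a = trans (zo (λ { refl → ℕₚ.<-asym κ<a (op< op) }) λ { refl → ℕₚ.<-irrefl refl κ<a })
        (fixes a (ℕₚ.<⇒≤ κ<a))

      dn-old : ∀ a → a Fin.< κ → D a ⇔ (Dn z a ⊎ ∃ λ q → Op′ q × Orbit z q a)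
      dn-old a a<κ = mk⇔ (λ d → to (Equivalence.to (dn a a<κ) d)) from
        where
        to : Dn y a ⊎ (∃ λ q → Op q × Orbit y q a) → Dn z a ⊎ ∃ λ q → Op′ q × Orbit z q a
        to (inj₁ (b , a<b , a∼b)) = inj₁ (b , a<b , widen a∼b)
        to (inj₂ (q , o , q∼a)) with q Fin.≟ p
        ... | no q≢p = inj₂ (q , inj₁ (o , q≢p) , widen q∼a)
        ... | yes refl = inj₁ (κ , a<κ , orbit-trans z (widen (orbit-sym y q∼a)) p∼q)
        D-joined : Joined a → D a
        D-joined ja = Equivalence.from (dn a a<κ) (inj₂ (p , op , joined-old a<κ ja))
        from : Dn z a ⊎ (∃ λ q → Op′ q × Orbit z q a) → D a
        from (inj₁ (b , a<b , a∼b)) with narrow a∼b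
        ... | inj₁ a∼b′ = Equivalence.from (dn a a<κ) (inj₁ (b , a<b , a∼b′))
        ... | inj₂ (ja , _) = D-joined ja
        from (inj₂ (q , op′ , q∼a)) with narrow q∼a | op′
        ... | inj₂ (_ , ja) | _ = D-joined ja
        ... | inj₁ q∼a′ | inj₁ (o , _) = Equivalence.from (dn a a<κ) (inj₂ (q , o , q∼a′))
        ... | inj₁ κ∼a | inj₂ (_ , inj₁ (_ , refl)) = D-joined (inj₂ (orbit-sym y κ∼a))
        ... | inj₁ p∼a | inj₂ (_ , inj₂ (_ , refl)) = D-joined (inj₁ (orbit-sym y p∼a))

      dn-here : D κ ⇔ (Dn z κ ⊎ ∃ λ q → Op′ q × Orbit z q κ)
      dn-here = mk⇔ (λ d → inj₂ (to d (Right? κ))) from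
        where
        to : D κ → Dec (Right κ) → ∃ λ q → Op′ q × Orbit z q κ
        to d (yes r) = κ , inj₂ (d , inj₁ (r , refl)) , orbit-refl z
        to d (no ¬r) = p , inj₂ (d , inj₂ (¬r , refl)) , p∼q
        from : Dn z κ ⊎ (∃ λ q → Op′ q × Orbit z q κ) → D κ
        from (inj₁ (b , κ<b , κ∼b)) = contradiction (cong toℕ (orbit-fixed z (z-fixes b κ<b) (orbit-sym z κ∼b)))
          (ℕₚ.<⇒≢ κ<b ∘ sym)
        from (inj₂ (q , inj₂ (d , _) , _)) = d
        from (inj₂ (q , inj₁ (o , q≢p) , q∼κ)) with narrow q∼κ
        ... | inj₁ q∼κ′ = contradiction (κ-alone q∼κ′) (op≢κ o)
        ... | inj₂ (inj₁ q∼p , _) = contradiction q∼p (apart o q≢p)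
        ... | inj₂ (inj₂ q∼κ′ , _) = contradiction (κ-alone q∼κ′) (op≢κ o)

      dn′ : ∀ a → UpTo a → D a ⇔ (Dn z a ⊎ ∃ λ q → Op′ q × Orbit z q a)
      dn′ a (before a<κ) = dn-old a a<κ
      dn′ a (here refl)  = dn-here

      next : Stage (suc (toℕ κ))
      next = record
        { y = z ; fixes = z-fixes ; geo = geo-z ; Op = Op′ ; Op? = Op′? ; op< = op<′
        ; visible = λ o m κ<m → visible′ m κ<m extremal o ; exit = λ o m κ<m → exit′ m κ<m extremal o
        ; count = count′ ; up = λ a a≤κ → up′ a (up-to a≤κ) ; dn = λ a a≤κ → dn′ a (up-to a≤κ) }

    advance : Stage (suc (toℕ κ))
    advance with U? κ
    ... | no ¬u = Skip.next ¬u
    ... | yes u = go (Right? κ)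
      where
      some : ∃ Op
      some = #-witness Op? (ℕₚ.+-cancelˡ-< (cnt U? (toℕ κ)) 0 _
        (subst₂ _<_ (sym (ℕₚ.+-identityʳ _)) count (ballot κ u)))
      go : Dec (Right κ) → Stage (suc (toℕ κ))
      -- Clockwise, a right `κ` joins the representative met last before `κ`, and a left `κ` the one
      -- met first after it.
      go (yes r) with maximum Op? {λ a b → Br a b κ}
            (λ oa ob a≢b → case br-total a≢b (op≢κ ob) (op≢κ oa) of λ
              { (inj₁ br) → inj₁ br ; (inj₂ br) → inj₂ (br-rotate² br) })
            (λ ab bd → br-rotate (br-trans (br-rotate² ab) (br-rotate² bd))) some
      ... | p , op , top = Join.next u op (inj₁ (r , top))
      go (no ¬r) with maximum Op? {λ a b → Br b a κ}
            (λ oa ob a≢b → case br-total a≢b (op≢κ ob) (op≢κ oa) of λ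
              { (inj₁ br) → inj₂ br ; (inj₂ br) → inj₁ (br-rotate² br) })
            (λ ba db → br-rotate (br-trans (br-rotate² db) (br-rotate² ba))) some
      ... | p , op , bottom = Join.next u op (inj₂ (¬r , bottom))

  stages : ∀ k → k ≤ suc n → Stage k
  stages zero    _   = start
  stages (suc k) k<N = subst (Stage ∘ suc) (Finₚ.toℕ-fromℕ< k<N)
    (Step.advance (fromℕ< k<N) (subst Stage (sym (Finₚ.toℕ-fromℕ< k<N)) (stages k (ℕₚ.<⇒≤ k<N))))

  -- After the last label, `balanced` and `count` leave no open polygon, so the clause of `dn` about
  -- open polygons becomes void.
  bits-surjective : ∃ λ x → Geo x × (∀ k → Dn x k ⇔ D k) × (∀ k → Up x k ⇔ U k)
  bits-surjective = y , geo , (λ k → mk⇔ (Equivalence.from (dn k (Finₚ.toℕ<n k)) ∘ inj₁) (to k)) ,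
                    (λ k → up k (Finₚ.toℕ<n k))
    where
    open Stage (stages (suc n) ℕₚ.≤-refl)
    closed : ∀ {p} → ¬ Op p
    closed o = ℕₚ.<⇒≢ (ℕₚ.m<m+n (cnt U? (suc n)) (#-pos Op? o)) (trans balanced count)
    to : ∀ k → D k → Dn y k
    to k d with Equivalence.to (dn k (Finₚ.toℕ<n k)) d
    ... | inj₁ dn₁ = dn₁
    ... | inj₂ (_ , o , _) = contradiction o closed

-- Displacement: a lower bound for the length of words, attained exactly by the
-- words of fully commutative elements.

displacement : Permutation′ m → ℕ
displacement w = sum λ v → toℕ (w $ v) ∸ toℕ v

displacement-cong : {v w : Permutation′ m} → v ≈ w → displacement v ≡ displacement w
displacement-cong v≈w = sum-cong-≗ λ a → cong (λ b → toℕ b ∸ toℕ a) (v≈w a)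

∸-triangle : ∀ a b d → a ∸ d ≤ (a ∸ b) + (b ∸ d)
∸-triangle a b d = ℕₚ.m≤n+o⇒m∸n≤o a d (begin
  a                        ≤⟨ ℕₚ.m≤n+m∸n a b ⟩
  b + (a ∸ b)              ≤⟨ ℕₚ.+-monoˡ-≤ (a ∸ b) (ℕₚ.m≤n+m∸n b d) ⟩
  d + (b ∸ d) + (a ∸ b)    ≡⟨ ℕₚ.+-assoc d (b ∸ d) (a ∸ b) ⟩
  d + ((b ∸ d) + (a ∸ b))  ≡⟨ cong (d +_) (ℕₚ.+-comm (b ∸ d) (a ∸ b)) ⟩
  d + ((a ∸ b) + (b ∸ d))  ∎)
  where open ℕₚ.≤-Reasoning

-- The truncated difference obeys the triangle inequality; the sum over the intermediate labels
-- `w a` is reindexed along `w`.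
displacement-· : (v w : Permutation′ m) → displacement (v · w) ≤ displacement v + displacement w
displacement-· v w = begin
  displacement (v · w)
    ≤⟨ sum-mono (λ a → ∸-triangle (toℕ (v $ w $ a)) (toℕ (w $ a)) (toℕ a)) ⟩
  sum (λ a → (toℕ (v $ w $ a) ∸ toℕ (w $ a)) + (toℕ (w $ a) ∸ toℕ a))
    ≡⟨ ∑-distrib-+ (λ a → toℕ (v $ w $ a) ∸ toℕ (w $ a)) (λ a → toℕ (w $ a) ∸ toℕ a) ⟩
  sum (λ a → toℕ (v $ w $ a) ∸ toℕ (w $ a)) + displacement w
    ≡⟨ cong (_+ displacement w) (sym (sum-permute (λ a → toℕ (v $ a) ∸ toℕ a) w)) ⟩
  displacement v + displacement w ∎
  where open ℕₚ.≤-Reasoning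

displacement-transpose : {p q : Fin m} → p Fin.< q → displacement (transpose p q) ≡ toℕ q ∸ toℕ p
displacement-transpose {p = p} {q} p<q =
  trans (sum-single p λ a a≢p → zero-at a a≢p (a Fin.≟ q)) (cong (λ b → toℕ b ∸ toℕ p) (transpose-l p q))
  where
  zero-at : ∀ a → a ≢ p → Dec (a ≡ q) → toℕ (transpose p q $ a) ∸ toℕ a ≡ 0
  zero-at a a≢p (yes refl) = trans (cong (λ b → toℕ b ∸ toℕ a) (transpose-r p a)) (ℕₚ.m≤n⇒m∸n≡0 (ℕₚ.<⇒≤ p<q))
  zero-at a a≢p (no a≢q) = trans (cong (λ b → toℕ b ∸ toℕ a) (transpose-other a≢p a≢q)) (ℕₚ.n∸n≡0 (toℕ a))

inject₁<suc : (i : Fin n) → inject₁ i Fin.< suc i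
inject₁<suc i = s≤s (ℕₚ.≤-reflexive (Finₚ.toℕ-inject₁ i))

displacement≤length : (is : List (Fin n)) → displacement ⟦ is ⟧ ≤ length is
displacement≤length {n} [] = ℕₚ.≤-reflexive (sum-zero {suc n} λ a → ℕₚ.n∸n≡0 (toℕ a))
displacement≤length (i ∷ is) = ℕₚ.≤-trans (displacement-· (s i) ⟦ is ⟧) (ℕₚ.+-mono-≤
  (ℕₚ.≤-reflexive (trans (displacement-transpose (inject₁<suc i))
    (trans (cong (λ k → suc (toℕ i) ∸ k) (Finₚ.toℕ-inject₁ i)) (ℕₚ.m+n∸n≡m 1 (toℕ i)))))
  (displacement≤length is))

-- Commutation classes

infix 4 _~_

_~_ : List (Fin n) → List (Fin n) → Set
_~_ = EqClosure Commutation

~-refl : {is : List (Fin n)} → is ~ is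
~-refl = ε

~-sym : {is js : List (Fin n)} → is ~ js → js ~ is
~-sym = Eq.symmetric Commutation

~-trans : {is js ks : List (Fin n)} → is ~ js → js ~ ks → is ~ ks
~-trans = Eq.transitive Commutation

~-reflexive : {is js : List (Fin n)} → is ≡ js → is ~ js
~-reflexive refl = ~-refl

~-invariant : {A : Set} {R : A → A → Set} → (∀ a → R a a) → (∀ a b → R a b → R b a) →
              (∀ a b d → R a b → R b d → R a d) → (f : List (Fin n) → A) →
              (∀ {is js} → Commutation is js → R (f is) (f js)) → ∀ {is js} → is ~ js → R (f is) (f js)
~-invariant r sy tr f inv ε = r _
~-invariant r sy tr f inv (SymC.fwd c ◅ cs) = tr _ _ _ (inv c) (~-invariant r sy tr f inv cs)
~-invariant r sy tr f inv (SymC.bwd c ◅ cs) = tr _ _ _ (sy _ _ (inv c)) (~-invariant r sy tr f inv cs)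

~-⟦⟧ : {is js : List (Fin n)} → is ~ js → ⟦ is ⟧ ≈ ⟦ js ⟧
~-⟦⟧ = ~-invariant {R = _≈_} (λ _ _ → refl) (λ _ _ p i → sym (p i)) (λ _ _ _ p q i → trans (p i) (q i)) ⟦_⟧
  λ { (commute as i j bs comm) a → trans (⟦⟧-++ as (i ∷ j ∷ bs) a)
        (trans (cong (⟦ as ⟧ $_) (comm (⟦ bs ⟧ $ a))) (sym (⟦⟧-++ as (j ∷ i ∷ bs) a))) }

-- Commutations keep the sum of the letters, whereas a braid move from `i j i` to `j i j` changes
-- it. This tells the two commutation classes apart.
weight : List (Fin n) → ℕ
weight []       = 0
weight (i ∷ is) = toℕ i + weight is

weight-++ : (is js : List (Fin n)) → weight (is ++ js) ≡ weight is + weight js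
weight-++ []       js = refl
weight-++ (i ∷ is) js = trans (cong (toℕ i +_) (weight-++ is js)) (sym (ℕₚ.+-assoc (toℕ i) _ _))

~-weight : {is js : List (Fin n)} → is ~ js → weight is ≡ weight js
~-weight = ~-invariant {R = _≡_} (λ _ → refl) (λ _ _ → sym) (λ _ _ _ → trans) weight λ { (commute as i j bs _) → trans (weight-++ as (i ∷ j ∷ bs))
  (trans (cong (weight as +_) (trans (sym (ℕₚ.+-assoc (toℕ i) _ _)) (trans (cong (_+ weight bs) (ℕₚ.+-comm (toℕ i) (toℕ j)))
    (ℕₚ.+-assoc (toℕ j) _ _)))) (sym (weight-++ as (j ∷ i ∷ bs)))) }

~-length : {is js : List (Fin n)} → is ~ js → length is ≡ length js
~-length = ~-invariant {R = _≡_} (λ _ → refl) (λ _ _ → sym) (λ _ _ _ → trans) length λ { (commute as i j bs _) →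
  trans (Listₚ.length-++ as) (sym (Listₚ.length-++ as)) }

~-context : (as bs : List (Fin n)) {is js : List (Fin n)} → is ~ js → as ++ is ++ bs ~ as ++ js ++ bs
~-context as bs = Eq.gmap (λ ws → as ++ ws ++ bs) λ { (commute xs i j ys comm) →
  subst₂ Commutation (assoc xs (i ∷ j ∷ ys)) (assoc xs (j ∷ i ∷ ys))
    (subst₂ (λ us vs → Commutation ((as ++ xs) ++ us) ((as ++ xs) ++ vs)) refl refl
      (commute (as ++ xs) i j (ys ++ bs) comm)) }
  where
  assoc : ∀ xs ys → (as ++ xs) ++ ys ++ bs ≡ as ++ (xs ++ ys) ++ bs
  assoc xs ys = trans (Listₚ.++-assoc as xs (ys ++ bs)) (cong (as ++_) (sym (Listₚ.++-assoc xs ys bs)))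

~-prefix : (as : List (Fin n)) {is js : List (Fin n)} → is ~ js → as ++ is ~ as ++ js
~-prefix as {is} {js} is~js = subst₂ (λ us vs → as ++ us ~ as ++ vs) (Listₚ.++-identityʳ is) (Listₚ.++-identityʳ js)
  (~-context as [] is~js)

Far : Fin n → Fin n → Set
Far i j = suc (toℕ i) < toℕ j ⊎ suc (toℕ j) < toℕ i

transpose-disjoint : {p q r t : Fin m} → p ≢ r → p ≢ t → q ≢ r → q ≢ t →
                     transpose p q · transpose r t ≈ transpose r t · transpose p q
transpose-disjoint {p = p} {q} {r} {t} p≢r p≢t q≢r q≢t a = go (a Fin.≟ p) (a Fin.≟ q) (a Fin.≟ r) (a Fin.≟ t)
  where
  pq = transpose p q
  rt = transpose r t
  go : Dec (a ≡ p) → Dec (a ≡ q) → Dec (a ≡ r) → Dec (a ≡ t) → pq $ rt $ a ≡ rt $ pq $ a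
  go (yes refl) _ _ _ = trans (cong (pq $_) (transpose-other p≢r p≢t))
    (trans (transpose-l a q) (sym (trans (cong (rt $_) (transpose-l a q)) (transpose-other q≢r q≢t))))
  go (no _) (yes refl) _ _ = trans (cong (pq $_) (transpose-other q≢r q≢t))
    (trans (transpose-r p a) (sym (trans (cong (rt $_) (transpose-r p a)) (transpose-other p≢r p≢t))))
  go (no a≢p) (no a≢q) (yes refl) _ = trans (cong (pq $_) (transpose-l a t))
    (trans (transpose-other (p≢t ∘ sym) (q≢t ∘ sym)) (sym (trans (cong (rt $_) (transpose-other a≢p a≢q)) (transpose-l a t))))
  go (no a≢p) (no a≢q) (no _) (yes refl) = trans (cong (pq $_) (transpose-r r a))
    (trans (transpose-other (p≢r ∘ sym) (q≢r ∘ sym)) (sym (trans (cong (rt $_) (transpose-other a≢p a≢q)) (transpose-r r a))))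
  go (no a≢p) (no a≢q) (no a≢r) (no a≢t) = trans (cong (pq $_) (transpose-other a≢r a≢t))
    (trans (transpose-other a≢p a≢q) (sym (trans (cong (rt $_) (transpose-other a≢p a≢q)) (transpose-other a≢r a≢t))))

far-commute : {i j : Fin n} → Far i j → s i · s j ≈ s j · s i
far-commute {i = i} {j} far = transpose-disjoint
  (λ eq → ij far (trans (sym (Finₚ.toℕ-inject₁ i)) (trans (cong toℕ eq) (Finₚ.toℕ-inject₁ j))))
  (λ eq → ij₁ far (trans (sym (Finₚ.toℕ-inject₁ i)) (cong toℕ eq)))
  (λ eq → i₁j far (trans (cong toℕ eq) (Finₚ.toℕ-inject₁ j)))
  (λ eq → ij far (cong ℕ.pred (cong toℕ eq)))
  where
  ij : ∀ {a b} → suc a < b ⊎ suc b < a → a ≢ b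
  ij (inj₁ lt) refl = ℕₚ.<-asym lt (ℕₚ.n<1+n _)
  ij (inj₂ lt) refl = ℕₚ.<-asym lt (ℕₚ.n<1+n _)
  ij₁ : ∀ {a b} → suc a < b ⊎ suc b < a → a ≢ suc b
  ij₁ (inj₁ lt) refl = ℕₚ.<-asym lt (ℕₚ.<-trans (ℕₚ.n<1+n _) (ℕₚ.n<1+n _))
  ij₁ (inj₂ lt) refl = ℕₚ.<-irrefl refl lt
  i₁j : ∀ {a b} → suc a < b ⊎ suc b < a → suc a ≢ b
  i₁j (inj₁ lt) refl = ℕₚ.<-irrefl refl lt
  i₁j (inj₂ lt) refl = ℕₚ.<-asym lt (ℕₚ.<-trans (ℕₚ.n<1+n _) (ℕₚ.n<1+n _))

move-right : (i : Fin n) (js ks : List (Fin n)) → All (Far i) js → i ∷ js ++ ks ~ js ++ i ∷ ks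
move-right i []       ks []          = ~-refl
move-right i (j ∷ js) ks (far ∷ all) = ~-trans
  (Eq.return (commute [] i j (js ++ ks) (far-commute far))) (~-prefix (j ∷ []) (move-right i js ks all))

Adjacent : Fin n → Fin n → Set
Adjacent i j = toℕ i ≡ suc (toℕ j) ⊎ toℕ j ≡ suc (toℕ i)

-- A property of the whole commutation class. Tight words and reduced words of fully commutative
-- elements both have it, and it is what `normalise` uses.
record Good (is : List (Fin n)) : Set where
  field
    no-square : ∀ as i bs → ¬ is ~ as ++ i ∷ i ∷ bs
    no-braid  : ∀ as i j bs → Adjacent i j → ¬ is ~ as ++ i ∷ j ∷ i ∷ bs

good-~ : {is js : List (Fin n)} → is ~ js → Good is → Good js
good-~ is~js g = record
  { no-square = λ as i bs js~ → Good.no-square g as i bs (~-trans is~js js~)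
  ; no-braid  = λ as i j bs adj js~ → Good.no-braid g as i j bs adj (~-trans is~js js~) }

good-suffix : (as : List (Fin n)) {is : List (Fin n)} → Good (as ++ is) → Good is
good-suffix as g = record
  { no-square = λ xs i bs is~ → Good.no-square g (as ++ xs) i bs
      (~-trans (~-prefix as is~) (~-reflexive (sym (Listₚ.++-assoc as xs _))))
  ; no-braid = λ xs i j bs adj is~ → Good.no-braid g (as ++ xs) i j bs adj
      (~-trans (~-prefix as is~) (~-reflexive (sym (Listₚ.++-assoc as xs _)))) }

transpose-braid : {a b d : Fin m} → a ≢ b → b ≢ d → a ≢ d →
                  transpose a b · transpose b d · transpose a b ≈ transpose a d ×
                  transpose b d · transpose a b · transpose b d ≈ transpose a d
transpose-braid {a = a} {b} {d} a≢b b≢d a≢d = (λ v → go₁ v (v Fin.≟ a) (v Fin.≟ b) (v Fin.≟ d)) ,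
                                              (λ v → go₂ v (v Fin.≟ a) (v Fin.≟ b) (v Fin.≟ d))
  where
  ab = transpose a b
  bd = transpose b d
  ab-d : ab $ d ≡ d
  ab-d = transpose-other (a≢d ∘ sym) (b≢d ∘ sym)
  bd-a : bd $ a ≡ a
  bd-a = transpose-other a≢b a≢d
  ad-b : transpose a d $ b ≡ b
  ad-b = transpose-other (a≢b ∘ sym) b≢d
  go₁ : ∀ v → Dec (v ≡ a) → Dec (v ≡ b) → Dec (v ≡ d) → ab $ bd $ ab $ v ≡ transpose a d $ v
  go₁ v (yes refl) _ _ = trans (cong (λ e → ab $ bd $ e) (transpose-l v b)) (trans (cong (ab $_) (transpose-l b d))
    (trans ab-d (sym (transpose-l v d))))
  go₁ v (no _) (yes refl) _ = trans (cong (λ e → ab $ bd $ e) (transpose-r a v)) (trans (cong (ab $_) bd-a)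
    (trans (transpose-l a v) (sym ad-b)))
  go₁ v (no _) (no _) (yes refl) = trans (cong (λ e → ab $ bd $ e) ab-d) (trans (cong (ab $_) (transpose-r b v))
    (trans (transpose-r a b) (sym (transpose-r a v))))
  go₁ v (no v≢a) (no v≢b) (no v≢d) = trans (cong (λ e → ab $ bd $ e) (transpose-other v≢a v≢b))
    (trans (cong (ab $_) (transpose-other v≢b v≢d)) (trans (transpose-other v≢a v≢b) (sym (transpose-other v≢a v≢d))))
  go₂ : ∀ v → Dec (v ≡ a) → Dec (v ≡ b) → Dec (v ≡ d) → bd $ ab $ bd $ v ≡ transpose a d $ v
  go₂ v (yes refl) _ _ = trans (cong (λ e → bd $ ab $ e) bd-a) (trans (cong (bd $_) (transpose-l v b))
    (trans (transpose-l b d) (sym (transpose-l v d))))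
  go₂ v (no _) (yes refl) _ = trans (cong (λ e → bd $ ab $ e) (transpose-l v d)) (trans (cong (bd $_) ab-d)
    (trans (transpose-r v d) (sym ad-b)))
  go₂ v (no _) (no _) (yes refl) = trans (cong (λ e → bd $ ab $ e) (transpose-r b v)) (trans (cong (bd $_) (transpose-r a b))
    (trans bd-a (sym (transpose-r a v))))
  go₂ v (no v≢a) (no v≢b) (no v≢d) = trans (cong (λ e → bd $ ab $ e) (transpose-other v≢b v≢d))
    (trans (cong (bd $_) (transpose-other v≢a v≢b)) (trans (transpose-other v≢b v≢d) (sym (transpose-other v≢a v≢d))))

module _ {i j : Fin n} where

  private
    module Rising (j≡ : toℕ j ≡ suc (toℕ i)) where
      b≡ : suc i ≡ inject₁ j
      b≡ = Finₚ.toℕ-injective (trans (sym j≡) (sym (Finₚ.toℕ-inject₁ j)))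
      a<d : toℕ (suc j) ≡ 2 + toℕ (inject₁ i)
      a<d = cong suc (trans j≡ (cong suc (sym (Finₚ.toℕ-inject₁ i))))
      braid : s i · s j · s i ≈ transpose (inject₁ i) (suc j) × s j · s i · s j ≈ transpose (inject₁ i) (suc j)
      braid = subst (λ b → transpose (inject₁ i) (suc i) · transpose b (suc j) · transpose (inject₁ i) (suc i) ≈ transpose (inject₁ i) (suc j)
                         × transpose b (suc j) · transpose (inject₁ i) (suc i) · transpose b (suc j) ≈ transpose (inject₁ i) (suc j)) b≡
        (transpose-braid (ℕₚ.<⇒≢ (inject₁<suc i) ∘ cong toℕ)
          (λ eq → ℕₚ.<⇒≢ (subst (_< toℕ (suc j)) j≡ (ℕₚ.n<1+n _)) (cong toℕ eq))
          (λ eq → ℕₚ.<⇒≢ (ℕₚ.<-trans (ℕₚ.n<1+n _) (ℕₚ.n<1+n _)) (trans (cong toℕ eq) a<d)))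

  braid-rising : toℕ j ≡ suc (toℕ i) →
                 s i · s j · s i ≈ transpose (inject₁ i) (suc j) × s j · s i · s j ≈ transpose (inject₁ i) (suc j)
  braid-rising = Rising.braid

  rising-distance : toℕ j ≡ suc (toℕ i) → displacement (transpose (inject₁ i) (suc j)) ≡ 2
  rising-distance j≡ = trans (displacement-transpose
    (subst (toℕ (inject₁ i) <_) (sym (Rising.a<d j≡)) (ℕₚ.<-trans (ℕₚ.n<1+n _) (ℕₚ.n<1+n _))))
    (trans (cong (_∸ toℕ (inject₁ i)) (Rising.a<d j≡)) (ℕₚ.m+n∸n≡m 2 (toℕ (inject₁ i))))

-- Both braid words give the transposition of two labels at distance 2; its displacement 2 is less
-- than their three letters.
braid : {i j : Fin n} → Adjacent i j → s i · s j · s i ≈ s j · s i · s j × displacement (s i · s j · s i) ≡ 2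
braid {i = i} {j} (inj₂ j≡) with braid-rising j≡
... | iji , jij = (λ a → trans (iji a) (sym (jij a))) ,
      trans (displacement-cong {v = s i · s j · s i} {transpose (inject₁ i) (suc j)} iji) (rising-distance j≡)
braid {i = i} {j} (inj₁ i≡) with braid-rising i≡
... | jij , iji = (λ a → trans (iji a) (sym (jij a))) ,
      trans (displacement-cong {v = s i · s j · s i} {transpose (inject₁ j) (suc i)} iji) (rising-distance i≡)

⟦square⟧ : (as : List (Fin n)) (i : Fin n) (bs : List (Fin n)) → ⟦ as ++ i ∷ i ∷ bs ⟧ ≈ ⟦ as ++ bs ⟧
⟦square⟧ as i bs a = trans (⟦⟧-++ as (i ∷ i ∷ bs) a)
  (trans (cong (⟦ as ⟧ $_) (transpose-involutive (inject₁ i) (suc i) (⟦ bs ⟧ $ a))) (sym (⟦⟧-++ as bs a)))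

length-insert : (as is bs : List (Fin n)) → length (as ++ is ++ bs) ≡ length is + length (as ++ bs)
length-insert as is bs = trans (Listₚ.length-++ as) (trans (cong (length as +_) (Listₚ.length-++ is))
  (trans (sym (ℕₚ.+-assoc (length as) _ _)) (trans (cong (_+ length bs) (ℕₚ.+-comm (length as) (length is)))
    (trans (ℕₚ.+-assoc (length is) _ _) (cong (length is +_) (sym (Listₚ.length-++ as)))))))

-- Length and product are constant on a commutation class, so tightness is too. A square can be
-- deleted, and a braid factor yields displacement 2 for three letters; either way the displacement
-- falls short of the length.
tight⇒good : (is : List (Fin n)) → length is ≤ displacement ⟦ is ⟧ → Good is
tight⇒good {n} is tight = record { no-square = square ; no-braid = no-braid′ }
  where
  open ℕₚ.≤-Reasoning
  moved : ∀ js → is ~ js → length js ≤ displacement ⟦ js ⟧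
  moved js is~js = subst₂ _≤_ (~-length is~js) (displacement-cong {v = ⟦ is ⟧} {⟦ js ⟧} (~-⟦⟧ is~js)) tight
  square : ∀ as i bs → ¬ is ~ as ++ i ∷ i ∷ bs
  square as i bs is~ = ℕₚ.<-irrefl refl (begin-strict
    length (as ++ bs)                     <⟨ ℕₚ.m<n⇒m<1+n (ℕₚ.n<1+n _) ⟩
    2 + length (as ++ bs)                 ≡⟨ sym (length-insert as (i ∷ i ∷ []) bs) ⟩
    length (as ++ i ∷ i ∷ bs)             ≤⟨ moved _ is~ ⟩
    displacement ⟦ as ++ i ∷ i ∷ bs ⟧     ≡⟨ displacement-cong {v = ⟦ as ++ i ∷ i ∷ bs ⟧} {⟦ as ++ bs ⟧} (⟦square⟧ as i bs) ⟩
    displacement ⟦ as ++ bs ⟧             ≤⟨ displacement≤length (as ++ bs) ⟩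
    length (as ++ bs)                     ∎)
  no-braid′ : ∀ as i j bs → Adjacent i j → ¬ is ~ as ++ i ∷ j ∷ i ∷ bs
  no-braid′ as i j bs adj is~ = ℕₚ.<-irrefl refl (begin-strict
    2 + length (as ++ bs)                 <⟨ ℕₚ.n<1+n _ ⟩
    3 + length (as ++ bs)                 ≡⟨ sym (length-insert as (i ∷ j ∷ i ∷ []) bs) ⟩
    length (as ++ i ∷ j ∷ i ∷ bs)         ≤⟨ moved _ is~ ⟩
    displacement ⟦ as ++ i ∷ j ∷ i ∷ bs ⟧ ≡⟨ displacement-cong {v = ⟦ as ++ i ∷ j ∷ i ∷ bs ⟧} {⟦ as ⟧ · t · ⟦ bs ⟧} (⟦⟧-++ as (i ∷ j ∷ i ∷ bs)) ⟩
    displacement (⟦ as ⟧ · t · ⟦ bs ⟧)    ≤⟨ displacement-· ⟦ as ⟧ (t · ⟦ bs ⟧) ⟩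
    displacement ⟦ as ⟧ + displacement (t · ⟦ bs ⟧) ≤⟨ ℕₚ.+-mono-≤ (displacement≤length as) (displacement-· t ⟦ bs ⟧) ⟩
    length as + (displacement t + displacement ⟦ bs ⟧)
      ≤⟨ ℕₚ.+-monoʳ-≤ (length as) (ℕₚ.+-mono-≤ (ℕₚ.≤-reflexive (proj₂ (braid adj))) (displacement≤length bs)) ⟩
    length as + (2 + length bs)           ≡⟨ trans (ℕₚ.+-suc _ _) (cong suc (ℕₚ.+-suc _ _)) ⟩
    2 + (length as + length bs)           ≡⟨ cong (2 +_) (sym (Listₚ.length-++ as)) ⟩
    2 + length (as ++ bs)                 ∎)
    where t = s i · s j · s i

-- A square would contradict reducedness. A braid move would give another reduced word, in the same
-- commutation class by hypothesis, but of different weight.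
fc⇒good : {w : Permutation′ (suc n)} → FullyCommutative w → (is : List (Fin n)) → Reduced w is → Good is
fc⇒good {n} {w} fc is (is≈w , minimal) = record { no-square = square ; no-braid = no-braid′ }
  where
  moved : ∀ {js} → is ~ js → ⟦ js ⟧ ≈ w
  moved is~js a = trans (sym (~-⟦⟧ is~js a)) (is≈w a)
  square : ∀ as i bs → ¬ is ~ as ++ i ∷ i ∷ bs
  square as i bs is~ = ℕₚ.<⇒≱ (ℕₚ.m<n⇒m<1+n (ℕₚ.n<1+n _))
    (subst (_≤ length (as ++ bs)) (trans (~-length is~) (length-insert as (i ∷ i ∷ []) bs))
      (minimal (as ++ bs) λ a → trans (sym (⟦square⟧ as i bs a)) (moved is~ a)))
  no-braid′ : ∀ as i j bs → Adjacent i j → ¬ is ~ as ++ i ∷ j ∷ i ∷ bs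
  no-braid′ as i j bs adj is~ = i≢j adj (ℕₚ.+-cancelʳ-≡ (toℕ i + weight bs) _ _ (ℕₚ.+-cancelˡ-≡ (toℕ j) _ _
      (trans (trans (sym (ℕₚ.+-assoc (toℕ j) _ _)) (trans (cong (_+ (toℕ i + weight bs)) (ℕₚ.+-comm (toℕ j) (toℕ i)))
        (ℕₚ.+-assoc (toℕ i) _ _))) (trans same (cong (toℕ j +_) (trans (sym (ℕₚ.+-assoc (toℕ i) _ _))
          (trans (cong (_+ weight bs) (ℕₚ.+-comm (toℕ i) (toℕ j))) (ℕₚ.+-assoc (toℕ j) _ _))))))))
    where
    other : List (Fin n)
    other = as ++ j ∷ i ∷ j ∷ bs
    other≈w : ⟦ other ⟧ ≈ w
    other≈w a = trans (⟦⟧-++ as (j ∷ i ∷ j ∷ bs) a) (trans (cong (⟦ as ⟧ $_) (sym (proj₁ (braid adj) (⟦ bs ⟧ $ a))))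
      (trans (sym (⟦⟧-++ as (i ∷ j ∷ i ∷ bs) a)) (moved is~ a)))
    length-other : length other ≡ length is
    length-other = trans (length-insert as (j ∷ i ∷ j ∷ []) bs)
      (trans (sym (length-insert as (i ∷ j ∷ i ∷ []) bs)) (sym (~-length is~)))
    is~other : is ~ other
    is~other = fc is other (is≈w , minimal)
      (other≈w , λ js js≈w → subst (_≤ length js) (sym length-other) (minimal js js≈w))
    same : toℕ i + (toℕ j + (toℕ i + weight bs)) ≡ toℕ j + (toℕ i + (toℕ j + weight bs))
    same = ℕₚ.+-cancelˡ-≡ (weight as) _ _ (trans (sym (weight-++ as (i ∷ j ∷ i ∷ bs)))
      (trans (sym (~-weight is~)) (trans (~-weight is~other) (weight-++ as (j ∷ i ∷ j ∷ bs)))))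
    i≢j : Adjacent i j → toℕ i ≢ toℕ j
    i≢j (inj₁ eq) eq′ = ℕₚ.<⇒≢ (ℕₚ.n<1+n (toℕ j)) (trans (sym eq′) eq)
    i≢j (inj₂ eq) eq′ = ℕₚ.<⇒≢ (ℕₚ.n<1+n (toℕ i)) (trans eq′ eq)

-- Descending words

descending-self : (i : Fin n) → descending i i ≡ i ∷ []
descending-self zero    = refl
descending-self {suc (suc n)} (suc i) = cong (map suc) (descending-self i)

descending-letters : (i j : Fin n) → All (λ k → j Fin.≤ k × k Fin.≤ i) (descending i j)
descending-letters zero    zero    = (z≤n , z≤n) ∷ []
descending-letters zero    (suc j) = []
descending-letters {suc (suc n)}  (suc i) zero    =
  Allₚ.++⁺ (Allₚ.map⁺ (All.map (λ (_ , k≤i) → z≤n , s≤s k≤i) (descending-letters i zero))) ((z≤n , z≤n) ∷ [])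
descending-letters {suc (suc n)} (suc i) (suc j) =
  Allₚ.map⁺ (All.map (λ (j≤k , k≤i) → s≤s j≤k , s≤s k≤i) (descending-letters i j))

descending-head : (i j : Fin n) → j Fin.≤ i → ∃ λ is → descending i j ≡ i ∷ is × All (Fin._< i) is
descending-head zero    zero    _ = [] , refl , []
descending-head {suc (suc n)}  (suc i) zero    _ with descending-head i zero z≤n
... | is , eq , all = map suc is ++ zero ∷ [] , cong (λ ws → map suc ws ++ zero ∷ []) eq ,
        Allₚ.++⁺ (Allₚ.map⁺ (All.map s≤s all)) (s≤s z≤n ∷ [])
descending-head {suc (suc n)} (suc i) (suc j) (s≤s j≤i) with descending-head i j j≤i
... | is , eq , all = map suc is , cong (map suc) eq , Allₚ.map⁺ (All.map s≤s all)

descending-last : (i j : Fin n) → j Fin.≤ i → ∃ λ is → descending i j ≡ is ++ j ∷ [] × All (j Fin.<_) is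
descending-last zero    zero    _ = [] , refl , []
descending-last {suc (suc n)}  (suc i) zero    _ = map suc (descending i zero) , refl ,
  Allₚ.map⁺ (All.map (λ _ → s≤s z≤n) (descending-letters i zero))
descending-last {suc (suc n)} (suc i) (suc j) (s≤s j≤i) with descending-last i j j≤i
... | is , eq , all = map suc is , trans (cong (map suc) eq) (Listₚ.map-++ suc is (j ∷ [])) , Allₚ.map⁺ (All.map s≤s all)

descending-cons : (k i j : Fin n) → toℕ k ≡ suc (toℕ i) → j Fin.≤ i → descending k j ≡ k ∷ descending i j
descending-cons {suc (suc n)} (suc zero) zero zero _ _ = refl
descending-cons {suc (suc n)} (suc k) (suc i) zero eq _ =
  cong (λ ws → map suc ws ++ zero ∷ []) (descending-cons k i zero (ℕₚ.suc-injective eq) z≤n)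
descending-cons {suc (suc n)} (suc k) (suc i) (suc j) eq (s≤s j≤i) = cong (map suc) (descending-cons k i j (ℕₚ.suc-injective eq) j≤i)

-- Exposes the adjacent letters `k⁺`, `k`. All letters before them commute with `k`, so that a `k`
-- in front of the word can be moved up to form a braid factor.
descending-split : (i j k : Fin n) → j Fin.≤ k → k Fin.< i →
                   ∃₂ λ is k⁺ → ∃ λ js → descending i j ≡ is ++ k⁺ ∷ k ∷ js × toℕ k⁺ ≡ suc (toℕ k) × All (k⁺ Fin.<_) is
descending-split {suc (suc n)} (suc i) zero zero _ _ with descending-last i zero z≤n
... | is , eq , all = map suc is , suc zero , [] ,
        trans (cong (λ ws → map suc ws ++ zero ∷ []) eq) (trans (cong (_++ zero ∷ []) (Listₚ.map-++ suc is (zero ∷ [])))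
          (Listₚ.++-assoc (map suc is) _ _)) ,
        refl , Allₚ.map⁺ (All.map s≤s all)
descending-split {suc (suc n)} (suc i) zero (suc k) _ (s≤s k<i) with descending-split i zero k z≤n k<i
... | is , k⁺ , js , eq , k⁺≡ , all = map suc is , suc k⁺ , map suc js ++ zero ∷ [] ,
        trans (cong (λ ws → map suc ws ++ zero ∷ []) eq) (trans (cong (_++ zero ∷ []) (Listₚ.map-++ suc is (k⁺ ∷ k ∷ js)))
          (Listₚ.++-assoc (map suc is) _ _)) ,
        cong suc k⁺≡ , Allₚ.map⁺ (All.map s≤s all)
descending-split {suc (suc n)} (suc i) (suc j) (suc k) (s≤s j≤k) (s≤s k<i) with descending-split i j k j≤k k<i
... | is , k⁺ , js , eq , k⁺≡ , all = map suc is , suc k⁺ , map suc js ,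
        trans (cong (map suc) eq) (Listₚ.map-++ suc is (k⁺ ∷ k ∷ js)) , cong suc k⁺≡ , Allₚ.map⁺ (All.map s≤s all)

descending-length : (i j : Fin n) → j Fin.≤ i → length (descending i j) ≡ suc (toℕ i) ∸ toℕ j
descending-length zero zero _ = refl
descending-length {suc (suc n)} (suc i) zero _ = trans (Listₚ.length-++ (map suc (descending i zero)))
  (trans (ℕₚ.+-comm _ 1) (cong suc (trans (Listₚ.length-map suc (descending i zero)) (descending-length i zero z≤n))))
descending-length {suc (suc n)} (suc i) (suc j) (s≤s j≤i) = trans (Listₚ.length-map suc (descending i j)) (descending-length i j j≤i)

-- The rightmost letter acts first, so the letters carry the label at `j` up one step at a time; the
-- labels it passes fall by one each, as `descending-down` records.
descending-top : (i j : Fin n) → j Fin.≤ i → ⟦ descending i j ⟧ $ inject₁ j ≡ suc i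
descending-top zero zero _ = refl
descending-top {suc (suc n)} (suc i) zero _ = trans (⟦⟧-++ (map suc (descending i zero)) (zero ∷ []) zero)
  (trans (⟦map-suc⟧ (descending i zero) (suc zero)) (cong suc (descending-top i zero z≤n)))
descending-top {suc (suc n)} (suc i) (suc j) (s≤s j≤i) =
  trans (⟦map-suc⟧ (descending i j) (suc (inject₁ j))) (cong suc (descending-top i j j≤i))

descending-down : (i j : Fin n) (v : Fin (suc n)) → v ≢ inject₁ j → (⟦ descending i j ⟧ $ v) Fin.≤ v
descending-down zero zero zero v≢ = contradiction refl v≢
descending-down zero zero (suc zero) _ = z≤n
descending-down zero zero (suc (suc v)) _ = ℕₚ.≤-refl
descending-down zero (suc j) v _ = ℕₚ.≤-refl
descending-down {suc (suc n)} (suc i) zero v v≢ = subst (Fin._≤ v) (sym (⟦⟧-++ (map suc (descending i zero)) (zero ∷ []) v))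
  (subst (Fin._≤ v) (sym (⟦map-suc⟧ (descending i zero) (s zero $ v))) (go v v≢))
  where
  go : ∀ v → v ≢ zero → (lift₀ ⟦ descending i zero ⟧ $ s zero $ v) Fin.≤ v
  go zero v≢ = contradiction refl v≢
  go (suc zero) _ = z≤n
  go (suc (suc v)) _ = s≤s (descending-down i zero (suc v) λ ())
descending-down {suc (suc n)} (suc i) (suc j) zero v≢ = subst (Fin._≤ Fin.zero {suc (suc n)}) (sym (⟦map-suc⟧ (descending i j) zero)) z≤n
descending-down {suc (suc n)} (suc i) (suc j) (suc v) v≢ = subst (Fin._≤ suc v) (sym (⟦map-suc⟧ (descending i j) (suc v)))
  (s≤s (descending-down i j v (v≢ ∘ cong suc)))

word-fixes-below : (is : List (Fin n)) (v : Fin (suc n)) → All (λ k → toℕ v < toℕ k) is → ⟦ is ⟧ $ v ≡ v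
word-fixes-below [] v [] = refl
word-fixes-below (i ∷ is) v (v<i ∷ all) = trans (cong (s i $_) (word-fixes-below is v all)) (transpose-other
  (λ eq → ℕₚ.<⇒≢ v<i (trans (cong toℕ eq) (Finₚ.toℕ-inject₁ i))) (λ eq → ℕₚ.<⇒≢ (ℕₚ.m<n⇒m<1+n v<i) (cong toℕ eq)))

word-fixes-above : (is : List (Fin n)) (v : Fin (suc n)) → All (λ k → suc (toℕ k) < toℕ v) is → ⟦ is ⟧ $ v ≡ v
word-fixes-above [] v [] = refl
word-fixes-above (i ∷ is) v (i<v ∷ all) = trans (cong (s i $_) (word-fixes-above is v all)) (transpose-other
  (λ eq → ℕₚ.<⇒≢ (ℕₚ.<-trans (ℕₚ.n<1+n _) i<v) (sym (trans (cong toℕ eq) (Finₚ.toℕ-inject₁ i))))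
  (λ eq → ℕₚ.<⇒≢ i<v (sym (cong toℕ eq))))

-- Normal forms

Block : ℕ → Set
Block n = Fin n × Fin n

top bottom : Block n → Fin n
top    = proj₁
bottom = proj₂

_⊏_ : Block n → Block n → Set
b ⊏ d = top b Fin.< top d × bottom b Fin.< bottom d

blockWord : Block n → List (Fin n)
blockWord (i , j) = descending i j

word : List (Block n) → List (Fin n)
word bs = concat (map blockWord bs)

Ordered : Block n → Set
Ordered (i , j) = j Fin.≤ i

NF : List (Block n) → Set
NF bs = All Ordered bs × AllPairs _⊏_ bs

private
  -- The last component lets the recursion put an untouched first block back in front.
  Inserted : Fin n → List (Block n) → Set
  Inserted k bs = ∃ λ bs′ → NF bs′ × k ∷ word bs ~ word bs′ ×
    (∀ {b} → All (b ⊏_) bs → top b Fin.< k → bottom b Fin.< k → All (b ⊏_) bs′)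

-- A letter in front of a normal form either starts a new block, extends the first
-- block, commutes with it, or produces a forbidden factor.
insert : (k : Fin n) (bs : List (Block n)) → NF bs → Good (k ∷ word bs) → Inserted k bs
insert k [] nf g = (k , k) ∷ [] , (ℕₚ.≤-refl ∷ [] , [] ∷ []) ,
  ~-reflexive (sym (cong (_++ []) (descending-self k))) , λ _ t<k b<k → (t<k , b<k) ∷ []
insert {n} k ((i , j) ∷ bs) (j≤i ∷ ords , ⊏bs ∷ pairs) g = go (toℕ k ℕ.<? toℕ j) (ℕₚ.<-cmp (toℕ k) (toℕ i))
  where

  start : k Fin.< j → Inserted k ((i , j) ∷ bs)
  start k<j = (k , k) ∷ (i , j) ∷ bs ,
    (ℕₚ.≤-refl ∷ j≤i ∷ ords , ((ℕₚ.<-≤-trans k<j j≤i , k<j) ∷ All.map above ⊏bs) ∷ ⊏bs ∷ pairs) ,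
    ~-reflexive (sym (cong (_++ word ((i , j) ∷ bs)) (descending-self k))) ,
    λ b⊏ t<k b<k → (t<k , b<k) ∷ b⊏
    where
    above : ∀ {b} → (i , j) ⊏ b → (k , k) ⊏ b
    above (i<t , j<b) = ℕₚ.<-trans (ℕₚ.<-≤-trans k<j j≤i) i<t , ℕₚ.<-trans k<j j<b

  inner : j Fin.≤ k → k Fin.< i → ⊥
  inner j≤k k<i with descending-split i j k j≤k k<i
  -- The new letter passes `is` and meets the letters `k⁺`, `k` of the block.
  ... | is , k⁺ , js , eq , k⁺≡ , all = Good.no-braid g is k k⁺ (js ++ word bs) (inj₂ k⁺≡)
    (~-trans (~-reflexive (cong (k ∷_) (trans (cong (_++ word bs) eq) (Listₚ.++-assoc is _ _))))
      (move-right k is (k⁺ ∷ k ∷ js ++ word bs) (All.map (λ k⁺<l → inj₁ (subst (_< _) k⁺≡ k⁺<l)) all)))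

  equal : toℕ k ≡ toℕ i → ⊥
  equal k≡i with Finₚ.toℕ-injective k≡i | descending-head i j j≤i
  ... | refl | is , eq , _ = Good.no-square g [] k (is ++ word bs) (~-reflexive (cong (λ ws → k ∷ ws ++ word bs) eq))

  past : suc (toℕ i) < toℕ k → Inserted k ((i , j) ∷ bs)
  past i⁺<k with insert k bs (ords , pairs) (good-suffix (descending i j) (good-~ moved g))
    where
    moved : k ∷ descending i j ++ word bs ~ descending i j ++ k ∷ word bs
    moved = move-right k (descending i j) (word bs)
      (All.map (λ (_ , l≤i) → inj₂ (ℕₚ.≤-<-trans (s≤s l≤i) i⁺<k)) (descending-letters i j))
  ... | bs′ , (ords′ , pairs′) , bs~ , bound = (i , j) ∷ bs′ ,
    (j≤i ∷ ords′ , bound ⊏bs i<k (ℕₚ.≤-<-trans j≤i i<k) ∷ pairs′) ,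
    ~-trans (move-right k (descending i j) (word bs)
        (All.map (λ (_ , l≤i) → inj₂ (ℕₚ.≤-<-trans (s≤s l≤i) i⁺<k)) (descending-letters i j)))
      (~-prefix (descending i j) bs~) ,
    λ { (b⊏ ∷ bs⊏) t<k b<k → b⊏ ∷ bound bs⊏ t<k b<k }
    where
    i<k : i Fin.< k
    i<k = ℕₚ.<-trans (ℕₚ.n<1+n _) i⁺<k

  extend : toℕ k ≡ suc (toℕ i) → Inserted k ((i , j) ∷ bs)
  extend k≡ = (k , j) ∷ bs , (j≤k ∷ ords , apart bs ⊏bs ords pairs refl ∷ pairs) ,
    ~-reflexive (cong (_++ word bs) (sym (descending-cons k i j k≡ j≤i))) ,
    λ { (b⊏ ∷ bs⊏) t<k b<k → (t<k , proj₂ b⊏) ∷ bs⊏ }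
    where
    j≤k : j Fin.≤ k
    j≤k = ℕₚ.≤-trans j≤i (ℕₚ.≤-trans (ℕₚ.n≤1+n _) (ℕₚ.≤-reflexive (sym k≡)))
    k≤ : ∀ {l : Fin n} → i Fin.< l → k Fin.≤ l
    k≤ = subst (_≤ _) (sym k≡)
    -- If the next block also began with `k`, its first letter could be moved left past the letters
    -- below `i`, producing the braid factor `k i k`.
    apart : ∀ ds → All ((i , j) ⊏_) ds → All Ordered ds → AllPairs _⊏_ ds → ds ≡ bs → All ((k , j) ⊏_) ds
    apart [] [] [] [] _ = []
    apart ((t , b) ∷ ds) ((i<t , j<b) ∷ rest) (b≤t ∷ _) (⊏ds ∷ _) eq = (k<t , j<b) ∷
        All.map (λ { ((t<t′ , _) , (_ , j<b′)) → ℕₚ.<-trans k<t t<t′ , j<b′ }) (All.zip (⊏ds , rest))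
      where
      k<t : k Fin.< t
      k<t with ℕₚ.m≤n⇒m<n∨m≡n (k≤ i<t)
      ... | inj₁ lt = lt
      ... | inj₂ k≡t with Finₚ.toℕ-injective k≡t | descending-head i j j≤i | descending-head t b b≤t
      ...   | refl | is , eq₁ , all | js , eq₂ , _ = ⊥-elim (Good.no-braid g [] k i (is ++ js ++ word ds) (inj₁ k≡)
              (~-trans (~-reflexive (cong₂ (λ us vs → k ∷ us ++ vs) eq₁
                  (trans (cong word (sym eq)) (cong (_++ word ds) eq₂))))
                (~-prefix (k ∷ i ∷ []) (~-sym (move-right k is (js ++ word ds)
                  (All.map (λ l<i → inj₂ (ℕₚ.<-≤-trans (s≤s l<i) (ℕₚ.≤-reflexive (sym k≡)))) all))))))

  go : Dec (k Fin.< j) → Tri (k Fin.< i) (toℕ k ≡ toℕ i) (i Fin.< k) → Inserted k ((i , j) ∷ bs)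
  go (yes k<j) _ = start k<j
  go (no k≮j) (tri< k<i _ _) = ⊥-elim (inner (ℕₚ.≮⇒≥ k≮j) k<i)
  go (no k≮j) (tri≈ _ k≡i _) = ⊥-elim (equal k≡i)
  go (no k≮j) (tri> _ _ i<k) with ℕₚ.m≤n⇒m<n∨m≡n i<k
  ... | inj₁ i⁺<k = past i⁺<k
  ... | inj₂ i⁺≡k = extend (sym i⁺≡k)

normalise : (is : List (Fin n)) → Good is → ∃ λ bs → NF bs × is ~ word bs
normalise []       g = [] , ([] , []) , ~-refl
normalise (i ∷ is) g with normalise is (good-suffix (i ∷ []) g)
... | bs , nf , is~ with insert i bs nf (good-~ (~-prefix (i ∷ []) is~) g)
... | bs′ , nf′ , ibs~ , _ = bs′ , nf′ , ~-trans (~-prefix (i ∷ []) is~) ibs~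

word-above : (l : ℕ) (bs : List (Block n)) → All (λ b → l < toℕ (bottom b)) bs → All (λ k → l < toℕ k) (word bs)
word-above l [] [] = []
word-above l ((i , j) ∷ bs) (l<j ∷ all) =
  Allₚ.++⁺ (All.map (λ (j≤k , _) → ℕₚ.<-≤-trans l<j j≤k) (descending-letters i j)) (word-above l bs all)

-- Later blocks act first and have larger letters, so they fix the bottom of `b`; earlier blocks
-- have smaller tops, so they fix the label above its top.
nf-image : (bs : List (Block n)) → NF bs → ∀ {b} → b ∈ₗ bs → ⟦ word bs ⟧ $ inject₁ (bottom b) ≡ suc (top b)
nf-image ((i , j) ∷ bs) (j≤i ∷ ords , ⊏bs ∷ pairs) (here refl) =
  trans (⟦⟧-++ (descending i j) (word bs) (inject₁ j)) (trans (cong (⟦ descending i j ⟧ $_)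
    (word-fixes-below (word bs) (inject₁ j) (word-above _ bs (All.map (λ (_ , j<) →
      subst (_< _) (sym (Finₚ.toℕ-inject₁ j)) j<) ⊏bs)))) (descending-top i j j≤i))
nf-image ((i , j) ∷ bs) (j≤i ∷ ords , ⊏bs ∷ pairs) {b} (there b∈) =
  trans (⟦⟧-++ (descending i j) (word bs) (inject₁ (bottom b))) (trans (cong (⟦ descending i j ⟧ $_)
    (nf-image bs (ords , pairs) b∈)) (word-fixes-above (descending i j) (suc (top b))
      (All.map (λ (_ , k≤i) → s≤s (ℕₚ.≤-<-trans k≤i (proj₁ (All.lookup ⊏bs b∈)))) (descending-letters i j))))

nf-down : (bs : List (Block n)) → NF bs → ∀ v → (∀ {b} → b ∈ₗ bs → v ≢ inject₁ (bottom b)) → (⟦ word bs ⟧ $ v) Fin.≤ v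
nf-down [] _ v _ = ℕₚ.≤-refl
nf-down ((i , j) ∷ bs) (j≤i ∷ ords , ⊏bs ∷ pairs) v v∉ = subst (Fin._≤ v) (sym (⟦⟧-++ (descending i j) (word bs) v))
  (ℕₚ.≤-trans (descending-down i j (⟦ word bs ⟧ $ v) λ eq → v∉ (here refl) (perm-injective ⟦ word bs ⟧
      (trans eq (sym (word-fixes-below (word bs) (inject₁ j) (word-above _ bs (All.map (λ (_ , j<) →
        subst (_< _) (sym (Finₚ.toℕ-inject₁ j)) j<) ⊏bs)))))))
    (nf-down bs (ords , pairs) v (v∉ ∘ there)))

bottom? : (bs : List (Block n)) (v : Fin (suc n)) → (∃ λ b → b ∈ₗ bs × v ≡ inject₁ (bottom b)) ⊎ (∀ {b} → b ∈ₗ bs → v ≢ inject₁ (bottom b))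
bottom? bs v with any? (λ b → v Fin.≟ inject₁ (bottom b)) bs
... | yes some = inj₁ (find some)
... | no none = inj₂ λ b∈ eq → none (lose b∈ eq)

-- Each block lifts only the label at its bottom, by its own length. The function `extra` places the
-- length of the first block at that label.
nf-tight : (bs : List (Block n)) → NF bs → length (word bs) ≤ displacement ⟦ word bs ⟧
nf-tight [] _ = z≤n
nf-tight {n} ((i , j) ∷ bs) (j≤i ∷ ords , ⊏bs ∷ pairs) = begin
  length (descending i j ++ word bs)          ≡⟨ Listₚ.length-++ (descending i j) ⟩
  length (descending i j) + length (word bs)  ≤⟨ ℕₚ.+-mono-≤ (ℕₚ.≤-reflexive (trans (descending-length i j j≤i) single)) (nf-tight bs (ords , pairs)) ⟩
  sum extra + displacement w                  ≡⟨ sym (∑-distrib-+ extra (λ v → toℕ (w $ v) ∸ toℕ v)) ⟩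
  sum (λ v → extra v + (toℕ (w $ v) ∸ toℕ v)) ≤⟨ sum-mono (λ v → pointwise v (v Fin.≟ inject₁ j) (bottom? bs v)) ⟩
  displacement ⟦ word ((i , j) ∷ bs) ⟧        ∎
  where
  open ℕₚ.≤-Reasoning
  w = ⟦ word bs ⟧
  extra : Fin (suc n) → ℕ
  extra v = ind (v Fin.≟ inject₁ j) ℕ.* (suc (toℕ i) ∸ toℕ j)
  extra-none : ∀ {v} → v ≢ inject₁ j → extra v ≡ 0
  extra-none {v} v≢ = cong (ℕ._* (suc (toℕ i) ∸ toℕ j)) (ind-no (v Fin.≟ inject₁ j) v≢)
  extra-one : extra (inject₁ j) ≡ suc (toℕ i) ∸ toℕ j
  extra-one = trans (cong (ℕ._* (suc (toℕ i) ∸ toℕ j)) (ind-yes (inject₁ j Fin.≟ inject₁ j) refl)) (ℕₚ.*-identityˡ _)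
  single : suc (toℕ i) ∸ toℕ j ≡ sum extra
  single = sym (trans (sum-single (inject₁ j) λ v v≢ → extra-none v≢) extra-one)
  whole : ∀ v → ⟦ word ((i , j) ∷ bs) ⟧ $ v ≡ ⟦ descending i j ⟧ $ w $ v
  whole = ⟦⟧-++ (descending i j) (word bs)
  pointwise : ∀ v → Dec (v ≡ inject₁ j) → _ → extra v + (toℕ (w $ v) ∸ toℕ v) ≤ toℕ (⟦ word ((i , j) ∷ bs) ⟧ $ v) ∸ toℕ v
  pointwise v (yes refl) _ = ℕₚ.≤-reflexive (trans (cong₂ _+_ extra-one
      (trans (cong (λ u → toℕ u ∸ toℕ v) w-fixes) (ℕₚ.n∸n≡0 (toℕ v))))
      (trans (ℕₚ.+-identityʳ _) (sym (cong₂ _∸_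
        (cong toℕ (trans (whole v) (trans (cong (⟦ descending i j ⟧ $_) w-fixes) (descending-top i j j≤i))))
        (Finₚ.toℕ-inject₁ j)))))
    where
    w-fixes : w $ inject₁ j ≡ inject₁ j
    w-fixes = word-fixes-below (word bs) (inject₁ j) (word-above _ bs (All.map (λ (_ , j<) →
        subst (_< _) (sym (Finₚ.toℕ-inject₁ j)) j<) ⊏bs))
  pointwise v (no v≢) (inj₂ v∉) = subst (_≤ toℕ (⟦ word ((i , j) ∷ bs) ⟧ $ v) ∸ toℕ v)
    (sym (cong₂ _+_ (extra-none v≢) (ℕₚ.m≤n⇒m∸n≡0 (nf-down bs (ords , pairs) v v∉)))) z≤n
  pointwise v (no v≢) (inj₁ (b , b∈ , refl)) = ℕₚ.≤-reflexive (trans (cong (_+ (toℕ (w $ v) ∸ toℕ v)) (extra-none v≢))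
    (cong (λ u → toℕ u ∸ toℕ v) (trans (nf-image bs (ords , pairs) b∈)
      (sym (nf-image ((i , j) ∷ bs) (j≤i ∷ ords , ⊏bs ∷ pairs) (there b∈))))))

tight⇒reduced : {w : Permutation′ (suc n)} (is : List (Fin n)) → ⟦ is ⟧ ≈ w → length is ≤ displacement ⟦ is ⟧ → Reduced w is
tight⇒reduced {w = w} is is≈w tight = is≈w , λ js js≈w → ℕₚ.≤-trans tight
  (subst (_≤ length js) (displacement-cong {v = ⟦ js ⟧} {⟦ is ⟧} λ a → trans (js≈w a) (sym (is≈w a))) (displacement≤length js))

module _ {w : Permutation′ (suc n)} (bs : List (Block n)) (nf : NF bs) (word≈w : ⟦ word bs ⟧ ≈ w) where

  private
    image : ∀ {b} → b ∈ₗ bs → w $ inject₁ (bottom b) ≡ suc (top b)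
    image b∈ = trans (sym (word≈w _)) (nf-image bs nf b∈)
    ordered : ∀ {b} → b ∈ₗ bs → inject₁ (bottom b) Fin.< suc (top b)
    ordered {b} b∈ = s≤s (subst (_≤ toℕ (top b)) (sym (Finₚ.toℕ-inject₁ (bottom b))) (All.lookup (proj₁ nf) b∈))
    exceeds : ∀ v → v Fin.< (w $ v) → ∃ λ b → b ∈ₗ bs × v ≡ inject₁ (bottom b)
    exceeds v v< with bottom? bs v
    ... | inj₁ found = found
    ... | inj₂ v∉ = contradiction (subst (Fin._≤ v) (word≈w v) (nf-down bs nf v v∉)) (ℕₚ.<⇒≱ v<)

  bottoms : ∀ v → (∃ λ b → b ∈ₗ bs × bottom b ≡ v) ⇔ inject₁ v Fin.< (w $ inject₁ v)
  bottoms v = mk⇔ (λ { (b , b∈ , refl) → subst (inject₁ v Fin.<_) (sym (image b∈)) (ordered b∈) })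
    λ v< → let (b , b∈ , eq) = exceeds (inject₁ v) v< in b , b∈ , Finₚ.inject₁-injective (sym eq)

  tops : ∀ v → (∃ λ b → b ∈ₗ bs × top b ≡ v) ⇔ (w ⟨$⟩ˡ suc v) Fin.< suc v
  tops v = mk⇔ (λ { (b , b∈ , refl) → subst (Fin._< suc v) (sym (trans (cong (w ⟨$⟩ˡ_) (sym (image b∈))) (inverseˡ w))) (ordered b∈) })
    from
    where
    from : (w ⟨$⟩ˡ suc v) Fin.< suc v → ∃ λ b → b ∈ₗ bs × top b ≡ v
    from lt with exceeds (w ⟨$⟩ˡ suc v) (subst ((w ⟨$⟩ˡ suc v) Fin.<_) (sym (inverseʳ w)) lt)
    ... | b , b∈ , eq = b , b∈ , Finₚ.suc-injective (trans (sym (image b∈)) (trans (cong (w $_) (sym eq)) (inverseʳ w)))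

sorted-unique : {is js : List (Fin n)} → AllPairs Fin._<_ is → AllPairs Fin._<_ js → (∀ k → k ∈ₗ is ⇔ k ∈ₗ js) → is ≡ js
sorted-unique [] [] _ = refl
sorted-unique {js = j ∷ js} [] (_ ∷ _) e with () ← Equivalence.from (e j) (here refl)
sorted-unique {is = i ∷ is} (_ ∷ _) [] e with () ← Equivalence.to (e i) (here refl)
sorted-unique {is = i ∷ is} {j ∷ js} (i<is ∷ sis) (j<js ∷ sjs) e = cong₂ _∷_ i≡j
    (sorted-unique sis sjs λ k → mk⇔ (λ k∈ → to k k∈ (Equivalence.to (e k) (there k∈)))
                                     (λ k∈ → from k k∈ (Equivalence.from (e k) (there k∈))))
  where
  i≡j : i ≡ j
  i≡j with Equivalence.to (e i) (here refl) | Equivalence.from (e j) (here refl)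
  ... | here eq | _ = eq
  ... | there _ | here eq = sym eq
  ... | there i∈ | there j∈ = contradiction (All.lookup i<is j∈) (ℕₚ.<-asym (All.lookup j<js i∈))
  to : ∀ k → k ∈ₗ is → k ∈ₗ j ∷ js → k ∈ₗ js
  to k k∈ (here eq)   = contradiction (cong toℕ (trans i≡j (sym eq))) (ℕₚ.<⇒≢ (All.lookup i<is k∈))
  to k k∈ (there k∈′) = k∈′
  from : ∀ k → k ∈ₗ js → k ∈ₗ i ∷ is → k ∈ₗ is
  from k k∈ (here eq)   = contradiction (cong toℕ (trans (sym i≡j) (sym eq))) (ℕₚ.<⇒≢ (All.lookup j<js k∈))
  from k k∈ (there k∈′) = k∈′

AllPairs-map : {A B : Set} {R : A → A → Set} {S : B → B → Set} (f : A → B) → (∀ {a b} → R a b → S (f a) (f b)) →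
               {xs : List A} → AllPairs R xs → AllPairs S (map f xs)
AllPairs-map f g []       = []
AllPairs-map f g (r ∷ rs) = Allₚ.map⁺ (All.map g r) ∷ AllPairs-map f g rs

map-∈ : {A : Set} (f : Block n → A) {bs : List (Block n)} {v : A} → v ∈ₗ map f bs ⇔ (∃ λ b → b ∈ₗ bs × f b ≡ v)
map-∈ f = mk⇔ (λ v∈ → let (b , b∈ , eq) = ∈ₗₚ.∈-map⁻ f v∈ in b , b∈ , sym eq) λ { (b , b∈ , refl) → ∈ₗₚ.∈-map⁺ f b∈ }

blocks-unique : {bs ds : List (Block n)} → map top bs ≡ map top ds → map bottom bs ≡ map bottom ds → bs ≡ ds
blocks-unique {bs = []}     {[]}     _  _   = refl
blocks-unique {bs = b ∷ bs} {d ∷ ds} eq eq′ with Listₚ.∷-injective eq | Listₚ.∷-injective eq′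
... | refl , eqs | refl , eqs′ = cong (b ∷_) (blocks-unique eqs eqs′)

-- Tops and bottoms are strictly increasing lists, hence determined by their sets, which are read
-- off from the excedances. Two permutations are allowed so that the result also separates fully
-- commutative elements.
nf-unique : {w w′ : Permutation′ (suc n)} {bs ds : List (Block n)} → NF bs → NF ds → ⟦ word bs ⟧ ≈ w → ⟦ word ds ⟧ ≈ w′ →
            (∀ k → k Fin.< (w $ k) ⇔ k Fin.< (w′ $ k)) → (∀ k → (w ⟨$⟩ˡ k) Fin.< k ⇔ (w′ ⟨$⟩ˡ k) Fin.< k) → bs ≡ ds
nf-unique {w = w} {w′} {bs} {ds} nf nf′ eq eq′ positions values = blocks-unique
  (sorted-unique (AllPairs-map top proj₁ (proj₂ nf)) (AllPairs-map top proj₁ (proj₂ nf′)) λ k →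
    via (map-∈ top) (tops {w = w} bs nf eq k) (values (suc k)) (tops {w = w′} ds nf′ eq′ k) (map-∈ top))
  (sorted-unique (AllPairs-map bottom proj₂ (proj₂ nf)) (AllPairs-map bottom proj₂ (proj₂ nf′)) λ k →
    via (map-∈ bottom) (bottoms {w = w} bs nf eq k) (positions (inject₁ k)) (bottoms {w = w′} ds nf′ eq′ k) (map-∈ bottom))
  where
  via : {A B C D E F : Set} → A ⇔ B → B ⇔ C → C ⇔ D → E ⇔ D → F ⇔ E → A ⇔ F
  via ab bc cd ed fe = mk⇔
    (Equivalence.from fe ∘ Equivalence.from ed ∘ Equivalence.to cd ∘ Equivalence.to bc ∘ Equivalence.to ab)
    (Equivalence.from ab ∘ Equivalence.from bc ∘ Equivalence.from cd ∘ Equivalence.to ed ∘ Equivalence.to fe)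

inverse-cong : {v w : Permutation′ m} → v ≈ w → ∀ k → v ⟨$⟩ˡ k ≡ w ⟨$⟩ˡ k
inverse-cong {v = v} {w} v≈w k = perm-injective v (trans (inverseʳ v) (trans (sym (inverseʳ w)) (sym (v≈w (w ⟨$⟩ˡ k)))))

-- A reduced word is no longer than the tight word `word bs`, hence tight and `Good`; its
-- commutation class then contains a normal form, which must be `bs`.
nf⇒fc : (bs : List (Block n)) → NF bs → FullyCommutative ⟦ word bs ⟧
nf⇒fc bs nf is js ris rjs = ~-trans (to-nf is ris) (~-sym (to-nf js rjs))
  where
  w = ⟦ word bs ⟧
  to-nf : ∀ is → Reduced w is → is ~ word bs
  to-nf is (is≈w , minimal) with normalise is (tight⇒good is (ℕₚ.≤-trans (minimal (word bs) (λ _ → refl))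
      (subst (length (word bs) ≤_) (displacement-cong {v = w} {⟦ is ⟧} (sym ∘ is≈w)) (nf-tight bs nf))))
  ... | ds , nf′ , is~ = ~-trans is~ (~-reflexive (cong word (nf-unique {w = w} {w} nf′ nf
          (λ a → trans (sym (~-⟦⟧ is~ a)) (is≈w a)) (λ _ → refl) (λ _ → mk⇔ id id) (λ _ → mk⇔ id id))))

fc-cong : {v w : Permutation′ (suc n)} → v ≈ w → FullyCommutative v → FullyCommutative w
fc-cong {v = v} {w} v≈w fc is js ris rjs = fc is js (back is ris) (back js rjs)
  where
  back : ∀ is → Reduced w is → Reduced v is
  back is (is≈w , minimal) = (λ a → trans (is≈w a) (sym (v≈w a))) , λ js js≈v → minimal js λ a → trans (js≈v a) (v≈w a)

-- Reduced words exist

word-to : (v : Fin (suc n)) → ∃ λ is → ⟦ is ⟧ $ zero ≡ v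
word-to {n} v = go (toℕ v) v refl
  where
  go : ∀ k (v : Fin (suc n)) → toℕ v ≡ k → ∃ λ is → ⟦ is ⟧ $ zero ≡ v
  go _       zero    _  = [] , refl
  go (suc k) (suc v) eq with go k (inject₁ v) (trans (Finₚ.toℕ-inject₁ v) (ℕₚ.suc-injective eq))
  ... | is , is0 = v ∷ is , trans (cong (s v $_) is0) (transpose-l (inject₁ v) (suc v))

-- A first word takes `zero` to its image; what remains fixes `zero` and is a lifted permutation of
-- fewer labels.
word-of : (w : Permutation′ (suc n)) → ∃ λ is → ⟦ is ⟧ ≈ w
word-of {zero}  w = [] , λ { zero → sym (only (w $ zero)) }
  where
  only : (v : Fin 1) → v ≡ zero
  only zero = refl
word-of {suc n} w with word-to (w $ zero)
... | is , is0 with word-of (removeₚ zero (flip ⟦ is ⟧ · w))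
... | js , js≈ = is ++ map suc js , λ a → trans (⟦⟧-++ is (map suc js) a) (trans
      (cong (⟦ is ⟧ $_) (trans (⟦map-suc⟧ js a) (trans (lift₀-cong ⟦ js ⟧ (removeₚ zero x) js≈ a) (lift₀-remove x x0 a))))
      (inverseʳ ⟦ is ⟧))
  where
  x = flip ⟦ is ⟧ · w
  x0 : x $ zero ≡ zero
  x0 = trans (cong (⟦ is ⟧ ⟨$⟩ˡ_) (sym is0)) (inverseˡ ⟦ is ⟧)

HasWord : Permutation′ (suc n) → ℕ → Set
HasWord w l = ∃ λ is → length is ≡ l × ⟦ is ⟧ ≈ w

hasWord? : (w : Permutation′ (suc n)) (l : ℕ) → Dec (HasWord w l)
hasWord? w zero = map′ (λ id≈w → [] , refl , id≈w) (λ { ([] , _ , id≈w) → id≈w }) (Finₚ.all? λ a → a Fin.≟ (w $ a))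
hasWord? w (suc l) = map′
  (λ { (i , is , len , is≈) → i ∷ is , cong suc len ,
       λ a → trans (cong (s i $_) (is≈ a)) (transpose-involutive (inject₁ i) (suc i) (w $ a)) })
  (λ { (i ∷ is , len , is≈) → i , is , ℕₚ.suc-injective len ,
       λ a → trans (sym (transpose-involutive (inject₁ i) (suc i) _)) (cong (s i $_) (is≈ a)) })
  (Finₚ.any? λ i → hasWord? (s i · w) l)

-- Having a word of a given length is decidable; the search goes upwards from 0 and is bounded by
-- any known word.
reduced-word : (w : Permutation′ (suc n)) → ∃ (Reduced w)
reduced-word {n} w with word-of w
... | is , is≈w = go (length is) 0 (λ l ()) (is , sym (ℕₚ.+-identityʳ _) , is≈w)
  where
  go : ∀ k l → (∀ l′ → l′ < l → ¬ HasWord w l′) → HasWord w (k + l) → ∃ (Reduced w)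
  go k l none some with hasWord? w l
  ... | yes (js , len , js≈w) = js , js≈w , λ ks ks≈w → subst (_≤ length ks) (sym len)
          (ℕₚ.≮⇒≥ λ lt → none (length ks) lt (ks , refl , ks≈w))
  go zero l none some | no ¬l = contradiction some ¬l
  go (suc k) l none some | no ¬l = go k (suc l) none′ (subst (HasWord w) (sym (ℕₚ.+-suc k l)) some)
    where
    none′ : ∀ l′ → l′ < suc l → ¬ HasWord w l′
    none′ l′ l′≤l has with ℕₚ.m≤n⇒m<n∨m≡n (ℕ.s≤s⁻¹ l′≤l)
    ... | inj₁ l′<l = none l′ l′<l has
    ... | inj₂ refl = ¬l has

fc⇒nf : {w : Permutation′ (suc n)} → FullyCommutative w → ∃ λ bs → NF bs × ⟦ word bs ⟧ ≈ w
fc⇒nf {w = w} fc with reduced-word w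
... | is , red with normalise is (fc⇒good {w = w} fc is red)
... | bs , nf , is~ = bs , nf , λ a → trans (sym (~-⟦⟧ is~ a)) (proj₁ red a)

fc-unique : {w w′ : Permutation′ (suc n)} → FullyCommutative w → FullyCommutative w′ →
            (∀ k → k Fin.< (w $ k) ⇔ k Fin.< (w′ $ k)) → (∀ k → (w ⟨$⟩ˡ k) Fin.< k ⇔ (w′ ⟨$⟩ˡ k) Fin.< k) → w ≈ w′
fc-unique {w = w} {w′} fc fc′ positions values with fc⇒nf {w = w} fc | fc⇒nf {w = w′} fc′
... | bs , nf , eq | ds , nf′ , eq′ with nf-unique {w = w} {w′} nf nf′ eq eq′ positions values
... | refl = λ a → trans (sym (eq a)) (eq′ a)

-- Comparison with NormalForm

functions⇒nf : ∀ {k} (i j : Fin k → Fin n) → (∀ {a b} → a Fin.< b → i a Fin.< i b) → (∀ {a b} → a Fin.< b → j a Fin.< j b) →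
               (∀ a → j a Fin.≤ i a) → NF (tabulate λ a → i a , j a)
functions⇒nf i j i-mono j-mono j≤i =
  Allₚ.tabulate⁺ j≤i , AllPairsₚ.tabulate⁺-< (λ a<b → i-mono a<b , j-mono a<b)

word-tabulate : ∀ {k} (i j : Fin k → Fin n) → word (tabulate λ a → i a , j a) ≡ concat (tabulate λ a → descending (i a) (j a))
word-tabulate i j = cong concat (Listₚ.map-tabulate (λ a → i a , j a) blockWord)

AllPairs-lookup : {A : Set} {R : A → A → Set} {xs : List A} → AllPairs R xs → ∀ {a b} → a Fin.< b → R (lookup xs a) (lookup xs b)
AllPairs-lookup (r ∷ rs) {zero}  {suc b} _         = All.lookup r (∈ₗₚ.∈-lookup b)
AllPairs-lookup (r ∷ rs) {suc a} {suc b} (s≤s a<b) = AllPairs-lookup rs a<b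

nf⇒normalForm : {w : Permutation′ (suc n)} (bs : List (Block n)) → NF bs → ⟦ word bs ⟧ ≈ w →
                Σ (NormalForm w) λ f → (∀ {b} → b ∈ₗ bs → ∃ λ a → NormalForm.i f a ≡ top b × NormalForm.j f a ≡ bottom b)
nf⇒normalForm {w = w} bs nf word≈w = f , λ b∈ → Any.index b∈ ,
    cong top (sym (lookup-index b∈)) , cong bottom (sym (lookup-index b∈))
  where
  i j : Fin (length bs) → Fin _
  i a = top (lookup bs a)
  j a = bottom (lookup bs a)
  f : NormalForm w
  f = record
    { size = length bs ; i = i ; j = j
    ; i-mono = λ a<b → proj₁ (AllPairs-lookup (proj₂ nf) a<b)
    ; j-mono = λ a<b → proj₂ (AllPairs-lookup (proj₂ nf) a<b)
    ; j≤i = λ a → All.lookup (proj₁ nf) (∈ₗₚ.∈-lookup a)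
    ; reduced = subst (Reduced w) (trans (cong word (sym (Listₚ.tabulate-lookup bs))) (word-tabulate i j))
        (tight⇒reduced {w = w} (word bs) word≈w (nf-tight bs nf)) }

module _ {w : Permutation′ (suc n)} (f : NormalForm w) where

  open NormalForm f

  private
    bs : List (Block n)
    bs = tabulate λ a → i a , j a
    nf : NF bs
    nf = functions⇒nf i j i-mono j-mono j≤i
    bs≈w : ⟦ word bs ⟧ ≈ w
    bs≈w a = trans (cong (λ ws → ⟦ ws ⟧ $ a) (word-tabulate i j)) (proj₁ reduced a)

  normalForm-i : ∀ a → (w ⟨$⟩ˡ suc (i a)) Fin.< suc (i a)
  normalForm-i a = Equivalence.to (tops {w = w} bs nf bs≈w (i a)) ((i a , j a) , ∈ₗₚ.∈-tabulate⁺ a , refl)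

  normalForm-j : ∀ a → inject₁ (j a) Fin.< (w $ inject₁ (j a))
  normalForm-j a = Equivalence.to (bottoms {w = w} bs nf bs≈w (j a)) ((i a , j a) , ∈ₗₚ.∈-tabulate⁺ a , refl)

lower : (k : Fin (suc n)) → toℕ k < n → ∃ λ v → inject₁ v ≡ k
lower k k<n = Fin.lower₁ k (ℕₚ.<⇒≢ k<n ∘ sym) , Finₚ.inject₁-lower₁ k (ℕₚ.<⇒≢ k<n ∘ sym)

-- The set `J w` is defined through some normal form; the right side depends on `w` alone, so every
-- normal form gives the same set.
∈J⇔ : {w : Permutation′ (suc n)} → FullyCommutative w → ∀ k → k ∈J w ⇔ k Fin.< (w $ k)
∈J⇔ {w = w} fc k = mk⇔ (λ { (v , refl , f , a , refl) → normalForm-j {w = w} f a }) from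
  where
  from : k Fin.< (w $ k) → k ∈J w
  from k< with lower k (ℕₚ.<-≤-trans k< (ℕ.s≤s⁻¹ (Finₚ.toℕ<n (w $ k)))) | fc⇒nf {w = w} fc
  ... | v , refl | bs , nf , eq with Equivalence.from (bottoms {w = w} bs nf eq v) k< | nf⇒normalForm {w = w} bs nf eq
  ... | b , b∈ , refl | f , index with index b∈
  ... | a , _ , ja = v , refl , f , a , ja

∈I⇔ : {w : Permutation′ (suc n)} → FullyCommutative w → ∀ k → k ∈I[1] w ⇔ (w ⟨$⟩ˡ k) Fin.< k
∈I⇔ {w = w} fc k = mk⇔ (λ { (v , refl , f , a , refl) → normalForm-i {w = w} f a }) (from k)
  where
  from : ∀ k → (w ⟨$⟩ˡ k) Fin.< k → k ∈I[1] w
  from (suc v) k< with fc⇒nf {w = w} fc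
  ... | bs , nf , eq with Equivalence.from (tops {w = w} bs nf eq v) k< | nf⇒normalForm {w = w} bs nf eq
  ... | b , b∈ , refl | f , index with index b∈
  ... | a , ia , _ = v , refl , f , a , ia

⇔-trans : {A B C : Set} → A ⇔ B → B ⇔ C → A ⇔ C
⇔-trans ab bc = mk⇔ (Equivalence.to bc ∘ Equivalence.to ab) (Equivalence.from ab ∘ Equivalence.from bc)

⇔-sym : {A B : Set} → A ⇔ B → B ⇔ A
⇔-sym ab = mk⇔ (Equivalence.from ab) (Equivalence.to ab)

-- Subsets and polygons

subsetOf : {P : Fin m → Set} → Decidable P → Subset m
subsetOf P? = tabulateᵥ λ a → Dec.does (P? a)

∈-subsetOf : {P : Fin m → Set} (P? : Decidable P) → ∀ a → a ∈ subsetOf P? ⇔ P a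
∈-subsetOf P? a = mk⇔
  (λ a∈ → holds (P? a) (trans (sym (Vecₚ.lookup∘tabulate _ a)) (Vecₚ.[]=⇒lookup a∈)))
  (λ p → Vecₚ.lookup⇒[]= a _ (trans (Vecₚ.lookup∘tabulate _ a) (dec-true (P? a) p)))
  where
  holds : {Q : Set} (Q? : Dec Q) → Dec.does Q? ≡ true → Q
  holds (yes q) _ = q

subset-ext : {P Q : Subset m} → (∀ v → v ∈ P ⇔ v ∈ Q) → P ≡ Q
subset-ext e = Subsetₚ.⊆-antisym (λ {v} → Equivalence.to (e v)) (λ {v} → Equivalence.from (e v))

subset-≟ : (P Q : Subset m) → Dec (P ≡ Q)
subset-≟ = Vecₚ.≡-dec Boolₚ._≟_

∈-∪⁅⁆ : {P : Subset m} {k v : Fin m} → v ∈ P ∪ ⁅ k ⁆ ⇔ (v ∈ P ⊎ v ≡ k)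
∈-∪⁅⁆ {P = P} {k} = mk⇔
  (λ v∈ → case Subsetₚ.x∈p∪q⁻ P ⁅ k ⁆ v∈ of λ { (inj₁ v∈P) → inj₁ v∈P ; (inj₂ v∈k) → inj₂ (Subsetₚ.x∈⁅y⁆⇒x≡y k v∈k) })
  (λ { (inj₁ v∈P) → Subsetₚ.x∈p∪q⁺ (inj₁ v∈P) ; (inj₂ refl) → Subsetₚ.x∈p∪q⁺ (inj₂ (Subsetₚ.x∈⁅x⁆ k)) })

orbit-greatest : (x : Permutation′ m) (a : Fin m) → ∃ λ b → Orbit x a b × ¬ Dn x b
orbit-greatest {m} x a = go m a (ℕₚ.m≤n+m m (toℕ a))
  where
  go : ∀ k a → m ≤ toℕ a + k → ∃ λ b → Orbit x a b × ¬ Dn x b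
  go zero a m≤a = contradiction (subst (m ≤_) (ℕₚ.+-identityʳ _) m≤a) (ℕₚ.<⇒≱ (Finₚ.toℕ<n a))
  go (suc k) a m≤ with Dn? x a
  ... | no ¬dn = a , orbit-refl x , ¬dn
  ... | yes (b , a<b , a∼b) with go k b (ℕₚ.≤-trans m≤ (ℕₚ.≤-trans (ℕₚ.≤-reflexive (ℕₚ.+-suc _ k)) (ℕₚ.+-monoˡ-≤ k a<b)))
  ... | d , b∼d , ¬dn = d , orbit-trans x a∼b b∼d , ¬dn

Up⇒supp : (x : Permutation′ m) {k : Fin m} → Up x k → supp x k
Up⇒supp x u eq = fixed⇒¬Up x eq u

Dn⇒supp : (x : Permutation′ m) {k : Fin m} → Dn x k → supp x k
Dn⇒supp x d eq = fixed⇒¬Dn x eq d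

supp-orbit : (x : Permutation′ m) {a b : Fin m} → supp x a → Orbit x a b → supp x b
supp-orbit x {a} {b} sa a∼b xb = sa (subst (λ v → x $ v ≡ v) (orbit-fixed x xb (orbit-sym x a∼b)) xb)

orbitSet : Permutation′ m → Fin m → Subset m
orbitSet x p = subsetOf (orbit? x p)

∈-orbitSet : (x : Permutation′ m) (p : Fin m) → ∀ q → q ∈ orbitSet x p ⇔ Orbit x p q
∈-orbitSet x p = ∈-subsetOf (orbit? x p)

pol-orbit : (x : Permutation′ (suc n)) {p : Fin (suc n)} → supp x p → Pol x (orbitSet x p)
pol-orbit x {p} sp = p , sp , ∈-orbitSet x p

pol-joins : (x : Permutation′ (suc n)) {P : Subset (suc n)} {a b : Fin (suc n)} → Pol x P → a ∈ P → b ∈ P → Orbit x a b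
pol-joins x (p , _ , mem) a∈ b∈ = orbit-trans x (orbit-sym x (Equivalence.to (mem _) a∈)) (Equivalence.to (mem _) b∈)

pol-closed : (x : Permutation′ (suc n)) {P : Subset (suc n)} {a b : Fin (suc n)} → Pol x P → a ∈ P → Orbit x a b → b ∈ P
pol-closed x (p , _ , mem) a∈ a∼b = Equivalence.from (mem _) (orbit-trans x (Equivalence.to (mem _) a∈) a∼b)

pol-supp : (x : Permutation′ (suc n)) {P : Subset (suc n)} {a : Fin (suc n)} → Pol x P → a ∈ P → supp x a
pol-supp x (p , sp , mem) a∈ = supp-orbit x sp (Equivalence.to (mem _) a∈)

pol-unique : (x : Permutation′ (suc n)) {P Q : Subset (suc n)} {a b : Fin (suc n)} →
             Pol x P → Pol x Q → a ∈ P → b ∈ Q → Orbit x a b → P ≡ Q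
pol-unique x polP polQ a∈ b∈ a∼b = subset-ext λ v → mk⇔
  (λ v∈ → pol-closed x polQ b∈ (orbit-trans x (orbit-sym x a∼b) (pol-joins x polP a∈ v∈)))
  (λ v∈ → pol-closed x polP a∈ (orbit-trans x a∼b (pol-joins x polQ b∈ v∈)))

module _ (x : Permutation′ (suc n)) where

  initial⇔ : ∀ k → Initial x k ⇔ (Dn x k × ¬ Up x k)
  initial⇔ k = mk⇔ to from
    where
    to : Initial x k → Dn x k × ¬ Up x k
    to (P , pol , k∈ , least) with Up? x k | Dn? x k
    ... | yes (b , b<k , k∼b) | _ = contradiction (least (pol-closed x pol k∈ k∼b)) (ℕₚ.<⇒≱ b<k)
    ... | no ¬u | yes d = d , ¬u
    ... | no ¬u | no ¬d = contradiction (¬Up∧¬Dn⇒fixed x ¬u ¬d) (pol-supp x pol k∈)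
    from : Dn x k × ¬ Up x k → Initial x k
    from (d , ¬u) = orbitSet x k , pol-orbit x (Dn⇒supp x d) , Equivalence.from (∈-orbitSet x k k) (orbit-refl x) ,
      λ {q} q∈ → ℕₚ.≮⇒≥ λ q<k → ¬u (q , q<k , Equivalence.to (∈-orbitSet x k q) q∈)

  terminal⇔ : ∀ k → Terminal x k ⇔ (Up x k × ¬ Dn x k)
  terminal⇔ k = mk⇔ to from
    where
    to : Terminal x k → Up x k × ¬ Dn x k
    to (P , pol , k∈ , greatest) with Dn? x k | Up? x k
    ... | yes (b , k<b , k∼b) | _ = contradiction (greatest (pol-closed x pol k∈ k∼b)) (ℕₚ.<⇒≱ k<b)
    ... | no ¬d | yes u = u , ¬d
    ... | no ¬d | no ¬u = contradiction (¬Up∧¬Dn⇒fixed x ¬u ¬d) (pol-supp x pol k∈)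
    from : Up x k × ¬ Dn x k → Terminal x k
    from (u , ¬d) = orbitSet x k , pol-orbit x (Up⇒supp x u) , Equivalence.from (∈-orbitSet x k k) (orbit-refl x) ,
      λ {q} q∈ → ℕₚ.≮⇒≥ λ k<q → ¬d (q , k<q , Equivalence.to (∈-orbitSet x k q) q∈)

  D⇔ : ∀ k → D x k ⇔ Dn x k
  D⇔ k = mk⇔ to λ d → Dn⇒supp x d , λ t → proj₂ (Equivalence.to (terminal⇔ k) t) d
    where
    to : D x k → Dn x k
    to (sk , ¬t) with Dn? x k | Up? x k
    ... | yes d | _ = d
    ... | no ¬d | yes u = contradiction (Equivalence.from (terminal⇔ k) (u , ¬d)) ¬t
    ... | no ¬d | no ¬u = contradiction (¬Up∧¬Dn⇒fixed x ¬u ¬d) sk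

  U⇔ : ∀ k → U x k ⇔ Up x k
  U⇔ k = mk⇔ to λ u → Up⇒supp x u , λ i → proj₂ (Equivalence.to (initial⇔ k) i) u
    where
    to : U x k → Up x k
    to (sk , ¬i) with Up? x k | Dn? x k
    ... | yes u | _ = u
    ... | no ¬u | yes d = contradiction (Equivalence.from (initial⇔ k) (d , ¬u)) ¬i
    ... | no ¬u | no ¬d = contradiction (¬Up∧¬Dn⇒fixed x ¬u ¬d) sk

  Nested : Fin (suc n) → Set
  Nested k = ∃₂ λ a b → a Fin.< k × k Fin.< b × Orbit x a b

  nested-in : ∀ {k P a b} → Pol x P → k ∉ P → a ∈ P → b ∈ P → a Fin.< k → k Fin.< b → NestedIn k P
  nested-in {k} {P} {a} {b} pol k∉ a∈ b∈ a<k k<b with orbit-least x a | orbit-greatest x b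
  ... | l , a∼l , ¬up | g , b∼g , ¬dn = k∉ ,
      (l , (pol-closed x pol a∈ a∼l , least) , ℕₚ.≤-<-trans (least a∈) a<k) ,
      (g , (pol-closed x pol b∈ b∼g , greatest) , ℕₚ.<-≤-trans k<b (greatest b∈))
    where
    least : ∀ {q} → q ∈ P → l Fin.≤ q
    least {q} q∈ = ℕₚ.≮⇒≥ λ q<l → ¬up (q , q<l , orbit-trans x (orbit-sym x a∼l) (pol-joins x pol a∈ q∈))
    greatest : ∀ {q} → q ∈ P → q Fin.≤ g
    greatest {q} q∈ = ℕₚ.≮⇒≥ λ g<q → ¬dn (q , g<q , orbit-trans x (orbit-sym x b∼g) (pol-joins x pol b∈ q∈))

  -- A fixed label is a vertex of no polygon, so only the two vertices on either side of it matter.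
  nested⇔ : ∀ k → x $ k ≡ k → (∃ λ P → Pol x P × NestedIn k P) ⇔ Nested k
  nested⇔ k fixed = mk⇔
    (λ { (P , pol , _ , (a , (a∈ , _) , a<k) , (b , (b∈ , _) , k<b)) → a , b , a<k , k<b , pol-joins x pol a∈ b∈ })
    λ { (a , b , a<k , k<b , a∼b) →
      let sa = Dn⇒supp x (b , ℕₚ.<-trans a<k k<b , a∼b) in
      orbitSet x a , pol-orbit x sa , nested-in (pol-orbit x sa)
        (λ k∈ → ℕₚ.<⇒≢ a<k (cong toℕ (sym (orbit-fixed x fixed (orbit-sym x (Equivalence.to (∈-orbitSet x a k) k∈))))))
        (Equivalence.from (∈-orbitSet x a a) (orbit-refl x)) (Equivalence.from (∈-orbitSet x a b) a∼b) a<k k<b }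

-- Lattice paths, pairs in 𝓘 and fully commutative elements

module Enumeration {P : Fin m → Set} (P? : Decidable P) where

  cnt-step : ∀ {a b : Fin m} → P a → a Fin.< b → cnt P? (toℕ a) < cnt P? (toℕ b)
  cnt-step {a} {b} Pa a<b = subst (_≤ cnt P? (toℕ b)) (cnt-yes P? a Pa) (cnt-mono P? a<b)

  cnt-injective : ∀ {a b : Fin m} → P a → P b → cnt P? (toℕ a) ≡ cnt P? (toℕ b) → a ≡ b
  cnt-injective {a} {b} Pa Pb eq with ℕₚ.<-cmp (toℕ a) (toℕ b)
  ... | tri< a<b _ _ = contradiction eq (ℕₚ.<⇒≢ (cnt-step Pa a<b))
  ... | tri≈ _ a≡b _ = Finₚ.toℕ-injective a≡b
  ... | tri> _ _ b<a = contradiction (sym eq) (ℕₚ.<⇒≢ (cnt-step Pb b<a))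

  abstract
    nth : ∀ r → r < cnt P? m → ∃ λ a → P a × cnt P? (toℕ a) ≡ r
    nth r r< = go m ℕₚ.≤-refl r<
      where
      go : ∀ k → k ≤ m → r < cnt P? k → ∃ λ a → P a × cnt P? (toℕ a) ≡ r
      go zero    _   r< = contradiction (subst (r <_) (cnt-zero P?) r<) λ ()
      go (suc k) k<m r< = step (P? κ)
        where
        κ : Fin m
        κ = fromℕ< k<m
        κ≡ : toℕ κ ≡ k
        κ≡ = Finₚ.toℕ-fromℕ< k<m
        step : Dec (P κ) → ∃ λ a → P a × cnt P? (toℕ a) ≡ r
        step (no ¬p) = go k (ℕₚ.<⇒≤ k<m) (subst (r <_) (trans (cong (cnt P? ∘ suc) (sym κ≡)) (trans (cnt-no P? κ ¬p) (cong (cnt P?) κ≡))) r<)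
        step (yes p) with ℕₚ.m≤n⇒m<n∨m≡n (ℕ.s≤s⁻¹ (subst (r <_) (trans (cong (cnt P? ∘ suc) (sym κ≡))
                            (trans (cnt-yes P? κ p) (cong (suc ∘ cnt P?) κ≡))) r<))
        ... | inj₁ r<k = go k (ℕₚ.<⇒≤ k<m) r<k
        ... | inj₂ r≡ = κ , p , trans (cong (cnt P?) κ≡) (sym r≡)

  cnt<size : ∀ {a} → P a → cnt P? (toℕ a) < cnt P? m
  cnt<size {a} Pa = subst (_≤ cnt P? m) (cnt-yes P? a Pa) (cnt-mono P? (Finₚ.toℕ<n a))

  module _ {k : ℕ} (k≡ : k ≡ cnt P? m) where

    enum : Fin k → Fin m
    enum r = proj₁ (nth (toℕ r) (subst (toℕ r <_) k≡ (Finₚ.toℕ<n r)))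

    enum-∈ : ∀ r → P (enum r)
    enum-∈ r = proj₁ (proj₂ (nth (toℕ r) (subst (toℕ r <_) k≡ (Finₚ.toℕ<n r))))

    enum-cnt : ∀ r → cnt P? (toℕ (enum r)) ≡ toℕ r
    enum-cnt r = proj₂ (proj₂ (nth (toℕ r) (subst (toℕ r <_) k≡ (Finₚ.toℕ<n r))))

    enum-mono : ∀ {q r} → q Fin.< r → enum q Fin.< enum r
    enum-mono {q} {r} q<r = ℕₚ.≰⇒> λ r≤q → ℕₚ.<⇒≱ q<r
      (subst₂ _≤_ (enum-cnt r) (enum-cnt q) (cnt-mono P? r≤q))

    enum-onto : ∀ {v} → P v → ∃ λ r → enum r ≡ v
    enum-onto {v} Pv = fromℕ< v<k , cnt-injective (enum-∈ _) Pv (trans (enum-cnt _) (Finₚ.toℕ-fromℕ< v<k))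
      where
      v<k : cnt P? (toℕ v) < k
      v<k = subst (cnt P? (toℕ v) <_) (sym k≡) (cnt<size Pv)

module FromPath {n} {Dp Up′ : Fin (suc n) → Set} (D? : Decidable Dp) (U? : Decidable Up′) (valid : Valid D? U?) where

  open Valid valid
  open Enumeration

  size : ℕ
  size = cnt D? (suc n)

  d u : Fin size → Fin (suc n)
  d = enum D? refl
  u = enum U? (sym balanced)

  -- Exactly `a` elements of U precede `u a`, so `ballot` demands more than `a` elements of D before
  -- it; if `u a ≤ d a`, there are at most `a`.
  d<u : ∀ a → d a Fin.< u a
  d<u a = ℕₚ.≰⇒> λ u≤d → ℕₚ.<⇒≱
    (subst₂ _<_ (enum-cnt U? (sym balanced) a) refl (ballot (u a) (enum-∈ U? (sym balanced) a)))
    (subst (cnt D? (toℕ (u a)) ≤_) (enum-cnt D? refl a) (cnt-mono D? u≤d))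

  abstract
    j-of : ∀ a → ∃ λ (v : Fin n) → inject₁ v ≡ d a
    j-of a = lower (d a) (ℕₚ.<-≤-trans (d<u a) (ℕ.s≤s⁻¹ (Finₚ.toℕ<n (u a))))

    i-of : ∀ a → ∃ λ (v : Fin n) → suc v ≡ u a
    i-of a = go (u a) (d<u a)
      where
      go : ∀ (v : Fin (suc n)) → d a Fin.< v → ∃ λ (w : Fin n) → suc w ≡ v
      go (suc v) _ = v , refl

  i j : Fin size → Fin n
  i a = proj₁ (i-of a)
  j a = proj₁ (j-of a)

  private
    toℕ-j : ∀ a → toℕ (j a) ≡ toℕ (d a)
    toℕ-j a = trans (sym (Finₚ.toℕ-inject₁ (j a))) (cong toℕ (proj₂ (j-of a)))
    toℕ-i : ∀ a → suc (toℕ (i a)) ≡ toℕ (u a)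
    toℕ-i a = cong toℕ (proj₂ (i-of a))

  i-mono : ∀ {a b} → a Fin.< b → i a Fin.< i b
  i-mono {a} {b} a<b = ℕ.s≤s⁻¹ (subst₂ _<_ (sym (toℕ-i a)) (sym (toℕ-i b)) (enum-mono U? (sym balanced) a<b))

  j-mono : ∀ {a b} → a Fin.< b → j a Fin.< j b
  j-mono {a} {b} a<b = subst₂ _<_ (sym (toℕ-j a)) (sym (toℕ-j b)) (enum-mono D? refl a<b)

  j≤i : ∀ a → j a Fin.≤ i a
  j≤i a = ℕ.s≤s⁻¹ (subst₂ _<_ (sym (toℕ-j a)) (sym (toℕ-i a)) (d<u a))

  pair : 𝓘 n
  pair = record
    { down = subsetOf D? ; up = subsetOf U? ; size = size
    -- Since `d a` lies below some label, it is never the last one; the enumeration therefore embeds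
    -- into `Fin n`.
    ; size≤n = Finₚ.injective⇒≤ {f = j} j-injective
    ; d = d ; u = u
    ; d-enumerates = enum-mono D? refl , λ v → ⇔-trans (∈-subsetOf D? v)
        (mk⇔ (enum-onto D? refl) λ { (a , refl) → enum-∈ D? refl a })
    ; u-enumerates = enum-mono U? (sym balanced) , λ v → ⇔-trans (∈-subsetOf U? v)
        (mk⇔ (enum-onto U? (sym balanced)) λ { (a , refl) → enum-∈ U? (sym balanced) a })
    ; d<u = d<u }
    where
    j-injective : ∀ {a b} → j a ≡ j b → a ≡ b
    j-injective {a} {b} eq with ℕₚ.<-cmp (toℕ a) (toℕ b)
    ... | tri< a<b _ _ = contradiction (cong toℕ eq) (ℕₚ.<⇒≢ (j-mono a<b))
    ... | tri≈ _ a≡b _ = Finₚ.toℕ-injective a≡b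
    ... | tri> _ _ b<a = contradiction (cong toℕ (sym eq)) (ℕₚ.<⇒≢ (j-mono b<a))

  private
    module Image (bs : List (Block n)) (nf : NF bs) (block∈ : ∀ a → (i a , j a) ∈ₗ bs)
                 (∈block : ∀ {b} → b ∈ₗ bs → ∃ λ a → b ≡ (i a , j a))
                 (w : Permutation′ (suc n)) (word≈w : ⟦ word bs ⟧ ≈ w) where

      positions : ∀ k → k Fin.< (w $ k) ⇔ Dp k
      positions k = mk⇔ to from
        where
        to : k Fin.< (w $ k) → Dp k
        to k< =
          let (v , v≡k)     = lower k (ℕₚ.<-≤-trans k< (ℕ.s≤s⁻¹ (Finₚ.toℕ<n (w $ k))))
              (b , b∈ , b≡) = Equivalence.from (bottoms {w = w} bs nf word≈w v) (subst (λ l → l Fin.< (w $ l)) (sym v≡k) k<)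
              (a , b≡ij)    = ∈block b∈
          in subst Dp (trans (sym (proj₂ (j-of a))) (trans (cong inject₁ (trans (sym (cong bottom b≡ij)) b≡)) v≡k))
               (enum-∈ D? refl a)
        from : Dp k → k Fin.< (w $ k)
        from p =
          let (a , a≡) = enum-onto D? refl p in
          subst (λ v → v Fin.< (w $ v)) (trans (proj₂ (j-of a)) a≡)
            (Equivalence.to (bottoms {w = w} bs nf word≈w (j a)) ((i a , j a) , block∈ a , refl))

      values : ∀ k → (w ⟨$⟩ˡ k) Fin.< k ⇔ Up′ k
      values k = mk⇔ (to k) from
        where
        to : ∀ k → (w ⟨$⟩ˡ k) Fin.< k → Up′ k
        to (suc v) k< =
          let (b , b∈ , b≡) = Equivalence.from (tops {w = w} bs nf word≈w v) k<
              (a , b≡ij)    = ∈block b∈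
          in subst Up′ (trans (sym (proj₂ (i-of a))) (cong suc (trans (sym (cong top b≡ij)) b≡)))
               (enum-∈ U? (sym balanced) a)
        from : Up′ k → (w ⟨$⟩ˡ k) Fin.< k
        from p =
          let (a , a≡) = enum-onto U? (sym balanced) p in
          subst (λ v → (w ⟨$⟩ˡ v) Fin.< v) (trans (proj₂ (i-of a)) a≡)
            (Equivalence.to (tops {w = w} bs nf word≈w (i a)) ((i a , j a) , block∈ a , refl))

  abstract
    element : ∃ λ w → FullyCommutative w × (∀ k → k Fin.< (w $ k) ⇔ Dp k) × (∀ k → (w ⟨$⟩ˡ k) Fin.< k ⇔ Up′ k)
    element = build (tabulate λ a → i a , j a) (functions⇒nf i j i-mono j-mono j≤i) ∈ₗₚ.∈-tabulate⁺ ∈ₗₚ.∈-tabulate⁻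
      where
      build : (bs : List (Block n)) → NF bs → (∀ a → (i a , j a) ∈ₗ bs) → (∀ {b} → b ∈ₗ bs → ∃ λ a → b ≡ (i a , j a)) →
              ∃ λ w → FullyCommutative w × (∀ k → k Fin.< (w $ k) ⇔ Dp k) × (∀ k → (w ⟨$⟩ˡ k) Fin.< k ⇔ Up′ k)
      build bs nf block∈ ∈block = ⟦ word bs ⟧ , nf⇒fc bs nf , Image.positions bs nf block∈ ∈block ⟦ word bs ⟧ (λ _ → refl) ,
        Image.values bs nf block∈ ∈block ⟦ word bs ⟧ (λ _ → refl)

Exceeds Exceeded : Permutation′ m → Fin m → Set
Exceeds  w k = k Fin.< (w $ k)
Exceeded w k = (w ⟨$⟩ˡ k) Fin.< k

Exceeds? : (w : Permutation′ m) → Decidable (Exceeds w)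
Exceeds? w k = k Fin.<? (w $ k)

Exceeded? : (w : Permutation′ m) → Decidable (Exceeded w)
Exceeded? w k = (w ⟨$⟩ˡ k) Fin.<? k

-- For excedance positions and values, the identity behind `height` is just commutativity of
-- addition, for every permutation.
excedance-valid : (w : Permutation′ (suc n)) → Valid (Exceeds? w) (Exceeded? w)
excedance-valid w = record
  { ballot = λ κ lt → height-positive (Exceeds? w) (Exceeded? w) w comm {a = w ⟨$⟩ˡ κ}
      (lt , ℕₚ.≤-reflexive (cong toℕ (sym (inverseʳ w))))
  ; balanced = height-end (Exceeds? w) (Exceeded? w) w comm }
  where
  comm : ∀ k → ind (Exceeds? w k) + ind ((w ⟨$⟩ˡ k) Fin.<? k) ≡ ind (Exceeded? w k) + ind (k Fin.<? (w $ k))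
  comm k = ℕₚ.+-comm (ind (k Fin.<? (w $ k))) _

-- The effect of inv_c on lattice paths: the two kinds of level steps are exchanged at
-- positive height, on the side where Right fails.

-- The hypothesis says, without subtraction, that both paths have the same step at each label; hence
-- their heights agree everywhere.
cnt-exchange : {A B A′ B′ : Fin m → Set} (A? : Decidable A) (B? : Decidable B) (A′? : Decidable A′) (B′? : Decidable B′) →
               (∀ k → ind (A′? k) + ind (B? k) ≡ ind (B′? k) + ind (A? k)) →
               ∀ k → cnt A′? k + cnt B? k ≡ cnt B′? k + cnt A? k
cnt-exchange A? B? A′? B′? pointwise k = trans (cong₂ _+_ (cnt-def A′? k) (cnt-def B? k))
  (trans (sym (∑-distrib-+ (λ a → ind (cnt? A′? k a)) (λ a → ind (cnt? B? k a)))) (trans (sum-cong-≗ each)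
    (trans (∑-distrib-+ (λ a → ind (cnt? B′? k a)) (λ a → ind (cnt? A? k a)))
      (sym (cong₂ _+_ (cnt-def B′? k) (cnt-def A? k))))))
  where
  each : ∀ a → ind (cnt? A′? k a) + ind (cnt? B? k a) ≡ ind (cnt? B′? k a) + ind (cnt? A? k a)
  each a with toℕ a ℕ.<? k
  ... | yes a<k = trans (cong₂ _+_ (one (A′? a)) (one (B? a))) (trans (pointwise a) (sym (cong₂ _+_ (one (B′? a)) (one (A? a)))))
    where
    one : {P : Set} (P? : Dec P) → ind (yes a<k ×-dec P?) ≡ ind P?
    one (yes _) = refl
    one (no _)  = refl
  ... | no _ = refl

height-exchange : ∀ {a b a′ b′} → a′ + b ≡ b′ + a → b < a → b′ < a′
height-exchange {a} {b} {a′} {b′} eq b<a = ℕₚ.+-cancelʳ-< b b′ a′ (subst (b′ + b <_) (sym eq) (ℕₚ.+-monoʳ-< b′ b<a))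

valid-exchange : {A B A′ B′ : Fin (suc n) → Set} {A? : Decidable A} {B? : Decidable B} {A′? : Decidable A′} {B′? : Decidable B′} →
                 (∀ k → ind (A′? k) + ind (B? k) ≡ ind (B′? k) + ind (A? k)) →
                 (∀ k → B′ k → cnt B? (toℕ k) < cnt A? (toℕ k)) → Valid A? B? → Valid A′? B′?
valid-exchange {n} {A? = A?} {B?} {A′?} {B′?} pointwise positive valid = record
  { ballot = λ k b′ → height-exchange {cnt A? (toℕ k)} {cnt B? (toℕ k)} (same (toℕ k)) (positive k b′)
  ; balanced = ℕₚ.+-cancelʳ-≡ (cnt A? (suc n)) _ _ (trans (sym (same (suc n))) (cong (cnt A′? (suc n) +_) (Valid.balanced valid))) }
  where
  same : ∀ k → cnt A′? k + cnt B? k ≡ cnt B′? k + cnt A? k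
  same = cnt-exchange A? B? A′? B′? pointwise

module Exchange {Right : Fin (suc n) → Set} (Right? : Decidable Right) where

  -- With `A` and `B` the up- and down-steps and `H` positive height, `Flip A B H` and `Flip B A H`
  -- are the steps of the exchanged path. On the left, labels in both sets leave, and labels in
  -- neither enter where `H` holds.
  Flip : (A B : Fin (suc n) → Set) (H : Fin (suc n) → Set) → Fin (suc n) → Set
  Flip A B H k = (Right k × A k) ⊎ (¬ Right k × ((A k × ¬ B k) ⊎ (¬ A k × ¬ B k × H k)))

  flip? : {A B H : Fin (suc n) → Set} → Decidable A → Decidable B → Decidable H → Decidable (Flip A B H)
  flip? A? B? H? k = (Right? k ×-dec A? k) ⊎-dec
    (¬? (Right? k) ×-dec ((A? k ×-dec ¬? (B? k)) ⊎-dec (¬? (A? k) ×-dec (¬? (B? k) ×-dec H? k))))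

  flip-ind : {A B H : Fin (suc n) → Set} (A? : Decidable A) (B? : Decidable B) (H? : Decidable H) →
             ∀ k → ind (flip? A? B? H? k) + ind (B? k) ≡ ind (flip? B? A? H? k) + ind (A? k)
  flip-ind A? B? H? k with Right? k | A? k | B? k | H? k
  ... | yes _ | yes _ | yes _ | _     = refl
  ... | yes _ | yes _ | no  _ | _     = refl
  ... | yes _ | no  _ | yes _ | _     = refl
  ... | yes _ | no  _ | no  _ | _     = refl
  ... | no  _ | yes _ | yes _ | _     = refl
  ... | no  _ | yes _ | no  _ | _     = refl
  ... | no  _ | no  _ | yes _ | _     = refl
  ... | no  _ | no  _ | no  _ | yes _ = refl
  ... | no  _ | no  _ | no  _ | no  _ = refl

  flip-cong : {A B H A′ B′ H′ : Fin (suc n) → Set} → (∀ k → A k ⇔ A′ k) → (∀ k → B k ⇔ B′ k) → (∀ k → H k ⇔ H′ k) →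
              ∀ k → Flip A B H k ⇔ Flip A′ B′ H′ k
  flip-cong a b h k = mk⇔
    (λ { (inj₁ (r , p)) → inj₁ (r , Equivalence.to (a k) p)
       ; (inj₂ (¬r , inj₁ (p , ¬q))) → inj₂ (¬r , inj₁ (Equivalence.to (a k) p , ¬q ∘ Equivalence.from (b k)))
       ; (inj₂ (¬r , inj₂ (¬p , ¬q , t))) → inj₂ (¬r , inj₂ (¬p ∘ Equivalence.from (a k) , ¬q ∘ Equivalence.from (b k) , Equivalence.to (h k) t)) })
    (λ { (inj₁ (r , p)) → inj₁ (r , Equivalence.from (a k) p)
       ; (inj₂ (¬r , inj₁ (p , ¬q))) → inj₂ (¬r , inj₁ (Equivalence.from (a k) p , ¬q ∘ Equivalence.to (b k)))
       ; (inj₂ (¬r , inj₂ (¬p , ¬q , t))) → inj₂ (¬r , inj₂ (¬p ∘ Equivalence.to (a k) , ¬q ∘ Equivalence.to (b k) , Equivalence.from (h k) t)) })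

  -- The labels in both sets must satisfy `H`, or the second exchange would not bring them back.
  flip-involutive : {A B H : Fin (suc n) → Set} → Decidable A → Decidable B → (∀ k → A k → B k → H k) →
                    ∀ k → Flip (Flip A B H) (Flip B A H) H k ⇔ A k
  flip-involutive {A} {B} {H} A? B? high k = mk⇔ to from
    where
    to : Flip (Flip A B H) (Flip B A H) H k → A k
    to (inj₁ (r , inj₁ (_ , p))) = p
    to (inj₁ (r , inj₂ (¬r , _))) = contradiction r ¬r
    to (inj₂ (¬r , inj₁ (inj₁ (r , _) , _))) = contradiction r ¬r
    to (inj₂ (¬r , inj₁ (inj₂ (_ , inj₁ (p , _)) , _))) = p
    to (inj₂ (¬r , inj₁ (inj₂ (_ , inj₂ (¬p , ¬q , h)) , ¬b′))) = contradiction (inj₂ (¬r , inj₂ (¬q , ¬p , h))) ¬b′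
    to (inj₂ (¬r , inj₂ (¬a′ , ¬b′ , h))) with A? k | B? k
    ... | yes p | _ = p
    ... | no ¬p | yes q = contradiction (inj₂ (¬r , inj₁ (q , ¬p))) ¬b′
    ... | no ¬p | no ¬q = contradiction (inj₂ (¬r , inj₂ (¬p , ¬q , h))) ¬a′
    from : A k → Flip (Flip A B H) (Flip B A H) H k
    from p with Right? k | B? k
    ... | yes r | _ = inj₁ (r , inj₁ (r , p))
    ... | no ¬r | no ¬q = inj₂ (¬r , inj₁ (inj₂ (¬r , inj₁ (p , ¬q)) ,
            λ { (inj₁ (r , _)) → ¬r r ; (inj₂ (_ , inj₁ (q , _))) → ¬q q ; (inj₂ (_ , inj₂ (_ , ¬p , _))) → ¬p p }))
    ... | no ¬r | yes q = inj₂ (¬r , inj₂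
            ((λ { (inj₁ (r , _)) → ¬r r ; (inj₂ (_ , inj₁ (_ , ¬q))) → ¬q q ; (inj₂ (_ , inj₂ (¬p , _))) → ¬p p }) ,
             (λ { (inj₁ (r , _)) → ¬r r ; (inj₂ (_ , inj₁ (_ , ¬p))) → ¬p p ; (inj₂ (_ , inj₂ (¬q , _))) → ¬q q }) ,
             high k p q))

  module _ {A B : Fin (suc n) → Set} (A? : Decidable A) (B? : Decidable B) where

    High : Fin (suc n) → Set
    High k = cnt B? (toℕ k) < cnt A? (toℕ k)

    High? : Decidable High
    High? k = cnt B? (toℕ k) ℕ.<? cnt A? (toℕ k)

    flip-valid : Valid A? B? → Valid (flip? A? B? High?) (flip? B? A? High?)
    flip-valid valid = valid-exchange (flip-ind A? B? High?) positive valid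
      where
      positive : ∀ k → Flip B A High k → High k
      positive k (inj₁ (_ , q)) = Valid.ballot valid k q
      positive k (inj₂ (_ , inj₁ (q , _))) = Valid.ballot valid k q
      positive k (inj₂ (_ , inj₂ (_ , _ , h))) = h

  -- The exchange changes no height, so the second exchange uses the same condition `H` as the
  -- first; this makes it an involution on paths.
  flip-high : {A B : Fin (suc n) → Set} (A? : Decidable A) (B? : Decidable B) → ∀ k →
              High A? B? k ⇔ High (flip? A? B? (High? A? B?)) (flip? B? A? (High? A? B?)) k
  flip-high A? B? k = mk⇔ (height-exchange {a} {b} {a′} {b′} same)
      (height-exchange {a′} {b′} {a} {b} (trans (ℕₚ.+-comm a b′) (trans (sym same) (ℕₚ.+-comm a′ b))))
    where
    a  = cnt A? (toℕ k)
    b  = cnt B? (toℕ k)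
    a′ = cnt (flip? A? B? (High? A? B?)) (toℕ k)
    b′ = cnt (flip? B? A? (High? A? B?)) (toℕ k)
    same : a′ + b ≡ b′ + a
    same = cnt-exchange A? B? (flip? A? B? (High? A? B?)) (flip? B? A? (High? A? B?)) (flip-ind A? B? (High? A? B?)) (toℕ k)

-- Both orientations of "not last": ▷ is < for Dn and > for Up.
record Side (_▷_ : ∀ {m} → Fin m → Fin m → Set) (S : ∀ {m} → Permutation′ m → Fin m → Set) : Set where
  field
    to-S    : ∀ {m} {x : Permutation′ m} {a b} → a ▷ b → Orbit x a b → S x a
    from-S  : ∀ {m} {x : Permutation′ m} {a} → S x a → ∃ λ b → a ▷ b × Orbit x a b
    ▷-trans : ∀ {m} {a b d : Fin m} → a ▷ b → b ▷ d → a ▷ d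
    ▷-≢     : ∀ {m} {a b : Fin m} → a ▷ b → a ≢ b
    extreme : ∀ {m} {x : Permutation′ m} {a} → S x a → ∃ λ b → a ▷ b × Orbit x a b × ¬ S x b
    nested-end : ∀ {m} {k : Fin m} {P : Subset m} → NestedIn k P → ∃ λ b → b ∈ P × k ▷ b

_>ᶠ_ : Fin m → Fin m → Set
a >ᶠ b = b Fin.< a

dn-side : Side Fin._<_ Dn
dn-side = record
  { to-S = λ a<b a∼b → _ , a<b , a∼b ; from-S = id ; ▷-trans = ℕₚ.<-trans ; ▷-≢ = λ a<b a≡b → ℕₚ.<⇒≢ a<b (cong toℕ a≡b)
  ; extreme = λ {_} {x} {a} → ext x a
  ; nested-end = λ { (_ , _ , (b , (b∈ , _) , k<b)) → b , b∈ , k<b } }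
  where
  ext : ∀ {m} (x : Permutation′ m) a → Dn x a → ∃ λ b → a Fin.< b × Orbit x a b × ¬ Dn x b
  ext x a d with orbit-greatest x a
  ... | b , a∼b , ¬db with ℕₚ.<-cmp (toℕ a) (toℕ b)
  ... | tri< a<b _ _ = b , a<b , a∼b , ¬db
  ... | tri≈ _ a≡b _ = contradiction (subst (Dn x) (Finₚ.toℕ-injective a≡b) d) ¬db
  ... | tri> _ _ b<a = contradiction (a , b<a , orbit-sym x a∼b) ¬db

up-side : Side _>ᶠ_ Up
up-side = record
  { to-S = λ a>b a∼b → _ , a>b , a∼b ; from-S = id ; ▷-trans = λ a>b b>d → ℕₚ.<-trans b>d a>b
  ; ▷-≢ = λ a>b a≡b → ℕₚ.<⇒≢ a>b (cong toℕ (sym a≡b))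
  ; extreme = λ {_} {x} {a} → ext x a
  ; nested-end = λ { (_ , (a , (a∈ , _) , a<k) , _) → a , a∈ , a<k } }
  where
  ext : ∀ {m} (x : Permutation′ m) a → Up x a → ∃ λ b → b Fin.< a × Orbit x a b × ¬ Up x b
  ext x a u with orbit-least x a
  ... | b , a∼b , ¬ub with ℕₚ.<-cmp (toℕ b) (toℕ a)
  ... | tri< b<a _ _ = b , b<a , a∼b , ¬ub
  ... | tri≈ _ b≡a _ = contradiction (subst (Up x) (sym (Finₚ.toℕ-injective b≡a)) u) ¬ub
  ... | tri> _ _ a<b = contradiction (a , a<b , orbit-sym x a∼b) ¬ub

orbit-moves : (x : Permutation′ m) {a b : Fin m} → Orbit x a b → a ≢ b → supp x a
orbit-moves x a∼b a≢b fixed = a≢b (orbit-fixed x fixed a∼b)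

-- Effect on the path of adding and deleting vertices

module Effects {_▷_ : ∀ {m} → Fin m → Fin m → Set} {S : ∀ {m} → Permutation′ m → Fin m → Set} (side : Side _▷_ S) where

  open Side side

  side-pol : (x : Permutation′ (suc n)) → ∀ v → S x v ⇔ (∃₂ λ P w → Pol x P × v ∈ P × w ∈ P × v ▷ w)
  side-pol x v = mk⇔
    (λ sv → let (w , v▷w , v∼w) = from-S sv in
      orbitSet x v , w , pol-orbit x (orbit-moves x v∼w (▷-≢ v▷w)) ,
      Equivalence.from (∈-orbitSet x v v) (orbit-refl x) , Equivalence.from (∈-orbitSet x v w) v∼w , v▷w)
    (λ (P , w , pol , v∈ , w∈ , v▷w) → to-S v▷w (pol-joins x pol v∈ w∈))

  -- Being nested, `k` has vertices on both sides. No other label gains a bit: where `k` is the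
  -- witness, the end of `P` beyond `k` is a witness already.
  add-effect : {c : Permutation′ (suc n)} → ∀ {k y z} → AddVertex c k y z → ∀ v → S z v ⇔ (S y v ⊎ v ≡ k)
  add-effect {k = k} {y} {z} (P , polP , nested , _ , _ , toE , fromE) v = mk⇔ to from
    where
    end = nested-end nested
    to : S z v → S y v ⊎ v ≡ k
    to sv with Equivalence.to (side-pol z v) sv
    ... | Q , w , polQ , v∈ , w∈ , v▷w with toE polQ
    ... | inj₁ (polQ′ , _) = inj₁ (Equivalence.from (side-pol y v) (Q , w , polQ′ , v∈ , w∈ , v▷w))
    ... | inj₂ refl with Equivalence.to ∈-∪⁅⁆ v∈ | Equivalence.to ∈-∪⁅⁆ w∈
    ... | inj₂ v≡k | _ = inj₂ v≡k
    ... | inj₁ v∈P | inj₁ w∈P = inj₁ (Equivalence.from (side-pol y v) (P , w , polP , v∈P , w∈P , v▷w))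
    ... | inj₁ v∈P | inj₂ refl = inj₁ (Equivalence.from (side-pol y v)
            (P , proj₁ end , polP , v∈P , proj₁ (proj₂ end) , ▷-trans v▷w (proj₂ (proj₂ end))))
    old : ∀ {v} → v ∈ P → v ∈ P ∪ ⁅ k ⁆
    old v∈ = Equivalence.from ∈-∪⁅⁆ (inj₁ v∈)
    from : S y v ⊎ v ≡ k → S z v
    from (inj₂ refl) = Equivalence.from (side-pol z v)
      (P ∪ ⁅ k ⁆ , proj₁ end , fromE (inj₂ refl) , Equivalence.from ∈-∪⁅⁆ (inj₂ refl) , old (proj₁ (proj₂ end)) , proj₂ (proj₂ end))
    from (inj₁ sv) with Equivalence.to (side-pol y v) sv
    ... | Q , w , polQ , v∈ , w∈ , v▷w with subset-≟ Q P
    ... | no Q≢P = Equivalence.from (side-pol z v) (Q , w , fromE (inj₁ (polQ , Q≢P)) , v∈ , w∈ , v▷w)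
    ... | yes refl = Equivalence.from (side-pol z v) (P ∪ ⁅ k ⁆ , w , fromE (inj₂ refl) , old v∈ , old w∈ , v▷w)

  side-cong : {x y : Permutation′ m} → x ≈ y → ∀ v → S x v ⇔ S y v
  side-cong {x = x} {y} x≈y v = mk⇔
    (λ sv → let (w , v▷w , v∼w) = from-S sv in to-S v▷w (orbit-cong {x = x} {y} x≈y v∼w))
    (λ sv → let (w , v▷w , v∼w) = from-S sv in to-S v▷w (orbit-cong {x = y} {x} (sym ∘ x≈y) v∼w))

  adds-effect : {c : Permutation′ (suc n)} → ∀ ks {y z} → AddVertices c ks y z → ∀ v → S z v ⇔ (S y v ⊎ v ∈ₗ ks)
  adds-effect [] {y} {z} y≈z v = mk⇔ (inj₁ ∘ Equivalence.from (side-cong {x = y} {z} y≈z v))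
    λ { (inj₁ sv) → Equivalence.to (side-cong {x = y} {z} y≈z v) sv ; (inj₂ ()) }
  adds-effect {c = c} (k ∷ ks) {y} {z} (y₁ , add , adds) v = mk⇔ to from
    where
    first  = add-effect {c = c} {k} {y} {y₁} add v
    second = adds-effect {c = c} ks {y₁} {z} adds v
    to : S z v → S y v ⊎ v ∈ₗ k ∷ ks
    to sv with Equivalence.to second sv
    ... | inj₂ v∈ = inj₂ (there v∈)
    ... | inj₁ sv₁ with Equivalence.to first sv₁
    ... | inj₁ sy = inj₁ sy
    ... | inj₂ v≡k = inj₂ (here v≡k)
    from : S y v ⊎ v ∈ₗ k ∷ ks → S z v
    from (inj₁ sy) = Equivalence.from second (inj₁ (Equivalence.from first (inj₁ sy)))
    from (inj₂ (here v≡k)) = Equivalence.from second (inj₁ (Equivalence.from first (inj₂ v≡k)))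
    from (inj₂ (there v∈)) = Equivalence.from second (inj₂ v∈)

  -- Deleted vertices satisfy `S`, so the extreme vertex of a polygon is never deleted and remains a
  -- witness for all others.
  without-effect : {x y : Permutation′ (suc n)} {Mₓ : Fin (suc n) → Set} → Decidable Mₓ → (∀ b → Mₓ b → S x b) →
                   Pol y ≐ without (Pol x) Mₓ → ∀ v → S y v ⇔ (S x v × ¬ Mₓ v)
  without-effect {x = x} {y} {Mₓ} M? inner (toW , fromW) v = mk⇔ to from
    where
    to : S y v → S x v × ¬ Mₓ v
    to sv with Equivalence.to (side-pol y v) sv
    ... | Q , w , polQ , v∈ , w∈ , v▷w with toW polQ
    ... | P , polP , mem = to-S v▷w (pol-joins x polP (proj₁ (Equivalence.to (mem v) v∈)) (proj₁ (Equivalence.to (mem w) w∈))) ,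
            proj₂ (Equivalence.to (mem v) v∈)
    from : S x v × ¬ Mₓ v → S y v
    from (sv , ¬mv) with extreme sv
    ... | b , v▷b , v∼b , ¬sb = Equivalence.from (side-pol y v)
          (subsetOf Q? , b , fromW (orbitSet x v , pol-orbit x (orbit-moves x v∼b (▷-≢ v▷b)) , ∈-subsetOf Q?) ,
           Equivalence.from (∈-subsetOf Q? v) (Equivalence.from (∈-orbitSet x v v) (orbit-refl x) , ¬mv) ,
           Equivalence.from (∈-subsetOf Q? b) (Equivalence.from (∈-orbitSet x v b) v∼b , ¬sb ∘ inner b) , v▷b)
      where
      Q? : Decidable (λ w → w ∈ orbitSet x v × ¬ Mₓ w)
      Q? w = (w Subsetₚ.∈? orbitSet x v) ×-dec ¬? (M? w)

-- Polygon diagrams realising the steps of the involution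

module Diagrams {n} {c : Permutation′ (suc n)} (unimodal : Unimodal c) where

  open CoxeterCircle unimodal public
  open Bits coxeter-circle public
  open Exchange R? public

  module _ (y : Permutation′ (suc n)) (geo : Geo y) where

    private
      -- One of `p₁`, `p₂` lies between `q₁` and `q₂` on the arc from `z` to `w`, contrary to the
      -- assumption that both avoid this arc.
      unseparated : ∀ {z w p₁ p₂ q₁ q₂} → Br z q₁ w → Br z q₂ w → ¬ Br z p₁ w → ¬ Br z p₂ w →
                    Br p₁ q₁ p₂ → Br p₂ q₂ p₁ → ⊥
      unseparated zq₁w zq₂w ¬p₁ ¬p₂ p₁q₁p₂ p₂q₂p₁
        with br-total (br-≢ zq₁w) (λ { refl → br-asym p₁q₁p₂ (br-rotate² p₂q₂p₁) }) (br-≢ zq₂w)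
      ... | inj₁ zq₁q₂ = ¬p₂ (br-trans (br-rotate (br-trans (br-rotate² zq₁q₂) (br-rotate
              (br-trans p₂q₂p₁ (br-rotate² p₁q₁p₂))))) zq₂w)
      ... | inj₂ zq₂q₁ = ¬p₁ (br-trans (br-rotate (br-trans (br-rotate² zq₂q₁) (br-rotate
              (br-trans p₁q₁p₂ (br-rotate² p₂q₂p₁))))) zq₁w)

      -- A walk along the polygon from `p` cannot get past `q` without an arrow jumping over it;
      -- until then it is before `q` or at `p`.
      find-gap : ∀ {p q} → ¬ Orbit y p q → ∀ j →
                 (∃ λ z → Orbit y p z × Br z q (y $ z)) ⊎ (iterate (y $_) p j ≡ p ⊎ Br p (iterate (y $_) p j) q)
      find-gap p≁q zero = inj₂ (inj₁ refl)
      find-gap {p} {q} p≁q (suc j) with find-gap p≁q j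
      ... | inj₁ gap = inj₁ gap
      ... | inj₂ before = subst (λ v → _ ⊎ (v ≡ p ⊎ Br p v q)) (sym (iterate-suc (y $_) p j))
              (step before (y $ z Fin.≟ p) (y $ z Fin.≟ z))
        where
        z = iterate (y $_) p j
        p∼z : Orbit y p z
        p∼z = j , refl
        step : (z ≡ p ⊎ Br p z q) → Dec (y $ z ≡ p) → Dec (y $ z ≡ z) →
               (∃ λ z → Orbit y p z × Br z q (y $ z)) ⊎ (y $ z ≡ p ⊎ Br p (y $ z) q)
        step _ (yes yz≡p) _ = inj₂ (inj₁ yz≡p)
        step before (no _) (yes yz≡z) = inj₂ (subst (λ v → v ≡ p ⊎ Br p v q) (sym yz≡z) before)
        step before (no _) (no yz≢z) with br-total (λ z≡q → p≁q (subst (Orbit y p) z≡q p∼z))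
              (λ q≡yz → p≁q (subst (Orbit y p) (sym q≡yz) (orbit-trans y p∼z (orbit-step y)))) (yz≢z ∘ sym)
        ... | inj₁ zqyz = inj₁ (z , p∼z , zqyz)
        ... | inj₂ zyzq = inj₂ (inj₂ (after before))
          where
          after : z ≡ p ⊎ Br p z q → Br p (y $ z) q
          after (inj₁ z≡p) = subst (λ v → Br v (y $ z) q) z≡p zyzq
          after (inj₂ pzq) = br-rotate (br-trans (br-rotate² pzq) (br-rotate² zyzq))

    -- If the polygon of `p₁` got past `q₁`, one of its arrows would span `q₁`, and by `geo-orbit`
    -- the whole polygon of `q₁`, while `avoid` keeps `p₁` and `p₂` out of that arc.
    uncrossed : ∀ {p₁ p₂ q₁ q₂} → Orbit y p₁ p₂ → Orbit y q₁ q₂ → ¬ Orbit y p₁ q₁ → Br p₁ q₁ p₂ → Br p₂ q₂ p₁ → ⊥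
    uncrossed {p₁} {q₁ = q₁} p∼@(j , refl) q∼ p≁q p₁q₁p₂ p₂q₂p₁ with find-gap p≁q j
    ... | inj₂ (inj₁ p₂≡p₁) = br-≢₃ p₁q₁p₂ (sym p₂≡p₁)
    ... | inj₂ (inj₂ p₁p₂q₁) = br-asym p₁q₁p₂ p₁p₂q₁
    ... | inj₁ (z , p∼z , gap) = unseparated gap (geo-orbit y geo q∼ gap)
            (avoid y geo (orbit-sym y p∼z)) (avoid y geo (orbit-trans y (orbit-sym y p∼z) p∼)) p₁q₁p₂ p₂q₂p₁

    br-at : ∀ {a b d} → a ≤ n → b ≤ n → d ≤ n → Between a b d → Br (at c a) (at c b) (at c d)
    br-at a≤n b≤n d≤n btw rewrite pos-at a≤n | pos-at b≤n | pos-at d≤n = btw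

    noncrossing : Noncrossing c (Pol y)
    noncrossing P Q polP polQ P≢Q =
      (λ v∈P v∈Q → P≢Q (pol-unique y polP polQ v∈P v∈Q (orbit-refl y))) , apart polP polQ P≢Q , apart polQ polP (P≢Q ∘ sym)
      where
      apart : ∀ {P Q} → Pol y P → Pol y Q → P ≢ Q → ¬ Crosses c P Q
      apart polP polQ P≢Q (a , b , a′ , b′ , a<b , b<a′ , a′<b′ , b′≤n , a∈ , b∈ , a′∈ , b′∈) =
        uncrossed (pol-joins y polP a∈ a′∈) (pol-joins y polQ b∈ b′∈) (P≢Q ∘ pol-unique y polP polQ a∈ b∈)
          (br-at a≤n b≤n a′≤n (inj₁ (a<b , b<a′))) (br-at a′≤n b′≤n a≤n (inj₂ (inj₂ (ℕₚ.<-trans a<b b<a′ , a′<b′))))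
        where
        a′≤n = ℕₚ.<⇒≤ (ℕₚ.<-≤-trans a′<b′ b′≤n)
        b≤n = ℕₚ.<⇒≤ (ℕₚ.<-≤-trans b<a′ a′≤n)
        a≤n = ℕₚ.<⇒≤ (ℕₚ.<-≤-trans a<b b≤n)

  remove-orbit : ∀ {k} x → supp x k → ∀ {a b} → a ≢ k → b ≢ k → Orbit x a b ⇔ Orbit (remove k x) a b
  remove-orbit {k} x sk {a} {b} a≢k b≢k = mk⇔ to
      (λ a∼b → orbit-cong {x = r · transpose q k} {x} (restore k x) (Merge.widen r q k (remove-apart x sk) a∼b))
    where
    r = remove k x
    q = x ⟨$⟩ˡ k
    open Merge r q k (remove-apart x sk) using (narrow; Joined)
    to-q : ∀ {a} → a ≢ k → Joined a → Orbit r a q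
    to-q a≢k (inj₁ a∼q) = a∼q
    to-q a≢k (inj₂ a∼k) = contradiction (sym (orbit-fixed r (remove-fixes k x) (orbit-sym r a∼k))) a≢k
    to : Orbit x a b → Orbit r a b
    to a∼b with narrow (orbit-cong {x = x} {r · transpose q k} (sym ∘ restore k x) a∼b)
    ... | inj₁ a∼b′ = a∼b′
    ... | inj₂ (ja , jb) = orbit-trans r (to-q a≢k ja) (orbit-sym r (to-q b≢k jb))

  -- An arrow crossing level `k` encloses `k` strictly because it cannot end at a fixed label;
  -- conversely an orbit with labels on both sides contains a crossing arrow.
  nested⇔high : ∀ x → Geo x → ∀ k → x $ k ≡ k → Nested x k ⇔ High (Dn? x) (Up? x) k
  nested⇔high x geo k fixed = mk⇔
    (λ { (a , b , a<k , k<b , a∼b) → height-positive (Dn? x) (Up? x) x (local x geo)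
           (proj₂ (above-cross x a<k (ℕₚ.<⇒≤ k<b) a∼b)) })
    (λ high → crossed (height-witness (Dn? x) (Up? x) x (local x geo) {toℕ k} high))
    where
    crossed : ∃ (Above x (toℕ k)) → Nested x k
    crossed (a , a<k , k≤xa) = a , x $ a , a<k ,
      ℕₚ.≤∧≢⇒< k≤xa (λ eq → ℕₚ.<⇒≢ a<k (cong toℕ (perm-injective x
        (trans (sym (Finₚ.toℕ-injective eq)) (sym fixed))))) ,
      orbit-step x

  module Add (y : Permutation′ (suc n)) (geo-y : Geo y) {k : Fin (suc n)} (yk : y $ k ≡ k) (nested : Nested y k) where

    private
      A B : Fin (suc n) → Set
      A v = Dn y v ⊎ v ≡ k
      B v = Up y v ⊎ v ≡ k
      A? : Decidable A
      A? v = Dn? y v ⊎-dec (v Fin.≟ k)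
      B? : Decidable B
      B? v = Up? y v ⊎-dec (v Fin.≟ k)

      valid : Valid A? B?
      valid = valid-exchange {A? = Dn? y} {Up? y} {A?} {B?} pointwise positive (bits-valid y geo-y)
        where
        pointwise : ∀ v → ind (A? v) + ind (Up? y v) ≡ ind (B? v) + ind (Dn? y v)
        pointwise v with v Fin.≟ k
        ... | yes refl = cong₂ _+_
                (trans (ind-yes (Dn? y v ⊎-dec yes refl) (inj₂ refl)) (sym (ind-yes (Up? y v ⊎-dec yes refl) (inj₂ refl))))
                (trans (ind-no (Up? y v) (fixed⇒¬Up y yk)) (sym (ind-no (Dn? y v) (fixed⇒¬Dn y yk))))
        ... | no v≢k = trans (cong₂ _+_ (old (Dn? y v)) (sym (old (Up? y v)))) (ℕₚ.+-comm (ind (Dn? y v)) _)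
          where
          old : {P : Set} (P? : Dec P) → ind (P? ⊎-dec no v≢k) ≡ ind P?
          old (yes _) = refl
          old (no _)  = refl
        positive : ∀ v → B v → cnt (Up? y) (toℕ v) < cnt (Dn? y) (toℕ v)
        positive v (inj₁ u)    = Valid.ballot (bits-valid y geo-y) v u
        positive v (inj₂ refl) = Equivalence.to (nested⇔high y geo-y k yk) nested

      abstract
        -- The path of `y` with the level step at `k` replaced by one of the other kind. It is valid
        -- because a nested label has positive height, and drawing it finds the right polygon for
        -- `k`.
        scan : ∃ λ x → Geo x × (∀ v → Dn x v ⇔ A v) × (∀ v → Up x v ⇔ B v)
        scan = Scan.bits-surjective coxeter-circle A? B? valid

    z : Permutation′ (suc n)
    z = proj₁ scan

    geo-z : Geo z
    geo-z = proj₁ (proj₂ scan)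

    dn-z : ∀ v → Dn z v ⇔ (Dn y v ⊎ v ≡ k)
    dn-z = proj₁ (proj₂ (proj₂ scan))

    up-z : ∀ v → Up z v ⇔ (Up y v ⊎ v ≡ k)
    up-z = proj₂ (proj₂ (proj₂ scan))

    private
      dn-k : Dn z k
      dn-k = Equivalence.from (dn-z k) (inj₂ refl)
      up-k : Up z k
      up-k = Equivalence.from (up-z k) (inj₂ refl)
      sk : supp z k
      sk = Dn⇒supp z dn-k
      r q : _
      r = remove k z
      q = z ⟨$⟩ˡ k
      q≢k : q ≢ k
      q≢k = preimage-≢ z sk
      q∼k : Orbit z q k
      q∼k = 1 , inverseʳ z

      module _ {_▷_ : ∀ {m} → Fin m → Fin m → Set} {S : ∀ {m} → Permutation′ m → Fin m → Set} (side : Side _▷_ S) where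
        open Side side
        -- A witness `k` can be replaced by one beyond it, since `k` itself satisfies `S` in `z`.
        removed-side : (∀ v → S z v ⇔ (S y v ⊎ v ≡ k)) → ¬ S y k → ∀ v → S r v ⇔ S y v
        removed-side s-z ¬sk v = mk⇔ to from
          where
          to : S r v → S y v
          to sv with from-S sv
          ... | w , v▷w , v∼w with Equivalence.to (s-z v) (to-S v▷w (Equivalence.from (remove-orbit z sk
                  (λ { refl → ▷-≢ v▷w (orbit-fixed r (remove-fixes v z) v∼w) })
                  (λ { refl → ▷-≢ v▷w (sym (orbit-fixed r (remove-fixes w z) (orbit-sym r v∼w))) })) v∼w))
          ... | inj₁ sy = sy
          ... | inj₂ refl = contradiction (orbit-fixed r (remove-fixes v z) v∼w) (▷-≢ v▷w)
          from : S y v → S r v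
          from sy = go (from-S (Equivalence.from (s-z v) (inj₁ sy)))
            where
            v≢k : v ≢ k
            v≢k refl = ¬sk sy
            go : (∃ λ w → v ▷ w × Orbit z v w) → S r v
            go (w , v▷w , v∼w) with w Fin.≟ k
            ... | no w≢k = to-S v▷w (Equivalence.to (remove-orbit z sk v≢k w≢k) v∼w)
            ... | yes refl with from-S (Equivalence.from (s-z w) (inj₂ refl))
            ... | w′ , k▷w′ , k∼w′ = to-S (▷-trans v▷w k▷w′)
                    (Equivalence.to (remove-orbit z sk v≢k (▷-≢ k▷w′ ∘ sym)) (orbit-trans z v∼w k∼w′))

      -- Deleting `k` from `z` leaves the bits of `y`, and bits determine the element. So the orbits
      -- of `z` are those of `y` up to the place of `k`.
      y≈r : y ≈ r
      y≈r = bits-injective {y} {r} geo-y (geo-remove z geo-z sk)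
        ((λ v → ⇔-sym (removed-side dn-side dn-z (fixed⇒¬Dn y yk) v)) ,
         (λ v → ⇔-sym (removed-side up-side up-z (fixed⇒¬Up y yk) v)))

    old-orbit : ∀ {a b} → a ≢ k → b ≢ k → Orbit z a b ⇔ Orbit y a b
    old-orbit a≢k b≢k = ⇔-trans (remove-orbit z sk a≢k b≢k)
      (mk⇔ (orbit-cong {x = r} {y} (sym ∘ y≈r)) (orbit-cong {x = y} {r} y≈r))

    private
      to-y : ∀ {a b} → a ≢ k → b ≢ k → Orbit z a b → Orbit y a b
      to-y a≢k b≢k = Equivalence.to (old-orbit a≢k b≢k)
      to-z : ∀ {a b} → a ≢ k → b ≢ k → Orbit y a b → Orbit z a b
      to-z a≢k b≢k = Equivalence.from (old-orbit a≢k b≢k)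

      -- The polygon that receives `k` is that of the predecessor of `k` in `z`.
      P : Subset (suc n)
      P = orbitSet y q
      ∈P : ∀ v → v ∈ P ⇔ Orbit y q v
      ∈P = ∈-orbitSet y q

      k∉orbit : ∀ {v} → v ≢ k → ¬ Orbit y v k
      k∉orbit v≢k v∼k = v≢k (sym (orbit-fixed y yk (orbit-sym y v∼k)))
      k∉P : k ∉ P
      k∉P k∈ = k∉orbit q≢k (Equivalence.to (∈P k) k∈)

      lo hi : Fin (suc n)
      lo = proj₁ up-k
      hi = proj₁ dn-k
      lo<k : lo Fin.< k
      lo<k = proj₁ (proj₂ up-k)
      k<hi : k Fin.< hi
      k<hi = proj₁ (proj₂ dn-k)
      q∼lo : Orbit y q lo
      q∼lo = to-y q≢k (ℕₚ.<⇒≢ lo<k ∘ cong toℕ) (orbit-trans z q∼k (proj₂ (proj₂ up-k)))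
      q∼hi : Orbit y q hi
      q∼hi = to-y q≢k (ℕₚ.<⇒≢ k<hi ∘ sym ∘ cong toℕ) (orbit-trans z q∼k (proj₂ (proj₂ dn-k)))
      sq : supp y q
      sq = supp-orbit y (Dn⇒supp y (hi , ℕₚ.<-trans lo<k k<hi , orbit-trans y (orbit-sym y q∼lo) q∼hi)) (orbit-sym y q∼lo)

      polP : Pol y P
      polP = pol-orbit y sq

      ∈P∪k : ∀ v → v ∈ P ∪ ⁅ k ⁆ ⇔ Orbit z k v
      ∈P∪k v = ⇔-trans ∈-∪⁅⁆ (mk⇔ to (λ k∼v → from k∼v (v Fin.≟ k)))
        where
        to : v ∈ P ⊎ v ≡ k → Orbit z k v
        to (inj₂ refl) = orbit-refl z
        to (inj₁ v∈) = orbit-trans z (orbit-sym z q∼k)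
          (to-z q≢k (λ { refl → k∉P v∈ }) (Equivalence.to (∈P v) v∈))
        from : Orbit z k v → Dec (v ≡ k) → v ∈ P ⊎ v ≡ k
        from k∼v (yes v≡k) = inj₂ v≡k
        from k∼v (no v≢k) = inj₁ (Equivalence.from (∈P v) (to-y q≢k v≢k (orbit-trans z q∼k k∼v)))

      enlarged : Pol z ≐ enlarge (Pol y) P k
      enlarged = (λ {Q} → to Q) , (λ {Q} → from Q)
        where
        to : ∀ Q → Pol z Q → enlarge (Pol y) P k Q
        to Q pol@(p , sp , mem) with k Subsetₚ.∈? Q
        ... | yes k∈ = inj₂ (subset-ext λ v → ⇔-trans
                (mk⇔ (pol-joins z pol k∈) (pol-closed z pol k∈)) (⇔-sym (∈P∪k v)))
        ... | no k∉ = inj₁ ((p , sp′ , λ v → mk⇔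
                (λ v∈ → to-y p≢k (λ { refl → k∉ v∈ }) (Equivalence.to (mem v) v∈))
                (λ p∼v → Equivalence.from (mem v) (to-z p≢k (λ { refl → k∉orbit p≢k p∼v }) p∼v))) , Q≢P)
          where
          p∈ : p ∈ Q
          p∈ = Equivalence.from (mem p) (orbit-refl z)
          p≢k : p ≢ k
          p≢k refl = k∉ p∈
          sp′ : supp y p
          sp′ = orbit-moves y (to-y p≢k (λ zp≡k → k∉ (Equivalence.from (mem k) (1 , zp≡k))) (orbit-step z)) (sp ∘ sym)
          Q≢P : Q ≢ P
          Q≢P refl = k∉ (pol-closed z pol (Equivalence.from (∈P q) (orbit-refl y)) q∼k)
        from : ∀ Q → enlarge (Pol y) P k Q → Pol z Q
        from Q (inj₂ refl) = k , sk , ∈P∪k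
        from Q (inj₁ (pol@(p , sp , mem) , Q≢P)) = p ,
            orbit-moves z (to-z p≢k yp≢k (orbit-step y)) (sp ∘ sym) , λ v → mk⇔
              (λ v∈ → to-z p≢k (λ { refl → k∉Q v∈ }) (Equivalence.to (mem v) v∈))
              (λ p∼v → Equivalence.from (mem v) (to-y p≢k (apart p∼v) p∼v))
          where
          p≢k : p ≢ k
          p≢k refl = sp yk
          yp≢k : y $ p ≢ k
          yp≢k yp≡k = p≢k (perm-injective y (trans yp≡k (sym yk)))
          k∉Q : k ∉ Q
          k∉Q k∈ = k∉orbit p≢k (Equivalence.to (mem k) k∈)
          apart : ∀ {v} → Orbit z p v → v ≢ k
          apart p∼k refl = Q≢P (pol-unique y pol polP (Equivalence.from (mem p) (orbit-refl y))
            (Equivalence.from (∈P q) (orbit-refl y)) (to-y p≢k q≢k (orbit-trans z p∼k (orbit-sym z q∼k))))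

    addVertex : AddVertex c k y z
    addVertex = P , polP , nested-in y polP k∉P (Equivalence.from (∈P lo) q∼lo) (Equivalence.from (∈P hi) q∼hi) lo<k k<hi ,
      (λ Q Q′ eQ eQ′ → noncrossing z geo-z Q Q′ (proj₂ enlarged eQ) (proj₂ enlarged eQ′)) ,
      geo⇒≤T z geo-z , enlarged

  add-vertices : ∀ ks y → Geo y → Unique ks → All (λ k → y $ k ≡ k × Nested y k) ks → ∃ λ z → Geo z × AddVertices c ks y z
  add-vertices [] y geo _ _ = y , geo , λ _ → refl
  add-vertices (k ∷ ks) y geo (k∉ ∷ uniq) ((yk , nested) ∷ all) =
    let (z′ , geo′ , adds) = add-vertices ks z geo-z uniq (All.map still (All.zip (k∉ , all))) in
    z′ , geo′ , z , addVertex , adds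
    where
    open Add y geo yk nested
    still : ∀ {l} → k ≢ l × (y $ l ≡ l × Nested y l) → z $ l ≡ l × Nested z l
    still {l} (k≢l , yl , (a , b , a<l , l<b , a∼b)) = ¬Up∧¬Dn⇒fixed z
        (λ u → case Equivalence.to (up-z l) u of λ { (inj₁ u′) → fixed⇒¬Up y yl u′ ; (inj₂ refl) → k≢l refl })
        (λ d → case Equivalence.to (dn-z l) d of λ { (inj₁ d′) → fixed⇒¬Dn y yl d′ ; (inj₂ refl) → k≢l refl }) ,
      (a , b , a<l , l<b , Equivalence.from (old-orbit
        (λ { refl → orbit-moves y a∼b a≢b yk }) (λ { refl → orbit-moves y (orbit-sym y a∼b) (a≢b ∘ sym) yk })) a∼b)
      where
      a≢b : a ≢ b
      a≢b = ℕₚ.<⇒≢ (ℕₚ.<-trans a<l l<b) ∘ cong toℕ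

  strip : ∀ ms x → Geo x → ∃ λ y → Geo y × (∀ {v} → v ∈ₗ ms → y $ v ≡ v) ×
          (∀ {a b} → ¬ a ∈ₗ ms → ¬ b ∈ₗ ms → Orbit y a b ⇔ Orbit x a b)
  strip [] x geo = x , geo , (λ ()) , λ _ _ → mk⇔ id id
  strip (k ∷ ms) x geo with strip ms x geo
  ... | y , geo-y , fixed , same with y $ k Fin.≟ k
  -- The deletions already made may have left `k` alone in its polygon.
  ... | yes yk = y , geo-y , (λ { (here refl) → yk ; (there v∈) → fixed v∈ }) ,
          λ a∉ b∉ → same (a∉ ∘ there) (b∉ ∘ there)
  ... | no sk = remove k y , geo-remove y geo-y sk ,
          (λ { (here refl) → remove-fixes k y ; (there v∈) → still v∈ (_ Fin.≟ k) }) ,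
          λ a∉ b∉ → ⇔-trans (⇔-sym (remove-orbit y sk (a∉ ∘ here) (b∉ ∘ here))) (same (a∉ ∘ there) (b∉ ∘ there))
    where
    still : ∀ {v} → v ∈ₗ ms → Dec (v ≡ k) → remove k y $ v ≡ v
    still v∈ (yes refl) = remove-fixes k y
    still v∈ (no v≢k) = trans (cong (y $_) (transpose-other v≢q v≢k)) (fixed v∈)
      where
      v≢q : _ ≢ y ⟨$⟩ˡ k
      v≢q eq = v≢k (trans (sym (fixed v∈)) (trans (cong (y $_) eq) (inverseʳ y)))

  -- Only inner vertices are deleted, so each polygon keeps its least and greatest vertices, which
  -- are distinct; no polygon disappears.
  strip-without : ∀ x → Geo x → {Mₓ : Fin (suc n) → Set} → Decidable Mₓ → (∀ v → Mₓ v → Dn x v × Up x v) →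
                  ∃ λ y → Geo y × Pol y ≐ without (Pol x) Mₓ
  strip-without x geo {Mₓ} M? inner with strip (filter M? (allFin (suc n))) x geo
  ... | y , geo-y , fixed′ , same′ = y , geo-y , (λ {Q} → to Q) , (λ {Q} → from Q)
    where
    ms = filter M? (allFin (suc n))
    fixed : ∀ {v} → Mₓ v → y $ v ≡ v
    fixed mv = fixed′ (∈ₗₚ.∈-filter⁺ M? (∈ₗₚ.∈-allFin _) mv)
    same : ∀ {a b} → ¬ Mₓ a → ¬ Mₓ b → Orbit y a b ⇔ Orbit x a b
    same ¬ma ¬mb = same′ (¬ma ∘ proj₂ ∘ ∈ₗₚ.∈-filter⁻ M? {xs = allFin (suc n)}) (¬mb ∘ proj₂ ∘ ∈ₗₚ.∈-filter⁻ M? {xs = allFin (suc n)})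
    outside : ∀ {a b} → supp y a → Orbit y a b → ¬ Mₓ b
    outside sa a∼b mb = supp-orbit y sa a∼b (fixed mb)
    to : ∀ Q → Pol y Q → without (Pol x) Mₓ Q
    to Q (p , sp , mem) = orbitSet x p ,
        pol-orbit x (orbit-moves x (Equivalence.to (same ¬mp (outside sp (orbit-step y))) (orbit-step y)) (sp ∘ sym)) ,
        λ v → mk⇔
          (λ v∈ → let p∼v = Equivalence.to (mem v) v∈ ; ¬mv = outside sp p∼v in
             Equivalence.from (∈-orbitSet x p v) (Equivalence.to (same ¬mp ¬mv) p∼v) , ¬mv)
          (λ (v∈ , ¬mv) → Equivalence.from (mem v) (Equivalence.from (same ¬mp ¬mv) (Equivalence.to (∈-orbitSet x p v) v∈)))
      where
      ¬mp : ¬ Mₓ p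
      ¬mp = outside sp (orbit-refl y)
    from : ∀ Q → without (Pol x) Mₓ Q → Pol y Q
    from Q (P , pol@(p , sp , memP) , mem) with orbit-least x p | orbit-greatest x p
    ... | l , p∼l , ¬ul | g , p∼g , ¬dg = l , orbit-moves y (Equivalence.from (same ¬ml ¬mg) l∼g) l≢g , λ v → mk⇔ (to-l v) (from-l v)
      where
      ¬ml : ¬ Mₓ l
      ¬ml ml = ¬ul (proj₂ (inner l ml))
      ¬mg : ¬ Mₓ g
      ¬mg mg = ¬dg (proj₁ (inner g mg))
      l∼g : Orbit x l g
      l∼g = orbit-trans x (orbit-sym x p∼l) p∼g
      l≢g : l ≢ g
      l≢g refl = supp-orbit x sp p∼l (¬Up∧¬Dn⇒fixed x ¬ul ¬dg)
      sl : supp y l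
      sl = orbit-moves y (Equivalence.from (same ¬ml ¬mg) l∼g) l≢g
      l∈ : l ∈ P
      l∈ = Equivalence.from (memP l) p∼l
      to-l : ∀ v → v ∈ Q → Orbit y l v
      to-l v v∈ = let (v∈P , ¬mv) = Equivalence.to (mem v) v∈ in Equivalence.from (same ¬ml ¬mv) (pol-joins x pol l∈ v∈P)
      from-l : ∀ v → Orbit y l v → v ∈ Q
      from-l v l∼v = Equivalence.from (mem v) (pol-closed x pol l∈ (Equivalence.to (same ¬ml ¬mv) l∼v) , ¬mv)
        where
        ¬mv : ¬ Mₓ v
        ¬mv = outside sl l∼v

-- The map φ: conditions, bijectivity and its relation to `Φ`

module Characterisation {n} {c : Permutation′ (suc n)} (unimodal : Unimodal c) where

  open Diagrams unimodal

  private
    Label : Set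
    Label = Fin (suc n)
    Perm : Set
    Perm = Permutation′ (suc n)

  ¬zero-inner : ∀ (x : Perm) → ¬ Up x zero
  ¬zero-inner x (_ , () , _)

  ¬max< : ∀ {b : Label} → ¬ fromℕ n Fin.< b
  ¬max< {b} lt = ℕₚ.<⇒≱ lt (subst (toℕ b ≤_) (sym (Finₚ.toℕ-fromℕ n)) (ℕ.s≤s⁻¹ (Finₚ.toℕ<n b)))

  ¬max-inner : ∀ (x : Perm) → ¬ Dn x (fromℕ n)
  ¬max-inner x (b , lt , _) = ¬max< lt

  -- The labels 1 and n+1 belong to both sides. They are neither inner vertices nor nested, so the
  -- exchange treats them alike on either side.
  ends-not-inner : ∀ (x : Perm) {k} → R c k → L c k → ¬ (Dn x k × Up x k)
  ends-not-inner x r l (d , u) with R∩L r l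
  ... | inj₁ refl = ¬zero-inner x u
  ... | inj₂ refl = ¬max-inner x d

  ends-not-nested : ∀ (x : Perm) {k} → R c k → L c k → ¬ Nested x k
  ends-not-nested x r l (a , b , a<k , k<b , _) with R∩L r l
  ... | inj₁ refl = case a<k of λ ()
  ... | inj₂ refl = ¬max< k<b

  L? : Decidable (L c)
  L? k with R? k | k Fin.≟ zero | k Fin.≟ fromℕ n
  ... | no ¬r | _        | _        = yes (¬R⇒L ¬r)
  ... | yes _ | yes refl | _        = yes L-zero
  ... | yes _ | no _     | yes refl = yes L-max
  ... | yes r | no k≢0   | no k≢n   = no λ l → case R∩L r l of λ { (inj₁ eq) → k≢0 eq ; (inj₂ eq) → k≢n eq }

  unsupp : ∀ (x : Perm) {k : Label} → ¬ supp x k → x $ k ≡ k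
  unsupp x {k} ¬s with x $ k Fin.≟ k
  ... | yes eq = eq
  ... | no neq = contradiction neq ¬s

  N⇔ : ∀ (x : Perm) k → N c x k ⇔ (L c k × x $ k ≡ k × Nested x k)
  N⇔ x k = mk⇔
    (λ (l , ¬s , nested) → l , unsupp x ¬s , Equivalence.to (nested⇔ x k (unsupp x ¬s)) nested)
    (λ (l , fixed , nested) → l , (λ s → s fixed) , Equivalence.from (nested⇔ x k fixed) nested)

  M⇔ : ∀ (x : Perm) k → M c x k ⇔ (Dn x k × Up x k × L c k)
  M⇔ x k = mk⇔ (λ (d , u , l) → Equivalence.to (D⇔ x k) d , Equivalence.to (U⇔ x k) u , l)
               (λ (d , u , l) → Equivalence.from (D⇔ x k) d , Equivalence.from (U⇔ x k) u , l)

  N? : ∀ (x : Perm) → Decidable (N c x)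
  N? x k = map′ (Equivalence.from (N⇔ x k)) (Equivalence.to (N⇔ x k))
    (L? k ×-dec ((x $ k Fin.≟ k) ×-dec Finₚ.any? λ a → Finₚ.any? λ b → (a Fin.<? k) ×-dec ((k Fin.<? b) ×-dec orbit? x a b)))

  M? : ∀ (x : Perm) → Decidable (M c x)
  M? x k = map′ (Equivalence.from (M⇔ x k)) (Equivalence.to (M⇔ x k)) (Dn? x k ×-dec (Up? x k ×-dec L? k))

  module Conditions (x : Perm) (geo : Geo x) where

    H : Label → Set
    H = High (Dn? x) (Up? x)

    -- The two conditions have the same shape: A is the set of steps in question, B the
    -- opposite one, and the polygons have their end of the relevant kind on A but not on B.
    module _ {A B Step End : Label → Set} (step : ∀ k → Step k ⇔ A k) (end : ∀ k → End k ⇔ (A k × ¬ B k))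
             (A? : Decidable A) (B? : Decidable B) (inner : ∀ k → (A k × B k) ⇔ (Dn x k × Up x k))
             (fixed : ∀ {k} → x $ k ≡ k → ¬ A k × ¬ B k) (unfixed : ∀ {k} → ¬ A k → ¬ B k → x $ k ≡ k) where

      Condition : Label → Set
      Condition k = (R c k × Step k) ⊎ (L c k × End k) ⊎ N c x k

      private
        M⇒inner : ∀ {k} → M c x k → A k × B k × L c k
        M⇒inner {k} mk with Equivalence.to (M⇔ x k) mk
        ... | d , u , l with Equivalence.from (inner k) (d , u)
        ... | a , b = a , b , l
        inner⇒M : ∀ {k} → A k → B k → L c k → M c x k
        inner⇒M {k} a b l with Equivalence.to (inner k) (a , b)
        ... | d , u = Equivalence.from (M⇔ x k) (d , u , l)

      -- The right side is what the definition of `inv_c` does to `A`: all of `N` enters, then all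
      -- of `M` leaves.
      condition⇔modified : ∀ k → Condition k ⇔ ((A k ⊎ N c x k) × ¬ M c x k)
      condition⇔modified k = mk⇔ to from
        where
        to : Condition k → (A k ⊎ N c x k) × ¬ M c x k
        to (inj₁ (r , st)) = inj₁ (Equivalence.to (step k) st) , λ mk → let (a , b , l) = M⇒inner mk in
          ends-not-inner x r l (Equivalence.to (inner k) (a , b))
        to (inj₂ (inj₁ (l , e))) = inj₁ (proj₁ (Equivalence.to (end k) e)) , λ mk → let (_ , b , _) = M⇒inner mk in
          proj₂ (Equivalence.to (end k) e) b
        to (inj₂ (inj₂ nk)) = inj₂ nk , λ mk → let (a , _ , _) = M⇒inner mk in
          proj₁ (fixed (proj₁ (proj₂ (Equivalence.to (N⇔ x k) nk)))) a
        from : (A k ⊎ N c x k) × ¬ M c x k → Condition k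
        from (inj₂ nk , _) = inj₂ (inj₂ nk)
        from (inj₁ a , ¬mk) with R? k
        ... | yes r = inj₁ (r , Equivalence.from (step k) a)
        ... | no ¬r = inj₂ (inj₁ (¬R⇒L ¬r , Equivalence.from (end k) (a , λ b → ¬mk (inner⇒M a b (¬R⇒L ¬r)))))

      -- For fixed labels, nestedness is positive height. The two labels in both `R` and `L` are
      -- caught by the first clause of `Flip` or cannot be nested.
      condition⇔flip : ∀ k → Condition k ⇔ Flip A B H k
      condition⇔flip k = mk⇔ to from
        where
        to : Condition k → Flip A B H k
        to (inj₁ (r , st)) = inj₁ (r , Equivalence.to (step k) st)
        to (inj₂ (inj₁ (l , e))) with R? k
        ... | yes r = inj₁ (r , proj₁ (Equivalence.to (end k) e))
        ... | no ¬r = inj₂ (¬r , inj₁ (Equivalence.to (end k) e))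
        to (inj₂ (inj₂ nk)) with Equivalence.to (N⇔ x k) nk | R? k
        ... | l , _ , nested | yes r = contradiction nested (ends-not-nested x r l)
        ... | l , xk , nested | no ¬r = inj₂ (¬r , inj₂ (proj₁ (fixed xk) , proj₂ (fixed xk) ,
                Equivalence.to (nested⇔high x geo k xk) nested))
        from : Flip A B H k → Condition k
        from (inj₁ (r , a)) = inj₁ (r , Equivalence.from (step k) a)
        from (inj₂ (¬r , inj₁ ab)) = inj₂ (inj₁ (¬R⇒L ¬r , Equivalence.from (end k) ab))
        from (inj₂ (¬r , inj₂ (¬a , ¬b , high))) = inj₂ (inj₂ (Equivalence.from (N⇔ x k)
          (¬R⇒L ¬r , unfixed ¬a ¬b , Equivalence.from (nested⇔high x geo k (unfixed ¬a ¬b)) high)))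

    private
      swap : ∀ {A B : Set} → A × B → B × A
      swap (a , b) = b , a

    J⇔modified : ∀ k → JCondition c x k ⇔ ((Dn x k ⊎ N c x k) × ¬ M c x k)
    J⇔modified = condition⇔modified (D⇔ x) (initial⇔ x) (Dn? x) (Up? x) (λ _ → mk⇔ id id)
      (λ xk → fixed⇒¬Dn x xk , fixed⇒¬Up x xk) (λ ¬d ¬u → ¬Up∧¬Dn⇒fixed x ¬u ¬d)

    I⇔modified : ∀ k → ICondition c x k ⇔ ((Up x k ⊎ N c x k) × ¬ M c x k)
    I⇔modified = condition⇔modified (U⇔ x) (terminal⇔ x) (Up? x) (Dn? x) (λ _ → mk⇔ swap swap)
      (λ xk → fixed⇒¬Up x xk , fixed⇒¬Dn x xk) (¬Up∧¬Dn⇒fixed x)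

    J⇔flip : ∀ k → JCondition c x k ⇔ Flip (Dn x) (Up x) H k
    J⇔flip = condition⇔flip (D⇔ x) (initial⇔ x) (Dn? x) (Up? x) (λ _ → mk⇔ id id)
      (λ xk → fixed⇒¬Dn x xk , fixed⇒¬Up x xk) (λ ¬d ¬u → ¬Up∧¬Dn⇒fixed x ¬u ¬d)

    I⇔flip : ∀ k → ICondition c x k ⇔ Flip (Up x) (Dn x) H k
    I⇔flip = condition⇔flip (U⇔ x) (terminal⇔ x) (Up? x) (Dn? x) (λ _ → mk⇔ swap swap)
      (λ xk → fixed⇒¬Up x xk , fixed⇒¬Dn x xk) (¬Up∧¬Dn⇒fixed x)

    inv-side : {_▷_ : ∀ {m} → Fin m → Fin m → Set} {S : ∀ {m} → Permutation′ m → Fin m → Set} → Side _▷_ S →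
               (∀ k → M c x k → S x k) → ∀ {y} → Inv c x y → ∀ k → S y k ⇔ ((S x k ⊎ N c x k) × ¬ M c x k)
    inv-side side inner {y} (ks , x′ , _ , ks⇔N , adds , _ , pol≐) k = ⇔-trans
      (without-effect {x = x′} {y} (M? x) (λ b mb → Equivalence.from (added b) (inj₁ (inner b mb))) pol≐ k)
      (mk⇔ (λ (sx′ , ¬mk) → to (Equivalence.to (added k) sx′) , ¬mk) (λ (sx , ¬mk) → Equivalence.from (added k) (from sx) , ¬mk))
      where
      open Effects side
      added = adds-effect {c = c} ks {x} {x′} adds
      to : _ ⊎ k ∈ₗ ks → _ ⊎ N c x k
      to (inj₁ sx) = inj₁ sx
      to (inj₂ k∈) = inj₂ (Equivalence.to (ks⇔N k) k∈)
      from : _ ⊎ N c x k → _ ⊎ k ∈ₗ ks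
      from (inj₁ sx) = inj₁ sx
      from (inj₂ nk) = inj₂ (Equivalence.from (ks⇔N k) nk)

    inv-dn : ∀ {y} → Inv c x y → ∀ k → Dn y k ⇔ JCondition c x k
    inv-dn {y} inv k = ⇔-trans (inv-side dn-side (λ k mk → proj₁ (Equivalence.to (M⇔ x k) mk)) {y} inv k) (⇔-sym (J⇔modified k))

    inv-up : ∀ {y} → Inv c x y → ∀ k → Up y k ⇔ ICondition c x k
    inv-up {y} inv k = ⇔-trans (inv-side up-side (λ k mk → proj₁ (proj₂ (Equivalence.to (M⇔ x k) mk))) {y} inv k) (⇔-sym (I⇔modified k))

    inv-exists : ∃ λ y → Geo y × Inv c x y
    inv-exists = fill (add-vertices ks x geo uniq (All.tabulate λ k∈ → proj₂ (Equivalence.to (N⇔ x _) (Equivalence.to (ks⇔N _) k∈))))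
      where
      ks = filter (N? x) (allFin (suc n))
      uniq : Unique ks
      uniq = Uniqueₚ.filter⁺ (N? x) (Uniqueₚ.allFin⁺ (suc n))
      ks⇔N : ∀ k → k ∈ₗ ks ⇔ N c x k
      ks⇔N k = mk⇔ (λ k∈ → proj₂ (∈ₗₚ.∈-filter⁻ (N? x) {xs = allFin (suc n)} k∈)) (∈ₗₚ.∈-filter⁺ (N? x) (∈ₗₚ.∈-allFin k))
      fill : (∃ λ z → Geo z × AddVertices c ks x z) → ∃ λ y → Geo y × Inv c x y
      fill (z , geo-z , adds) = empty (strip-without z geo-z (M? x) λ v mv →
          Equivalence.from (Effects.adds-effect dn-side {c = c} ks {x} {z} adds v) (inj₁ (proj₁ (Equivalence.to (M⇔ x v) mv))) ,
          Equivalence.from (Effects.adds-effect up-side {c = c} ks {x} {z} adds v) (inj₁ (proj₁ (proj₂ (Equivalence.to (M⇔ x v) mv)))))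
        where
        empty : _ → ∃ λ y → Geo y × Inv c x y
        empty (y , geo-y , pol≐) = y , geo-y , ks , z , uniq , ks⇔N , adds , geo⇒≤T y geo-y , pol≐

    abstract
      image : ∃ λ w → FullyCommutative w × (∀ k → k Fin.< (w $ k) ⇔ Flip (Dn x) (Up x) H k) ×
                      (∀ k → (w ⟨$⟩ˡ k) Fin.< k ⇔ Flip (Up x) (Dn x) H k)
      image = FromPath.element (flip? (Dn? x) (Up? x) (High? (Dn? x) (Up? x))) (flip? (Up? x) (Dn? x) (High? (Dn? x) (Up? x)))
        (flip-valid (Dn? x) (Up? x) (bits-valid x geo))

  open Conditions using (H)

  high-cong : {A B A′ B′ : Label → Set} (A? : Decidable A) (B? : Decidable B) (A′? : Decidable A′) (B′? : Decidable B′) →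
              (∀ k → A k ⇔ A′ k) → (∀ k → B k ⇔ B′ k) → ∀ k → High A? B? k ⇔ High A′? B′? k
  high-cong A? B? A′? B′? a b k = mk⇔
    (subst₂ _<_ (cnt-cong B? B′? b (toℕ k)) (cnt-cong A? A′? a (toℕ k)))
    (subst₂ _<_ (sym (cnt-cong B? B′? b (toℕ k))) (sym (cnt-cong A? A′? a (toℕ k))))

  module _ {A B F G : Label → Set} (A? : Decidable A) (B? : Decidable B) (F? : Decidable F) (G? : Decidable G)
           (valid : Valid A? B?) (f : ∀ k → F k ⇔ Flip A B (High A? B?) k) (g : ∀ k → G k ⇔ Flip B A (High A? B?) k) where

    private
      high : ∀ k → High F? G? k ⇔ High A? B? k
      high k = ⇔-trans (high-cong F? G? (flip? A? B? (High? A? B?)) (flip? B? A? (High? A? B?)) f g k) (⇔-sym (flip-high A? B? k))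

    -- `F` and `G` are given only up to equivalence: they are the exchanged sets themselves for
    -- injectivity, and the bits of a drawn element for surjectivity.
    unflip : ∀ k → Flip F G (High F? G?) k ⇔ A k
    unflip k = ⇔-trans (flip-cong f g high k) (flip-involutive A? B? (λ k _ b → Valid.ballot valid k b) k)

    unflip′ : ∀ k → Flip G F (High F? G?) k ⇔ B k
    unflip′ k = ⇔-trans (flip-cong g f high k) (flip-involutive B? A? (λ k b _ → Valid.ballot valid k b) k)

  flips-cong : ∀ (x y : Perm) → SameBits x y → ∀ k →
               (Flip (Dn x) (Up x) (High (Dn? x) (Up? x)) k ⇔ Flip (Dn y) (Up y) (High (Dn? y) (Up? y)) k) ×
               (Flip (Up x) (Dn x) (High (Dn? x) (Up? x)) k ⇔ Flip (Up y) (Dn y) (High (Dn? y) (Up? y)) k)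
  flips-cong x y (dn , up) k = flip-cong dn up high k , flip-cong up dn high k
    where
    high = high-cong (Dn? x) (Up? x) (Dn? y) (Up? y) dn up

  -- The value has the exchanged path of `x` as its excedances; no diagram of `inv_c x` is involved
  -- yet.
  φ : Setoid.Carrier (NC c) → Setoid.Carrier (FC n)
  φ (x , x≤c) = proj₁ image , proj₁ (proj₂ image)
    where open Conditions x (≤T⇒geo x x≤c)

  φ-positions : ∀ X k → k Fin.< (proj₁ (φ X) $ k) ⇔ Flip (Dn (proj₁ X)) (Up (proj₁ X)) (High (Dn? (proj₁ X)) (Up? (proj₁ X))) k
  φ-positions (x , x≤c) = proj₁ (proj₂ (proj₂ (Conditions.image x (≤T⇒geo x x≤c))))

  φ-values : ∀ X k → (proj₁ (φ X) ⟨$⟩ˡ k) Fin.< k ⇔ Flip (Up (proj₁ X)) (Dn (proj₁ X)) (High (Dn? (proj₁ X)) (Up? (proj₁ X))) k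
  φ-values (x , x≤c) = proj₂ (proj₂ (proj₂ (Conditions.image x (≤T⇒geo x x≤c))))

  φ-J : ∀ X k → k Fin.< (proj₁ (φ X) $ k) ⇔ JCondition c (proj₁ X) k
  φ-J X@(x , x≤c) k = ⇔-trans (φ-positions X k) (⇔-sym (Conditions.J⇔flip x (≤T⇒geo x x≤c) k))

  φ-I : ∀ X k → (proj₁ (φ X) ⟨$⟩ˡ k) Fin.< k ⇔ ICondition c (proj₁ X) k
  φ-I X@(x , x≤c) k = ⇔-trans (φ-values X k) (⇔-sym (Conditions.I⇔flip x (≤T⇒geo x x≤c) k))

  φ-determined : ∀ X {w} → FullyCommutative w → (∀ k → k Fin.< (w $ k) ⇔ JCondition c (proj₁ X) k) →
                 (∀ k → (w ⟨$⟩ˡ k) Fin.< k ⇔ ICondition c (proj₁ X) k) → w ≈ proj₁ (φ X)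
  φ-determined X {w} fc j i = fc-unique {w = w} {proj₁ (φ X)} fc (proj₂ (φ X))
    (λ k → ⇔-trans (j k) (⇔-sym (φ-J X k))) (λ k → ⇔-trans (i k) (⇔-sym (φ-I X k)))

  φ-cong : ∀ {X Y : Setoid.Carrier (NC c)} → proj₁ X ≈ proj₁ Y → proj₁ (φ X) ≈ proj₁ (φ Y)
  φ-cong {X} {Y} x≈y = fc-unique {w = proj₁ (φ X)} {proj₁ (φ Y)} (proj₂ (φ X)) (proj₂ (φ Y))
      (λ k → ⇔-trans (φ-positions X k) (⇔-trans (proj₁ (flips k)) (⇔-sym (φ-positions Y k))))
      (λ k → ⇔-trans (φ-values X k) (⇔-trans (proj₂ (flips k)) (⇔-sym (φ-values Y k))))
    where
    flips = flips-cong (proj₁ X) (proj₁ Y)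
      (Effects.side-cong dn-side {x = proj₁ X} {proj₁ Y} x≈y , Effects.side-cong up-side {x = proj₁ X} {proj₁ Y} x≈y)

  -- The excedances of the value are the exchanged path, and exchanging again recovers the bits of
  -- `X`.
  φ-injective : ∀ {X Y : Setoid.Carrier (NC c)} → proj₁ (φ X) ≈ proj₁ (φ Y) → proj₁ X ≈ proj₁ Y
  φ-injective {X@(x , x≤c)} {Y@(y , y≤c)} eq = bits-injective {x} {y} (≤T⇒geo x x≤c) (≤T⇒geo y y≤c)
      ((λ k → ⇔-trans (⇔-sym (back x x≤c k)) (⇔-trans (flip-cong dn up high k) (back y y≤c k))) ,
       (λ k → ⇔-trans (⇔-sym (back′ x x≤c k)) (⇔-trans (flip-cong up dn high k) (back′ y y≤c k))))
    where
    Hₓ : Perm → Label → Set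
    Hₓ x = High (Dn? x) (Up? x)
    Fd Fu : Perm → Label → Set
    Fd x = Flip (Dn x) (Up x) (Hₓ x)
    Fu x = Flip (Up x) (Dn x) (Hₓ x)
    Fd? : ∀ (x : Perm) → Decidable (Fd x)
    Fd? x = flip? (Dn? x) (Up? x) (High? (Dn? x) (Up? x))
    Fu? : ∀ (x : Perm) → Decidable (Fu x)
    Fu? x = flip? (Up? x) (Dn? x) (High? (Dn? x) (Up? x))
    back : ∀ (x : Perm) → x ≤T c → ∀ k → Flip (Fd x) (Fu x) (High (Fd? x) (Fu? x)) k ⇔ Dn x k
    back x x≤c = unflip (Dn? x) (Up? x) (Fd? x) (Fu? x) (bits-valid x (≤T⇒geo x x≤c)) (λ _ → mk⇔ id id) (λ _ → mk⇔ id id)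
    back′ : ∀ (x : Perm) → x ≤T c → ∀ k → Flip (Fu x) (Fd x) (High (Fd? x) (Fu? x)) k ⇔ Up x k
    back′ x x≤c = unflip′ (Dn? x) (Up? x) (Fd? x) (Fu? x) (bits-valid x (≤T⇒geo x x≤c)) (λ _ → mk⇔ id id) (λ _ → mk⇔ id id)
    dn : ∀ k → Fd x k ⇔ Fd y k
    dn k = ⇔-trans (⇔-sym (φ-positions X k)) (⇔-trans
      (mk⇔ (subst (k Fin.<_) (eq k)) (subst (k Fin.<_) (sym (eq k)))) (φ-positions Y k))
    up : ∀ k → Fu x k ⇔ Fu y k
    up k = ⇔-trans (⇔-sym (φ-values X k)) (⇔-trans
      (mk⇔ (subst (Fin._< k) (inv k)) (subst (Fin._< k) (sym (inv k)))) (φ-values Y k))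
      where inv = inverse-cong {v = proj₁ (φ X)} {proj₁ (φ Y)} eq
    high : ∀ k → High (Fd? x) (Fu? x) k ⇔ High (Fd? y) (Fu? y) k
    high = high-cong (Fd? x) (Fu? x) (Fd? y) (Fu? y) dn up

  -- The excedances of `w` form a path; an element drawn from its exchange has them as its own
  -- exchanged path.
  φ-surjective : ∀ (W : Setoid.Carrier (FC n)) → ∃ λ X → proj₁ (φ X) ≈ proj₁ W
  φ-surjective (w , fc) = preimage (Scan.bits-surjective coxeter-circle F? G? (flip-valid E? X? valid))
    where
    E? = Exceeds? w
    X? = Exceeded? w
    valid = excedance-valid w
    F? = flip? E? X? (High? E? X?)
    G? = flip? X? E? (High? E? X?)
    preimage : (∃ λ x → Geo x × (∀ k → Dn x k ⇔ Flip (Exceeds w) (Exceeded w) (High E? X?) k) ×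
                                (∀ k → Up x k ⇔ Flip (Exceeded w) (Exceeds w) (High E? X?) k)) →
               ∃ λ X → proj₁ (φ X) ≈ w
    preimage (x , geo , dn , up) = X , fc-unique {w = proj₁ (φ X)} {w} (proj₂ (φ X)) fc
        (λ k → ⇔-trans (φ-positions X k) (unflip E? X? (Dn? x) (Up? x) valid dn up k))
        (λ k → ⇔-trans (φ-values X k) (unflip′ E? X? (Dn? x) (Up? x) valid dn up k))
      where
      X : Setoid.Carrier (NC c)
      X = x , geo⇒≤T x geo

  φ-bijection : Bijection (NC c) (FC n)
  φ-bijection = record
    { to = φ
    ; cong = λ {X} {Y} → φ-cong {X} {Y}
    ; bijective = (λ {X} {Y} → φ-injective {X} {Y}) ,
        λ W → proj₁ (φ-surjective W) , λ {Z} Z≈X a →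
          trans (φ-cong {Z} {proj₁ (φ-surjective W)} Z≈X a) (proj₂ (φ-surjective W) a) }

  Φ⇒φ : ∀ X {w} → Φ c (proj₁ X) w → w ≈ proj₁ (φ X)
  Φ⇒φ X@(x , x≤c) {w} (p , (y , inv , down , up) , fc , J≡ , I≡) = φ-determined X {w} fc
      (λ k → ⇔-trans (⇔-sym (∈J⇔ {w = w} fc k)) (⇔-trans (⇔-sym (J≡ k)) (⇔-trans (down k)
        (⇔-trans (D⇔ y k) (inv-dn {y} inv k)))))
      (λ k → ⇔-trans (⇔-sym (∈I⇔ {w = w} fc k)) (⇔-trans (⇔-sym (I≡ k)) (⇔-trans (up k)
        (⇔-trans (U⇔ y k) (inv-up {y} inv k)))))
    where open Conditions x (≤T⇒geo x x≤c)

  -- Here the existence of the intermediate element is used: `inv_c x` is actually constructed, and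
  -- its path supplies the pair in `𝓘 n`.
  φ⇒Φ : ∀ X {w} → w ≈ proj₁ (φ X) → Φ c (proj₁ X) w
  φ⇒Φ X@(x , x≤c) {w} eq = build inv-exists
    where
    open Conditions x (≤T⇒geo x x≤c)
    fc : FullyCommutative w
    fc = fc-cong {v = proj₁ (φ X)} {w} (sym ∘ eq) (proj₂ (φ X))
    build : (∃ λ y → Geo y × Inv c x y) → Φ c x w
    build (y , geo-y , inv) = FromPath.pair (Dn? y) (Up? y) (bits-valid y geo-y) ,
      (y , inv , (λ k → ⇔-trans (∈-subsetOf (Dn? y) k) (⇔-sym (D⇔ y k))) ,
                 (λ k → ⇔-trans (∈-subsetOf (Up? y) k) (⇔-sym (U⇔ y k)))) ,
      fc ,
      (λ k → ⇔-trans (∈-subsetOf (Dn? y) k) (⇔-trans (inv-dn {y} inv k) (⇔-trans (⇔-sym (φ-J X k)) (⇔-trans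
        (mk⇔ (subst (k Fin.<_) (sym (eq k))) (subst (k Fin.<_) (eq k))) (⇔-sym (∈J⇔ {w = w} fc k)))))) ,
      (λ k → ⇔-trans (∈-subsetOf (Up? y) k) (⇔-trans (inv-up {y} inv k) (⇔-trans (⇔-sym (φ-I X k)) (⇔-trans
        (mk⇔ (subst (Fin._< k) (sym (inverse k))) (subst (Fin._< k) (inverse k))) (⇔-sym (∈I⇔ {w = w} fc k))))))
      where
      inverse : ∀ k → w ⟨$⟩ˡ k ≡ proj₁ (φ X) ⟨$⟩ˡ k
      inverse = inverse-cong {v = w} {proj₁ (φ X)} eq

standard-unimodal : {c : Permutation′ (suc n)} → StandardCoxeter c → Unimodal c
standard-unimodal {c = c} (is , is↭ , is≈c) = unimodal-cong {c = ⟦ is ⟧} {c} is≈c (coxeter-unimodal is is↭)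

theorem3p14 : ∀ (n : ℕ) → 1 ≤ n →
    ∀ (c : Permutation′ (suc n)) → StandardCoxeter c →
    Σ (Bijection (NC c) (FC n)) λ φ →
    let φ[_] = λ (x : Setoid.Carrier (NC c)) → proj₁ (Bijection.to φ x) in
    (∀ x w → Φ c (proj₁ x) w ⇔ w ≈ φ[ x ])
    × (∀ x k → (k ∈J φ[ x ] ⇔ JCondition c (proj₁ x) k)
    × (k ∈I[1] φ[ x ] ⇔ ICondition c (proj₁ x) k))
    × (∀ x (w : Setoid.Carrier (FC n)) →
    (∀ k → (k ∈J proj₁ w ⇔ JCondition c (proj₁ x) k)
    × (k ∈I[1] proj₁ w ⇔ ICondition c (proj₁ x) k)) →
    proj₁ w ≈ φ[ x ])
theorem3p14 n _ c coxeter = φ-bijection ,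
    (λ x w → mk⇔ (Φ⇒φ x {w}) (φ⇒Φ x {w})) ,
    (λ x k → ⇔-trans (∈J⇔ {w = proj₁ (φ x)} (proj₂ (φ x)) k) (φ-J x k) ,
             ⇔-trans (∈I⇔ {w = proj₁ (φ x)} (proj₂ (φ x)) k) (φ-I x k)) ,
    λ x (w , fc) same → φ-determined x {w} fc
      (λ k → ⇔-trans (⇔-sym (∈J⇔ {w = w} fc k)) (proj₁ (same k)))
      (λ k → ⇔-trans (⇔-sym (∈I⇔ {w = w} fc k)) (proj₂ (same k)))
  where open Characterisation (standard-unimodal {c = c} coxeter)
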